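{- For each $n\ge 1$ let $\pi$ be chosen uniformly at random from $Av_n(312)$, and let $\gamma_\pi$ denote the size of the biggest sub-permutation of $\pi$ that belongs to $Av(213)$. Then the expected value $E_n(\gamma)=\frac{1}{|Av_n(312)|}\sum_{\pi\in Av_n(312)}\gamma_\pi$ satisfies $$E_n(\gamma)\sim \log_2(n)\qquad (n\to\infty),$$ i.e. $E_n(\gamma)/\log_2(n)\to 1$.
   Context: $\mathcal{S}_n$ is the set of permutations $\pi=\pi_1\pi_2\dots\pi_n$ of $\{1,\dots,n\}$ in one-line notation. $Av_n(\sigma)\subseteq \mathcal{S}_n$ is the set of permutations of size $n$ avoiding the pattern $\sigma$ in the classical sense (no subsequence, not necessarily consecutive, is order-isomorphic to $\sigma$), and $Av(\sigma)=\bigcup_n Av_n(\sigma)$. For an entry $\pi_i$ of $\pi$, let $s_\pi(\pi_i)$ be the biggest sub-string (block of consecutive positions) of $\pi$ that contains $\pi_i$ and all of whose entries are greater than or equal to $\pi_i$. The sub-permutation of $\pi$ generated by $\pi_i$, denoted $g_\pi(\pi_i)$, is the permutation obtained by rescaling $s_\pi(\pi_i)$ (replacing its entries by $1,2,\dots,|s_\pi(\pi_i)|$ in an order-preserving way). The sub-permutations of $\pi$ are the permutations $g_\pi(\pi_i)$, $1\le i\le n$. The size of a permutation is its number of entries. -}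

module Defs where

module Permutations where

  open import Data.Fin.Base using (zero; suc; cast)
  open import Data.Fin.Properties as Fin using ()
  open import Data.Integer.Base as ℤ using (+_)
  open import Data.List.Base hiding (_∷ʳ_; find; sum)
  open import Data.List.Extrema.Nat using (argmax; max)
  open import Data.List.Membership.Propositional using (_∈_; lose; find)
  open import Data.List.Membership.Propositional.Properties
    using (∈-++⁺ˡ; ∈-++⁺ʳ; ∈-++⁻; ∈-map⁺; ∈-map⁻; ∈-filter⁺; ∈-cartesianProductWith⁺; ∈-length)
  open import Data.List.Properties using (length-applyUpTo)
  open import Data.List.Relation.Binary.Sublist.Propositional as Sublist using (_⊆_; []; _∷_; _∷ʳ_)
  open import Data.List.Relation.Unary.All as All using (All; []; _∷_)
  open import Data.List.Relation.Unary.AllPairs as AllPairs using (AllPairs; []; _∷_)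
  open import Data.List.Relation.Unary.AllPairs.Properties using (applyUpTo⁺₁)
  open import Data.List.Relation.Unary.Any as Any using (here; there)
  open import Data.Nat.Base using (ℕ; zero; suc; _≤_; _<_; z≤n; s≤s; NonZero; >-nonZero)
  open import Data.Nat.ListAction using (sum)
  open import Data.Nat.Properties as ℕ using (_≟_; _≤?_; _<?_)
  open import Data.Product.Base using (∃-syntax; Σ-syntax; _×_; _,_; proj₁; uncurry)
  open import Data.Rational.Unnormalised.Base using (ℚᵘ; _/_)
  open import Data.Sum.Base using (inj₁; inj₂)
  open import Function.Base using (_∘_)
  open import Function.Bundles using (_⇔_; mk⇔; Equivalence)
  open import Relation.Binary.PropositionalEquality using (_≡_; refl; sym; cong; subst)
  open import Relation.Nullary.Decidable using (Dec; yes; no; ¬?; map′; _×-dec_; _→-dec_)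
  open import Relation.Nullary.Negation using (¬_)
  open import Relation.Unary using (Decidable)
  open import Data.List.Membership.DecPropositional _≟_ using (_∈?_)
  open import Data.List.Relation.Unary.Unique.DecPropositional _≟_ using (Unique; unique?)

  -- Permutations are lists π₁ ∷ … ∷ πₙ ∷ [] in one-line notation.

  [1⋯_] : ℕ → List ℕ
  [1⋯ n ] = applyUpTo suc n

  words : ℕ → List ℕ → List (List ℕ)
  words zero    as = [] ∷ []
  words (suc k) as = cartesianProductWith _∷_ as (words k as)

  -- Words of length n over {1, …, n} without a repeated letter; each
  -- permutation is listed exactly once.
  permutations : ℕ → List (List ℕ)
  permutations n = filter unique? (words n [1⋯ n ])

  infix 4 _≅_ _≅?_

  -- Order-isomorphism.
  _≅_ : List ℕ → List ℕ → Set
  xs ≅ ys = Σ[ eq ∈ length xs ≡ length ys ] (∀ i j →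
    (lookup xs i < lookup xs j) ⇔
    (lookup ys (cast eq i) < lookup ys (cast eq j)))

  Contains : List ℕ → List ℕ → Set
  Contains σ π = ∃[ τ ] (τ ⊆ π × τ ≅ σ)

  Avoids : List ℕ → List ℕ → Set
  Avoids σ π = ¬ Contains σ π

  _≅?_ : ∀ xs ys → Dec (xs ≅ ys)
  xs ≅? ys with length xs ≟ length ys
  ... | no  ne = no (ne ∘ proj₁)
  ... | yes eq = map′ (eq ,_) (λ (_ , iso) → iso)
    (Fin.all? λ i → Fin.all? λ j → map′ (uncurry mk⇔) (λ e → Equivalence.to e , Equivalence.from e)
      ((_ <? _ →-dec _ <? _) ×-dec (_ <? _ →-dec _ <? _)))

  subsequences : List ℕ → List (List ℕ)
  subsequences []       = [] ∷ []
  subsequences (x ∷ xs) = subsequences xs ++ map (x ∷_) (subsequences xs)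

  ∈-subsequences⁻ : ∀ {τ} π → τ ∈ subsequences π → τ ⊆ π
  ∈-subsequences⁻ []      (here refl) = []
  ∈-subsequences⁻ (x ∷ π) τ∈ with ∈-++⁻ (subsequences π) τ∈
  ... | inj₁ τ∈′ = x ∷ʳ ∈-subsequences⁻ π τ∈′
  ... | inj₂ τ∈′ with ∈-map⁻ (x ∷_) τ∈′
  ...   | _ , τ∈″ , refl = refl ∷ ∈-subsequences⁻ π τ∈″

  ∈-subsequences⁺ : ∀ {τ π} → τ ⊆ π → τ ∈ subsequences π
  ∈-subsequences⁺ []         = here refl
  ∈-subsequences⁺ (x ∷ʳ τ⊆π) = ∈-++⁺ˡ (∈-subsequences⁺ τ⊆π)
  ∈-subsequences⁺ {π = _ ∷ π} (refl ∷ τ⊆π) = ∈-++⁺ʳ (subsequences π) (∈-map⁺ (_ ∷_) (∈-subsequences⁺ τ⊆π))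

  contains? : ∀ σ → Decidable (Contains σ)
  contains? σ π = map′
    (λ any → let τ , τ∈ , τ≅σ = find any in τ , ∈-subsequences⁻ π τ∈ , τ≅σ)
    (λ (_ , τ⊆π , τ≅σ) → lose (∈-subsequences⁺ τ⊆π) τ≅σ)
    (Any.any? (_≅? σ) (subsequences π))

  avoids? : ∀ σ → Decidable (Avoids σ)
  avoids? σ π = ¬? (contains? σ π)

  Av : ℕ → List ℕ → List (List ℕ)
  Av n σ = filter (avoids? σ) (permutations n)

  substrings : List ℕ → List (List ℕ)
  substrings π = concatMap inits (tails π)

  -- The entries of a permutation are distinct, so an entry πᵢ is given by its
  -- value x.  The default [] is never returned, as x ∷ [] is a candidate.
  s : List ℕ → ℕ → List ℕ
  s π x = argmax length []
    (filter (λ u → (x ∈? u) ×-dec All.all? (x ≤?_) u) (substrings π))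

  -- The new value of an entry is the number of entries that do not exceed it.
  rescale : List ℕ → List ℕ
  rescale u = map (λ y → length (filter (_≤? y) u)) u

  g : List ℕ → ℕ → List ℕ
  g π x = rescale (s π x)

  subpermutations : List ℕ → List (List ℕ)
  subpermutations π = map (g π) π

  p213 p312 : List ℕ
  p213 = 2 ∷ 1 ∷ 3 ∷ []
  p312 = 3 ∷ 1 ∷ 2 ∷ []

  -- The default 0 plays no role for n ≥ 1: the entry n generates 1 ∈ Av(213).
  γ : List ℕ → ℕ
  γ π = max 0 (map length (filter (avoids? p213) (subpermutations π)))

  private
    ∈-words : ∀ {as} w → All (_∈ as) w → w ∈ words (length w) as
    ∈-words []      []         = here refl
    ∈-words (x ∷ w) (x∈ ∷ w∈) = ∈-cartesianProductWith⁺ _∷_ x∈ (∈-words w w∈)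

    [1⋯n]↗ : ∀ n → AllPairs _<_ [1⋯ n ]
    [1⋯n]↗ n = applyUpTo⁺₁ suc n (λ i<j _ → s≤s i<j)

    ↗-⊆ : ∀ {xs ys} → xs ⊆ ys → AllPairs _<_ ys → AllPairs _<_ xs
    ↗-⊆ []           []       = []
    ↗-⊆ (_ ∷ʳ p)     (_ ∷ ↗)  = ↗-⊆ p ↗
    ↗-⊆ (refl ∷ p)   (x< ∷ ↗) = All.tabulate (λ y∈ → All.lookup x< (Sublist.lookup p y∈)) ∷ ↗-⊆ p ↗

    ↗-avoids-312 : ∀ {π} → AllPairs _<_ π → Avoids p312 π
    ↗-avoids-312 ↗ (a ∷ b ∷ c ∷ [] , τ⊆π , refl , iso)
      with ((a<b ∷ _) ∷ _) ← ↗-⊆ τ⊆π ↗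
      with s≤s () ← Equivalence.to (iso zero (suc zero)) a<b

    [1⋯n]∈Av : ∀ n → [1⋯ n ] ∈ Av n p312
    [1⋯n]∈Av n = ∈-filter⁺ (avoids? p312)
      (∈-filter⁺ unique?
        (subst (λ k → [1⋯ n ] ∈ words k [1⋯ n ]) (length-applyUpTo suc n)
          (∈-words [1⋯ n ] (All.tabulate (λ y∈ → y∈))))
        (AllPairs.map ℕ.<⇒≢ ([1⋯n]↗ n)))
      (↗-avoids-312 ([1⋯n]↗ n))

    Av-nonZero : ∀ n → NonZero (length (Av n p312))
    Av-nonZero n = >-nonZero (∈-length ([1⋯n]∈Av n))

  E : ℕ → ℚᵘ
  E n = _/_ (+ sum (map γ (Av n p312))) (length (Av n p312)) {{Av-nonZero n}}

module Reals where

  open import Data.Empty using (⊥)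
  open import Data.Integer.Base as ℤ using (+_; -[1+_])
  import Data.Integer.Properties as ℤ
  open import Data.Nat.Base as ℕ using (ℕ; zero; suc; z≤n; s≤s; NonZero)
  import Data.Nat.Properties as ℕ
  open import Data.Nat.Tactic.RingSolver using (solve-∀)
  open import Data.Product.Base using (∃; ∃₂; ∃-syntax; _×_; _,_; proj₁; proj₂)
  open import Data.Rational.Unnormalised.Base as ℚ
    using (ℚᵘ; mkℚᵘ; 0ℚᵘ; 1ℚᵘ; _<_; _*_; _+_; _-_; -_; *<*; 1/_; positive; >-nonZero)
  open import Data.Rational.Unnormalised.Properties as ℚ
    using (<-trans; <-asym; <-cmp; <-dense; ≃-sym; ≃-trans; <-respˡ-≃; <-respʳ-≃)
  open import Data.Sum.Base using (_⊎_; inj₁; inj₂; [_,_]′)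
  open import Data.Unit.Base using (⊤; tt)
  open import Relation.Binary.Definitions using (tri<; tri≈; tri>)
  open import Relation.Binary.PropositionalEquality using (_≡_; refl; sym; cong; subst₂)
  open import Relation.Nullary.Decidable using (yes; no)
  open import Relation.Nullary.Negation using (contradiction)

  record ℝ : Set₁ where
    field
      Lower Upper     : ℚᵘ → Set
      lower-inhabited : ∃ Lower
      upper-inhabited : ∃ Upper
      lower-closed    : ∀ {q r} → q < r → Lower r → Lower q
      upper-closed    : ∀ {q r} → q < r → Upper q → Upper r
      lower-open      : ∀ {q} → Lower q → ∃[ r ] (q < r × Lower r)
      upper-open      : ∀ {r} → Upper r → ∃[ q ] (q < r × Upper q)
      disjoint        : ∀ {q} → Lower q → Upper q → ⊥
      located         : ∀ {q r} → q < r → Lower q ⊎ Upper r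

    lower<upper : ∀ {q r} → Lower q → Upper r → q < r
    lower<upper {q} {r} l u with <-cmp q r
    ... | tri< q<r _ _ = q<r
    ... | tri≈ _ q≃r _ with r′ , q<r′ , l′ ← lower-open l =
      contradiction (upper-closed (<-respˡ-≃ q≃r q<r′) u) (disjoint l′)
    ... | tri> _ _ r<q = contradiction (upper-closed r<q u) (disjoint l)

  open ℝ

  infix 4 _<ʳ_ _ʳ<_

  _<ʳ_ : ℚᵘ → ℝ → Set
  q <ʳ x = Lower x q

  _ʳ<_ : ℝ → ℚᵘ → Set
  x ʳ< q = Upper x q


  log₂-Lower : ℕ → ℚᵘ → Set
  log₂-Lower n (mkℚᵘ (+ p)    d-1) = 2 ℕ.^ p ℕ.< n ℕ.^ suc d-1
  log₂-Lower n (mkℚᵘ -[1+ _ ] _)   = ⊤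

  log₂-Upper : ℕ → ℚᵘ → Set
  log₂-Upper n (mkℚᵘ (+ p)    d-1) = n ℕ.^ suc d-1 ℕ.< 2 ℕ.^ p
  log₂-Upper n (mkℚᵘ -[1+ _ ] _)   = ⊥

  private
    module _ where
      open ℕ.≤-Reasoning

      drop-+ : ∀ {p d q e} → mkℚᵘ (+ p) d < mkℚᵘ (+ q) e → p ℕ.* suc e ℕ.< q ℕ.* suc d
      drop-+ {p} {d} {q} {e} (*<* lt) = ℤ.drop‿+<+
        (subst₂ ℤ._<_ (sym (ℤ.pos-* p (suc e))) (sym (ℤ.pos-* q (suc d))) lt)

      lift-+ : ∀ {p d q e} → p ℕ.* suc e ℕ.< q ℕ.* suc d → mkℚᵘ (+ p) d < mkℚᵘ (+ q) e
      lift-+ {p} {d} {q} {e} lt = *<*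
        (subst₂ ℤ._<_ (ℤ.pos-* p (suc e)) (ℤ.pos-* q (suc d)) (ℤ.+<+ lt))

      +≮- : ∀ {p d q e} → mkℚᵘ (+ p) d < mkℚᵘ -[1+ q ] e → ⊥
      +≮- {p} {d} {q} {e} (*<* lt) with subst₂ ℤ._<_ (sym (ℤ.pos-* p (suc e))) refl lt
      ... | ()

      ^-comm : ∀ m a b → (m ℕ.^ a) ℕ.^ b ≡ (m ℕ.^ b) ℕ.^ a
      ^-comm m a b = begin-equality
        (m ℕ.^ a) ℕ.^ b  ≡⟨ ℕ.^-*-assoc m a b ⟩
        m ℕ.^ (a ℕ.* b)  ≡⟨ cong (m ℕ.^_) (ℕ.*-comm a b) ⟩
        m ℕ.^ (b ℕ.* a)  ≡⟨ ℕ.^-*-assoc m b a ⟨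
        (m ℕ.^ b) ℕ.^ a  ∎

      cross : ∀ n p d p′ d′ → n ℕ.^ d ℕ.≤ 2 ℕ.^ p → 2 ℕ.^ p′ ℕ.≤ n ℕ.^ d′ → p′ ℕ.* d ℕ.≤ p ℕ.* d′
      cross n p d p′ d′ h h′ = ℕ.≮⇒≥ λ lt → ℕ.<⇒≱ (ℕ.^-monoʳ-< 2 (s≤s (s≤s z≤n)) lt) (begin
        2 ℕ.^ (p′ ℕ.* d)    ≡⟨ ℕ.^-*-assoc 2 p′ d ⟨
        (2 ℕ.^ p′) ℕ.^ d    ≤⟨ ℕ.^-monoˡ-≤ d h′ ⟩
        (n ℕ.^ d′) ℕ.^ d    ≡⟨ ^-comm n d′ d ⟩
        (n ℕ.^ d) ℕ.^ d′    ≤⟨ ℕ.^-monoˡ-≤ d′ h ⟩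
        (2 ℕ.^ p) ℕ.^ d′    ≡⟨ ℕ.^-*-assoc 2 p d′ ⟩
        2 ℕ.^ (p ℕ.* d′)    ∎)

      bernoulli : ∀ a k → a ℕ.^ suc k ℕ.+ suc k ℕ.* a ℕ.^ k ℕ.≤ suc a ℕ.^ suc k
      bernoulli a zero    = ℕ.≤-reflexive (eq a)
        where
        eq : ∀ a → a ℕ.* 1 ℕ.+ 1 ≡ 1 ℕ.+ a ℕ.* 1
        eq = solve-∀
      bernoulli a (suc k) = begin
        a ℕ.* (a ℕ.* x) ℕ.+ suc (suc k) ℕ.* (a ℕ.* x)
          ≤⟨ ℕ.m≤m+n _ (suc k ℕ.* x) ⟩
        a ℕ.* (a ℕ.* x) ℕ.+ suc (suc k) ℕ.* (a ℕ.* x) ℕ.+ suc k ℕ.* x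
          ≡⟨ eq a k x ⟩
        suc a ℕ.* (a ℕ.* x ℕ.+ suc k ℕ.* x)
          ≤⟨ ℕ.*-monoʳ-≤ (suc a) (bernoulli a k) ⟩
        suc a ℕ.* suc a ℕ.^ suc k ∎
        where
        x = a ℕ.^ k
        eq : ∀ a k x → a ℕ.* (a ℕ.* x) ℕ.+ suc (suc k) ℕ.* (a ℕ.* x) ℕ.+ suc k ℕ.* x
                     ≡ suc a ℕ.* (a ℕ.* x ℕ.+ suc k ℕ.* x)
        eq = solve-∀

      a^a>0 : ∀ a → 0 ℕ.< a ℕ.^ a
      a^a>0 zero    = s≤s z≤n
      a^a>0 (suc a) = ℕ.m^n>0 (suc a) (suc a)

      doubling : ∀ {a b} → a ℕ.< b → 2 ℕ.* a ℕ.^ suc a ℕ.< b ℕ.^ suc a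
      doubling {a} {b} a<b = begin-strict
        2 ℕ.* a ℕ.^ suc a                         ≡⟨ eq (a ℕ.^ suc a) ⟩
        a ℕ.^ suc a ℕ.+ a ℕ.* a ℕ.^ a             <⟨ ℕ.+-monoʳ-< (a ℕ.^ suc a)
                                                       (ℕ.m<n+m _ (a^a>0 a)) ⟩
        a ℕ.^ suc a ℕ.+ suc a ℕ.* a ℕ.^ a         ≤⟨ bernoulli a a ⟩
        suc a ℕ.^ suc a                           ≤⟨ ℕ.^-monoˡ-≤ (suc a) a<b ⟩
        b ℕ.^ suc a                               ∎
        where
        eq : ∀ x → 2 ℕ.* x ≡ x ℕ.+ x
        eq = solve-∀

      n<2^n : ∀ n → n ℕ.< 2 ℕ.^ n
      n<2^n zero    = s≤s z≤n
      n<2^n (suc n) = begin-strict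
        suc n                  ≤⟨ n<2^n n ⟩
        2 ℕ.^ n                <⟨ ℕ.^-monoʳ-< 2 (s≤s (s≤s z≤n)) (ℕ.n<1+n n) ⟩
        2 ℕ.^ suc n            ∎

      low-closed : ∀ n q r → q < r → log₂-Lower n r → log₂-Lower n q
      low-closed n (mkℚᵘ -[1+ _ ] _) r                  _   _ = tt
      low-closed n (mkℚᵘ (+ p) d)    (mkℚᵘ -[1+ _ ] _)  q<r _ = contradiction q<r +≮-
      low-closed n (mkℚᵘ (+ p) d)    (mkℚᵘ (+ p′) d′)   q<r l = ℕ.≰⇒> λ h →
        ℕ.<⇒≱ (drop-+ q<r) (cross n p (suc d) p′ (suc d′) h (ℕ.<⇒≤ l))

      up-closed : ∀ n q r → q < r → log₂-Upper n q → log₂-Upper n r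
      up-closed n (mkℚᵘ (+ p) d) (mkℚᵘ -[1+ _ ] _)  q<r _ = contradiction q<r +≮-
      up-closed n (mkℚᵘ (+ p) d) (mkℚᵘ (+ p′) d′)   q<r u = ℕ.≰⇒> λ h →
        ℕ.<⇒≱ (drop-+ q<r) (cross n p (suc d) p′ (suc d′) (ℕ.<⇒≤ u) h)

      low-open : ∀ n q → log₂-Lower n q → ∃[ r ] (q < r × log₂-Lower n r)
      low-open n (mkℚᵘ -[1+ p ] d) _ with <-dense { mkℚᵘ -[1+ p ] d } {0ℚᵘ} (*<* ℤ.-<+)
      ... | mkℚᵘ -[1+ _ ] _ , q<r , _   = _ , q<r , tt
      ... | mkℚᵘ (+ p′)   e , _   , r<0 with () ← drop-+ {p′} {e} {0} {0} r<0
      low-open n (mkℚᵘ (+ p) d) l =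
        mkℚᵘ (+ suc (p ℕ.* m)) (a ℕ.+ d ℕ.* m) ,
        lift-+ (s≤s (ℕ.≤-trans (ℕ.≤-reflexive (eq p d m)) (ℕ.m≤n+m _ d))) ,
        (begin-strict
          2 ℕ.* 2 ℕ.^ (p ℕ.* m)       ≡⟨ cong (2 ℕ.*_) (ℕ.^-*-assoc 2 p m) ⟨
          2 ℕ.* a ℕ.^ m               <⟨ doubling l ⟩
          (n ℕ.^ suc d) ℕ.^ m         ≡⟨ ℕ.^-*-assoc n (suc d) m ⟩
          n ℕ.^ (suc d ℕ.* m)         ∎)
        where
        a = 2 ℕ.^ p
        m = suc a
        eq : ∀ p d m → p ℕ.* (suc d ℕ.* m) ≡ p ℕ.* m ℕ.* suc d
        eq = solve-∀

      up-open : ∀ n .{{_ : NonZero n}} r → log₂-Upper n r → ∃[ q ] (q < r × log₂-Upper n q)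
      up-open n (mkℚᵘ (+ zero) d) u = contradiction (ℕ.m^n>0 n (suc d)) (ℕ.<⇒≱ u)
      up-open n (mkℚᵘ (+ suc p) d) u =
        mkℚᵘ (+ (a ℕ.+ p ℕ.* m)) (a ℕ.+ d ℕ.* m) ,
        lift-+ (begin-strict
          (a ℕ.+ p ℕ.* m) ℕ.* suc d    <⟨ ℕ.*-monoˡ-< (suc d) (ℕ.n<1+n (a ℕ.+ p ℕ.* m)) ⟩
          (suc p ℕ.* m) ℕ.* suc d      ≡⟨ eq p d m ⟩
          suc p ℕ.* (suc d ℕ.* m)      ∎) ,
        ℕ.*-cancelˡ-< 2 _ _ (begin-strict
          2 ℕ.* n ℕ.^ (suc d ℕ.* m)    ≡⟨ cong (2 ℕ.*_) (ℕ.^-*-assoc n (suc d) m) ⟨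
          2 ℕ.* a ℕ.^ m                <⟨ doubling u ⟩
          (2 ℕ.^ suc p) ℕ.^ m          ≡⟨ ℕ.^-*-assoc 2 (suc p) m ⟩
          2 ℕ.^ (suc p ℕ.* m)          ∎)
        where
        a = n ℕ.^ suc d
        m = suc a
        eq : ∀ p d m → (suc p ℕ.* m) ℕ.* suc d ≡ suc p ℕ.* (suc d ℕ.* m)
        eq = solve-∀

      low-up-disjoint : ∀ n q → log₂-Lower n q → log₂-Upper n q → ⊥
      low-up-disjoint n (mkℚᵘ (+ _) _) l u = ℕ.<-asym l u

      low-up-located : ∀ n q r → q < r → log₂-Lower n q ⊎ log₂-Upper n r
      low-up-located n (mkℚᵘ -[1+ _ ] _) r                 _   = inj₁ tt
      low-up-located n (mkℚᵘ (+ p) d)    (mkℚᵘ -[1+ _ ] _) q<r = contradiction q<r +≮-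
      low-up-located n (mkℚᵘ (+ p) d)    (mkℚᵘ (+ p′) d′)  q<r
        with 2 ℕ.^ p ℕ.<? n ℕ.^ suc d
      ... | yes l = inj₁ l
      ... | no ¬l = inj₂ (ℕ.≰⇒> λ h →
        ℕ.<⇒≱ (drop-+ q<r) (cross n p (suc d) p′ (suc d′) (ℕ.≮⇒≥ ¬l) h))

  log₂ : (n : ℕ) .{{_ : NonZero n}} → ℝ
  log₂ n = record
    { Lower           = log₂-Lower n
    ; Upper           = log₂-Upper n
    ; lower-inhabited = mkℚᵘ -[1+ 0 ] 0 , tt
    ; upper-inhabited = mkℚᵘ (+ n) 0 , subst₂ ℕ._<_ (sym (ℕ.*-identityʳ n)) refl (n<2^n n)
    ; lower-closed    = λ {q} {r} → low-closed n q r
    ; upper-closed    = λ {q} {r} → up-closed n q r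
    ; lower-open      = λ {q} → low-open n q
    ; upper-open      = λ {r} → up-open n r
    ; disjoint        = λ {q} → low-up-disjoint n q
    ; located         = λ {q} {r} → low-up-located n q r
    }

  -- For x > 0:  q < e / x  ⇔  q x < e, and as t ↦ q t is monotone this holds iff
  -- q y < e and q z < e for some rational bounds y < x < z.
  record Quotient-Lower (e : ℚᵘ) (x : ℝ) (q : ℚᵘ) : Set where
    constructor mk
    field
      {y z} : ℚᵘ
      0<y   : 0ℚᵘ < y
      y<x   : y <ʳ x
      x<z   : x ʳ< z
      qy<e  : q * y < e
      qz<e  : q * z < e

  record Quotient-Upper (e : ℚᵘ) (x : ℝ) (q : ℚᵘ) : Set where
    constructor mk
    field
      {y z} : ℚᵘ
      0<y   : 0ℚᵘ < y
      y<x   : y <ʳ x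
      x<z   : x ʳ< z
      e<qy  : e < q * y
      e<qz  : e < q * z

  private
    *-monoʳ : ∀ {p q r} → 0ℚᵘ < r → p < q → r * p < r * q
    *-monoʳ {r = r} 0<r = ℚ.*-monoʳ-<-pos r {{positive 0<r}}

    *-monoˡ : ∀ {p q r} → 0ℚᵘ < r → p < q → p * r < q * r
    *-monoˡ {r = r} 0<r = ℚ.*-monoˡ-<-pos r {{positive 0<r}}

    neg*pos : ∀ {q r} → q < 0ℚᵘ → 0ℚᵘ < r → q * r < 0ℚᵘ
    neg*pos {r = r} q<0 0<r = <-respʳ-≃ (ℚ.*-zeroˡ r) (*-monoˡ 0<r q<0)

    pos*pos : ∀ {q r} → 0ℚᵘ < q → 0ℚᵘ < r → 0ℚᵘ < q * r
    pos*pos {r = r} 0<q 0<r = <-respˡ-≃ (ℚ.*-zeroˡ r) (*-monoˡ 0<r 0<q)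

    div : ∀ e {r} → 0ℚᵘ < r → ∃[ u ] (u * r) ℚ.≃ e
    div e {r} 0<r = e * r⁻¹ , (begin
      e * r⁻¹ * r    ≈⟨ ℚ.*-assoc e r⁻¹ r ⟩
      e * (r⁻¹ * r)  ≈⟨ ℚ.*-congˡ {e} (ℚ.*-inverseˡ r {{>-nonZero 0<r}}) ⟩
      e * 1ℚᵘ        ≈⟨ ℚ.*-identityʳ e ⟩
      e              ∎)
      where
      r⁻¹ = (1/ r) {{>-nonZero 0<r}}
      open import Relation.Binary.Reasoning.Setoid ℚ.≃-setoid

    <-by-*ʳ : ∀ {p q r} → 0ℚᵘ < r → p * r < q * r → p < q
    <-by-*ʳ {r = r} 0<r = ℚ.*-cancelʳ-<-nonNeg r {{ℚ.pos⇒nonNeg r {{positive 0<r}}}}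

    <-⊓ : ∀ {p q r} → p < q → p < r → p < q ℚ.⊓ r
    <-⊓ {_} {q} {r} p<q p<r with ℚ.≤-total q r
    ... | inj₁ q≤r = <-respʳ-≃ (≃-sym (ℚ.p≤q⇒p⊓q≃p q≤r)) p<q
    ... | inj₂ r≤q = <-respʳ-≃ (≃-sym (ℚ.p≥q⇒p⊓q≃q r≤q)) p<r

    ⊔-< : ∀ {p q r} → p < r → q < r → p ℚ.⊔ q < r
    ⊔-< {p} {q} {_} p<r q<r with ℚ.≤-total p q
    ... | inj₁ p≤q = <-respˡ-≃ (≃-sym (ℚ.p≤q⇒p⊔q≃q p≤q)) q<r
    ... | inj₂ q≤p = <-respˡ-≃ (≃-sym (ℚ.p≥q⇒p⊔q≃p q≤p)) p<r

    p-1<p : ∀ p → p - 1ℚᵘ < p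
    p-1<p p = <-respʳ-≃ (ℚ.+-identityʳ p) (ℚ.+-monoʳ-< p (*<* ℤ.-<+))

    p<p+1 : ∀ p → p < p + 1ℚᵘ
    p<p+1 p = <-respˡ-≃ (ℚ.+-identityʳ p) (ℚ.+-monoʳ-< p (*<* (ℤ.+<+ (s≤s z≤n))))

    module _ (e : ℚᵘ) (x : ℝ) (0<x : 0ℚᵘ <ʳ x) where
      bounds : ∃₂ λ y z → 0ℚᵘ < y × y <ʳ x × x ʳ< z
      bounds with y , 0<y , y<x ← lower-open x 0<x | z , x<z ← upper-inhabited x =
        y , z , 0<y , y<x , x<z

      0<upper : ∀ {z} → x ʳ< z → 0ℚᵘ < z
      0<upper = lower<upper x 0<x

      module _ {y z} (0<y : 0ℚᵘ < y) (0<z : 0ℚᵘ < z) where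
        e/y = proj₁ (div e 0<y)
        e/z = proj₁ (div e 0<z)

        <e/ : ∀ {q} → q < e/y ℚ.⊓ e/z → q * y < e × q * z < e
        <e/ q< = <-respʳ-≃ (proj₂ (div e 0<y)) (*-monoˡ 0<y (ℚ.<-≤-trans q< (ℚ.p⊓q≤p e/y e/z)))
               , <-respʳ-≃ (proj₂ (div e 0<z)) (*-monoˡ 0<z (ℚ.<-≤-trans q< (ℚ.p⊓q≤q e/y e/z)))

        >e/ : ∀ {q} → e/y ℚ.⊔ e/z < q → e < q * y × e < q * z
        >e/ <q = <-respˡ-≃ (proj₂ (div e 0<y)) (*-monoˡ 0<y (ℚ.≤-<-trans (ℚ.p≤p⊔q e/y e/z) <q))
               , <-respˡ-≃ (proj₂ (div e 0<z)) (*-monoˡ 0<z (ℚ.≤-<-trans (ℚ.p≤q⊔p e/y e/z) <q))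

        <e/⁻ : ∀ {q} → q * y < e → q * z < e → q < e/y ℚ.⊓ e/z
        <e/⁻ {q} qy<e qz<e = <-⊓ {q} {e/y} {e/z}
          (<-by-*ʳ {p = q} {e/y} 0<y (<-respʳ-≃ (≃-sym (proj₂ (div e 0<y))) qy<e))
          (<-by-*ʳ {p = q} {e/z} 0<z (<-respʳ-≃ (≃-sym (proj₂ (div e 0<z))) qz<e))

        >e/⁻ : ∀ {q} → e < q * y → e < q * z → e/y ℚ.⊔ e/z < q
        >e/⁻ {q} e<qy e<qz = ⊔-< {e/y} {e/z} {q}
          (<-by-*ʳ {p = e/y} {q} 0<y (<-respˡ-≃ (≃-sym (proj₂ (div e 0<y))) e<qy))
          (<-by-*ʳ {p = e/z} {q} 0<z (<-respˡ-≃ (≃-sym (proj₂ (div e 0<z))) e<qz))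

      q-lower-inhabited : ∃ (Quotient-Lower e x)
      q-lower-inhabited with y , z , 0<y , y<x , x<z ← bounds =
        let m = e/y 0<y (0<upper x<z) ℚ.⊓ e/z 0<y (0<upper x<z)
            qy<e , qz<e = <e/ 0<y (0<upper x<z) (p-1<p m)
        in m - 1ℚᵘ , mk 0<y y<x x<z qy<e qz<e

      q-upper-inhabited : ∃ (Quotient-Upper e x)
      q-upper-inhabited with y , z , 0<y , y<x , x<z ← bounds =
        let m = e/y 0<y (0<upper x<z) ℚ.⊔ e/z 0<y (0<upper x<z)
            e<qy , e<qz = >e/ 0<y (0<upper x<z) (p<p+1 m)
        in m + 1ℚᵘ , mk 0<y y<x x<z e<qy e<qz

      q-lower-closed : ∀ {q r} → q < r → Quotient-Lower e x r → Quotient-Lower e x q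
      q-lower-closed q<r (mk 0<y y<x x<z ry<e rz<e) =
        mk 0<y y<x x<z (<-trans (*-monoˡ 0<y q<r) ry<e)
                       (<-trans (*-monoˡ (0<upper x<z) q<r) rz<e)

      q-upper-closed : ∀ {q r} → q < r → Quotient-Upper e x q → Quotient-Upper e x r
      q-upper-closed q<r (mk 0<y y<x x<z e<qy e<qz) =
        mk 0<y y<x x<z (<-trans e<qy (*-monoˡ 0<y q<r))
                       (<-trans e<qz (*-monoˡ (0<upper x<z) q<r))

      q-lower-open : ∀ {q} → Quotient-Lower e x q → ∃[ r ] (q < r × Quotient-Lower e x r)
      q-lower-open (mk 0<y y<x x<z qy<e qz<e)
        with r , q<r , r< ← <-dense (<e/⁻ 0<y (0<upper x<z) qy<e qz<e) =
        let ry<e , rz<e = <e/ 0<y (0<upper x<z) r<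
        in r , q<r , mk 0<y y<x x<z ry<e rz<e

      q-upper-open : ∀ {r} → Quotient-Upper e x r → ∃[ q ] (q < r × Quotient-Upper e x q)
      q-upper-open (mk 0<y y<x x<z e<ry e<rz)
        with q , <q , q<r ← <-dense (>e/⁻ 0<y (0<upper x<z) e<ry e<rz) =
        let e<qy , e<qz = >e/ 0<y (0<upper x<z) <q
        in q , q<r , mk 0<y y<x x<z e<qy e<qz

      q-disjoint : ∀ {q} → Quotient-Lower e x q → Quotient-Upper e x q → ⊥
      q-disjoint {q} (mk {y} {z} _ y<x x<z qy<e qz<e) (mk {y′} {z′} _ y′<x x<z′ e<qy′ e<qz′)
        with ℚ.≤-total 0ℚᵘ q
      ... | inj₁ 0≤q = ℚ.<⇒≱ (<-trans qz<e e<qy′)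
              (ℚ.*-monoʳ-≤-nonNeg q {{ℚ.nonNegative 0≤q}} (ℚ.<⇒≤ (lower<upper x y′<x x<z)))
      ... | inj₂ q≤0 = ℚ.<⇒≱ (<-trans qy<e e<qz′)
              (ℚ.*-monoʳ-≤-nonPos q {{ℚ.nonPositive q≤0}} (ℚ.<⇒≤ (lower<upper x y<x x<z′)))

      q-located⁺ : 0ℚᵘ < e → ∀ {q r} → q < r → Quotient-Lower e x q ⊎ Quotient-Upper e x r
      q-located⁺ 0<e {q} {r} q<r with y , z , 0<y , y<x , x<z ← bounds
        with 0ℚᵘ ℚ.<? r
      ... | no 0≮r =
        let q<0 = ℚ.<-≤-trans q<r (ℚ.≮⇒≥ 0≮r)
        in inj₁ (mk 0<y y<x x<z (<-trans (neg*pos q<0 0<y) 0<e)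
                                (<-trans (neg*pos q<0 (0<upper x<z)) 0<e))
      ... | yes 0<r
        with c , q⊔0<c , c<r ← <-dense (⊔-< {q} {0ℚᵘ} {r} q<r 0<r)
        with q<c ← ℚ.≤-<-trans (ℚ.p≤p⊔q q 0ℚᵘ) q⊔0<c
        with 0<c ← ℚ.≤-<-trans (ℚ.p≤q⊔p q 0ℚᵘ) q⊔0<c
        with u , ur≃e ← div e 0<r
        with v , vc≃e ← div e 0<c
        with 0<u ← <-by-*ʳ {0ℚᵘ} {u} {r} 0<r
                     (<-respˡ-≃ (≃-sym (ℚ.*-zeroˡ r)) (<-respʳ-≃ (≃-sym ur≃e) 0<e))
        with u<v ← <-by-*ʳ {u} {v} {c} 0<c
                     (<-respʳ-≃ (≃-trans ur≃e (≃-sym vc≃e)) (*-monoʳ 0<u c<r))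
        with located x u<v
      ... | inj₁ u<x with y′ , u<y′ , y′<x ← lower-open x u<x =
        let e<ry′ = <-respˡ-≃ (≃-trans (ℚ.*-comm r u) ur≃e) (*-monoʳ 0<r u<y′)
        in inj₂ (mk (<-trans 0<u u<y′) y′<x x<z e<ry′
                    (<-trans e<ry′ (*-monoʳ 0<r (lower<upper x y′<x x<z))))
      ... | inj₂ x<v with z′ , z′<v , x<z′ ← upper-open x x<v =
        let cz′<e = <-respʳ-≃ (≃-trans (ℚ.*-comm c v) vc≃e) (*-monoʳ 0<c z′<v)
        in inj₁ (mk 0<y y<x x<z′
                    (<-trans (<-trans (*-monoˡ 0<y q<c) (*-monoʳ 0<c (lower<upper x y<x x<z′))) cz′<e)
                    (<-trans (*-monoˡ (0<upper x<z′) q<c) cz′<e))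

    module _ (e : ℚᵘ) (x : ℝ) (0<x : 0ℚᵘ <ʳ x) where
      neg-lower : ∀ {q} → Quotient-Lower (- e) x (- q) → Quotient-Upper e x q
      neg-lower {q} (mk {y} {z} 0<y y<x x<z y< z<) = mk 0<y y<x x<z
        (ℚ.neg-cancel-< (<-respˡ-≃ (≃-sym (ℚ.neg-distribˡ-* q y)) y<))
        (ℚ.neg-cancel-< (<-respˡ-≃ (≃-sym (ℚ.neg-distribˡ-* q z)) z<))

      neg-upper : ∀ {q} → Quotient-Upper (- e) x (- q) → Quotient-Lower e x q
      neg-upper {q} (mk {y} {z} 0<y y<x x<z <y <z) = mk 0<y y<x x<z
        (ℚ.neg-cancel-< (<-respʳ-≃ (≃-sym (ℚ.neg-distribˡ-* q y)) <y))
        (ℚ.neg-cancel-< (<-respʳ-≃ (≃-sym (ℚ.neg-distribˡ-* q z)) <z))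

      q-located : ∀ {q r} → q < r → Quotient-Lower e x q ⊎ Quotient-Upper e x r
      q-located {q} {r} q<r with <-cmp 0ℚᵘ e
      ... | tri< 0<e _ _ = q-located⁺ e x 0<x 0<e q<r
      ... | tri> _ _ e<0 = [ (λ l → inj₂ (neg-lower l)) , (λ u → inj₁ (neg-upper u)) ]′
                           (q-located⁺ (- e) x 0<x (ℚ.neg-mono-< e<0) (ℚ.neg-mono-< q<r))
      ... | tri≈ _ 0≃e _
        with y , z , 0<y , y<x , x<z ← bounds e x 0<x
        with 0<z ← lower<upper x 0<x x<z
        with 0ℚᵘ ℚ.<? r
      ...   | yes 0<r = inj₂ (mk 0<y y<x x<z (<-respˡ-≃ 0≃e (pos*pos 0<r 0<y))
                                             (<-respˡ-≃ 0≃e (pos*pos 0<r 0<z)))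
      ...   | no 0≮r  =
        let q<0 = ℚ.<-≤-trans q<r (ℚ.≮⇒≥ 0≮r)
        in inj₁ (mk 0<y y<x x<z (<-respʳ-≃ 0≃e (neg*pos q<0 0<y))
                                (<-respʳ-≃ 0≃e (neg*pos q<0 0<z)))

  quotient : (e : ℚᵘ) (x : ℝ) → 0ℚᵘ <ʳ x → ℝ
  quotient e x 0<x = record
    { Lower           = Quotient-Lower e x
    ; Upper           = Quotient-Upper e x
    ; lower-inhabited = q-lower-inhabited e x 0<x
    ; upper-inhabited = q-upper-inhabited e x 0<x
    ; lower-closed    = q-lower-closed e x 0<x
    ; upper-closed    = q-upper-closed e x 0<x
    ; lower-open      = q-lower-open e x 0<x
    ; upper-open      = q-upper-open e x 0<x
    ; disjoint        = q-disjoint e x 0<x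
    ; located         = q-located e x 0<x
    }

open Permutations public
open Reals public

open import Data.Nat.Base using (ℕ; _≤_; NonZero)
open import Data.Product.Base using (∃-syntax; Σ-syntax; _×_)
open import Data.Rational.Unnormalised.Base using (ℚᵘ; 0ℚᵘ; 1ℚᵘ; _<_; _+_; _-_)

infix 4 _∼_

-- f n / h n → 1; part of the condition is that h n > 0 for all large n, so
-- that the quotient is defined (log₂ 1 = 0).
_∼_ : (ℕ → ℚᵘ) → ((n : ℕ) .{{_ : NonZero n}} → ℝ) → Set
f ∼ h = ∀ ε → 0ℚᵘ < ε → ∃[ N ] ∀ n .{{_ : NonZero n}} → N ≤ n →
  Σ[ 0<hn ∈ 0ℚᵘ <ʳ h n ]
    (1ℚᵘ - ε <ʳ quotient (f n) (h n) 0<hn × quotient (f n) (h n) 0<hn ʳ< 1ℚᵘ + ε)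

{-# OPTIONS --safe #-}
module Submission where

-- An Av(312) permutation is L 1 R with every entry of L below every entry of R,
-- so Av(312) is in bijection with binary trees; its sub-permutations are the
-- fringe subtrees, and a sub-permutation avoids 213 iff its tree is a path (no
-- node has two children).  Let N_k be the number of fringe subtrees that are
-- paths with k nodes.  With C the Catalan series, B = (z C)′ = 1 / (1 − 2 z C)
-- has the coefficients b_m = (m + 1) C_m, and
--   ∑ N_k = 2^(k−1) b_(n−k),   ∑ N_k (N_k − 1) = 4^(k−1) (n − 2k) b_(n−2k),
-- the sums being over the trees with n nodes.  The recurrence
-- (m + 1) b_(m+1) = (4m + 2) b_m then gives a first moment bound
-- E_n(γ) ≤ K + ∑_{k>K} E(N_k) ≤ K + (K + 3) / 2^c for K = ⌊log₂ n⌋ + c, and a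
-- second moment bound P(N_k > 0) ≥ M / (1 + M), M = 2^c, for
-- k = ⌊log₂ n⌋ − c − 1.  Both are (1 + o(1)) log₂ n as c → ∞ slowly.

open import Defs

-- The value log₂ n comes from E(N_k) ≈ (n + 1) / 2^(k + 1): there are 2^(k - 1) paths with k nodes,
-- b_(n-k) is about b_n / 4^k, and b_n = (n + 1) C_n. So paths become rare slightly above log₂ n and
-- are almost surely present slightly below it. The obstacle to the lower bound is the dependence
-- between subtrees. Paths with equally many nodes are never nested, and their factorial moment
-- satisfies C_n ∑ N_k (N_k - 1) ≤ (∑ N_k)² with no error term. No asymptotics of Catalan numbers
-- enter, only bounds on b_(m+1) / b_m. All counting stays in ℕ with cross-multiplied inequalities.
-- Inverses of series are replaced by uniqueness of solutions of linear equations, and subtraction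
-- by cancellation. In place of c → ∞, each ε gets one fixed c.

-- Formal power series with natural coefficients.

module PowerSeries where

  open import Algebra.Bundles using (CommutativeSemiring)
  open import Data.Nat.Base
  open import Data.Nat.Properties
  open import Data.Nat.Tactic.RingSolver using (solve-∀)
  open import Data.Product.Base using (_,_)
  open import Level using (0ℓ)
  open import Relation.Binary.PropositionalEquality

  Series : Set
  Series = ℕ → ℕ

  infix 4 _≈_
  _≈_ : Series → Series → Set
  f ≈ g = ∀ n → f n ≡ g n

  tail : Series → Series
  tail f n = f (suc n)

  infixl 6 _⊕_
  infixl 7 _⊗_

  _⊕_ : Series → Series → Series
  (f ⊕ g) n = f n + g n

  -- The Cauchy product, read off `f` = `f 0` + z · `tail f`. The right factor stays whole, so
  -- inductions on the index generalise over `f`, and the enumeration product `_⊛_` can copy the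
  -- recursion.
  _⊗_ : Series → Series → Series
  (f ⊗ g) zero    = f 0 * g 0
  (f ⊗ g) (suc n) = f 0 * g (suc n) + (tail f ⊗ g) n

  scale : ℕ → Series → Series
  scale c f n = c * f n

  𝟘 𝟙 z : Series
  𝟘 _ = 0
  𝟙 zero    = 1
  𝟙 (suc _) = 0
  z zero    = 0
  z (suc n) = 𝟙 n

  ⊗-cong≤ : ∀ n {f f′ g g′} → (∀ i → i ≤ n → f i ≡ f′ i) → (∀ i → i ≤ n → g i ≡ g′ i) →
            (f ⊗ g) n ≡ (f′ ⊗ g′) n
  ⊗-cong≤ zero    p q = cong₂ _*_ (p 0 z≤n) (q 0 z≤n)
  ⊗-cong≤ (suc n) p q = cong₂ _+_ (cong₂ _*_ (p 0 z≤n) (q (suc n) ≤-refl))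
    (⊗-cong≤ n (λ i i≤n → p (suc i) (s≤s i≤n)) (λ i i≤n → q i (m≤n⇒m≤1+n i≤n)))

  ⊗-cong : ∀ {f f′ g g′} → f ≈ f′ → g ≈ g′ → f ⊗ g ≈ f′ ⊗ g′
  ⊗-cong p q n = ⊗-cong≤ n (λ i _ → p i) (λ i _ → q i)

  ⊗-distribʳ : ∀ h f g → (f ⊕ g) ⊗ h ≈ f ⊗ h ⊕ g ⊗ h
  ⊗-distribʳ h f g zero    = *-distribʳ-+ (h 0) (f 0) (g 0)
  ⊗-distribʳ h f g (suc n) = trans
    (cong₂ _+_ (*-distribʳ-+ (h (suc n)) (f 0) (g 0)) (⊗-distribʳ h (tail f) (tail g) n))
    (eq (f 0 * h (suc n)) (g 0 * h (suc n)) _ _)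
    where
    eq : ∀ a b c d → (a + b) + (c + d) ≡ (a + c) + (b + d)
    eq = solve-∀

  -- The mirror image of the defining clause, splitting off the constant coefficient of the right
  -- factor. Comparing the two gives commutativity.
  ⊗-suc : ∀ n f g → (f ⊗ g) (suc n) ≡ f (suc n) * g 0 + (f ⊗ tail g) n
  ⊗-suc zero    f g = +-comm (f 0 * g 1) (f 1 * g 0)
  ⊗-suc (suc n) f g = trans (cong (f 0 * g (suc (suc n)) +_) (⊗-suc n (tail f) g)) (eq (f 0 * g (suc (suc n))) (f (suc (suc n)) * g 0) _)
    where
    eq : ∀ a b c → a + (b + c) ≡ b + (a + c)
    eq = solve-∀

  ⊗-comm : ∀ f g → f ⊗ g ≈ g ⊗ f
  ⊗-comm f g zero    = *-comm (f 0) (g 0)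
  ⊗-comm f g (suc n) = trans
    (cong₂ _+_ (*-comm (f 0) (g (suc n))) (⊗-comm (tail f) g n))
    (sym (⊗-suc n g f))

  ⊗-scale : ∀ c f g → scale c f ⊗ g ≈ scale c (f ⊗ g)
  ⊗-scale c f g zero    = *-assoc c (f 0) (g 0)
  ⊗-scale c f g (suc n) = trans
    (cong₂ _+_ (*-assoc c (f 0) (g (suc n))) (⊗-scale c (tail f) g n))
    (sym (*-distribˡ-+ c (f 0 * g (suc n)) _))

  ⊗-assoc : ∀ f g h → (f ⊗ g) ⊗ h ≈ f ⊗ (g ⊗ h)
  ⊗-assoc f g h zero    = *-assoc (f 0) (g 0) (h 0)
  ⊗-assoc f g h (suc n) = begin
    f 0 * g 0 * h (suc n) + ((scale (f 0) (tail g) ⊕ tail f ⊗ g) ⊗ h) n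
      ≡⟨ cong (f 0 * g 0 * h (suc n) +_) (trans (⊗-distribʳ h (scale (f 0) (tail g)) (tail f ⊗ g) n)
           (cong₂ _+_ (⊗-scale (f 0) (tail g) h n) (⊗-assoc (tail f) g h n))) ⟩
    f 0 * g 0 * h (suc n) + (f 0 * (tail g ⊗ h) n + (tail f ⊗ (g ⊗ h)) n)
      ≡⟨ eq (f 0) (g 0) (h (suc n)) _ _ ⟩
    f 0 * (g 0 * h (suc n) + (tail g ⊗ h) n) + (tail f ⊗ (g ⊗ h)) n ∎
    where
    open ≡-Reasoning
    eq : ∀ a b c d e → a * b * c + (a * d + e) ≡ a * (b * c + d) + e
    eq = solve-∀

  ⊗-zeroˡ : ∀ f → 𝟘 ⊗ f ≈ 𝟘
  ⊗-zeroˡ f zero    = refl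
  ⊗-zeroˡ f (suc n) = ⊗-zeroˡ f n

  ⊗-identityˡ : ∀ f → 𝟙 ⊗ f ≈ f
  ⊗-identityˡ f zero    = *-identityˡ (f 0)
  ⊗-identityˡ f (suc n) = trans (cong₂ _+_ (*-identityˡ (f (suc n))) (⊗-zeroˡ f n)) (+-identityʳ _)

  ⊗-via-comm : ∀ {h} f g → f ⊗ g ≈ h → g ⊗ f ≈ h
  ⊗-via-comm f g p n = trans (⊗-comm g f n) (p n)

  series : CommutativeSemiring 0ℓ 0ℓ
  series = record
    { Carrier = Series ; _≈_ = _≈_ ; _+_ = _⊕_ ; _*_ = _⊗_ ; 0# = 𝟘 ; 1# = 𝟙
    ; isCommutativeSemiring = record
      { isSemiring = record
        { isSemiringWithoutAnnihilatingZero = record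
          { +-isCommutativeMonoid = record
            { isMonoid = record
              { isSemigroup = record
                { isMagma = record
                  { isEquivalence = record
                    { refl = λ _ → refl ; sym = λ p n → sym (p n) ; trans = λ p q n → trans (p n) (q n) }
                  ; ∙-cong = λ p q n → cong₂ _+_ (p n) (q n) }
                ; assoc = λ f g h n → +-assoc (f n) (g n) (h n) }
              ; identity = (λ _ _ → refl) , λ f n → +-identityʳ (f n) }
            ; comm = λ f g n → +-comm (f n) (g n) }
          ; *-cong = ⊗-cong
          ; *-assoc = ⊗-assoc
          ; *-identity = ⊗-identityˡ , λ f → ⊗-via-comm 𝟙 f (⊗-identityˡ f)
          ; distrib = (λ f g h n → trans (⊗-comm f (g ⊕ h) n)
              (trans (⊗-distribʳ f g h n) (cong₂ _+_ (⊗-comm g f n) (⊗-comm h f n)))) , ⊗-distribʳ }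
        ; zero = ⊗-zeroˡ , λ f → ⊗-via-comm 𝟘 f (⊗-zeroˡ f) }
      ; *-comm = ⊗-comm } }

  z⊗-suc : ∀ f n → (z ⊗ f) (suc n) ≡ f n
  z⊗-suc f n = ⊗-identityˡ f n

  -- The Euler operator z d/dz, which unlike d/dz leaves the indices in place.
  θ : Series → Series
  θ f n = n * f n

  θ-⊗ : ∀ f g → θ (f ⊗ g) ≈ θ f ⊗ g ⊕ f ⊗ θ g
  θ-⊗ f g zero    = sym (*-zeroʳ (f 0))
  θ-⊗ f g (suc n) = begin
    suc n * (f 0 * g (suc n) + (tail f ⊗ g) n)
      ≡⟨ eq₁ n (f 0) (g (suc n)) _ ⟩
    f 0 * (suc n * g (suc n)) + ((tail f ⊗ g) n + n * (tail f ⊗ g) n)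
      ≡⟨ cong (λ x → f 0 * (suc n * g (suc n)) + ((tail f ⊗ g) n + x)) (θ-⊗ (tail f) g n) ⟩
    f 0 * (suc n * g (suc n)) + ((tail f ⊗ g) n + ((θ (tail f) ⊗ g) n + (tail f ⊗ θ g) n))
      ≡⟨ eq₂ (f 0 * (suc n * g (suc n))) ((tail f ⊗ g) n) _ _ ⟩
    ((tail f ⊗ g) n + (θ (tail f) ⊗ g) n) + (f 0 * (suc n * g (suc n)) + (tail f ⊗ θ g) n)
      ≡⟨ cong (_+ (f ⊗ θ g) (suc n)) (sym (⊗-distribʳ g (tail f) (θ (tail f)) n)) ⟩
    (θ f ⊗ g) (suc n) + (f ⊗ θ g) (suc n) ∎
    where
    open ≡-Reasoning
    eq₁ : ∀ n a b c → suc n * (a * b + c) ≡ a * (suc n * b) + (c + n * c)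
    eq₁ = solve-∀
    eq₂ : ∀ a b c d → a + (b + (c + d)) ≡ (b + c) + (a + d)
    eq₂ = solve-∀

  -- Stands in for division by 1 - zQ. Because of the factor `z`, coefficient i + 1 of the right
  -- side involves the unknown only up to index i, hence strong induction; in `go` the bound `n` is
  -- what decreases.
  linear-unique : ∀ {A Q X Y} → X ≈ A ⊕ z ⊗ (Q ⊗ X) → Y ≈ A ⊕ z ⊗ (Q ⊗ Y) → X ≈ Y
  linear-unique {A} {Q} {X} {Y} p q n = go n n ≤-refl
    where
    go : ∀ n i → i ≤ n → X i ≡ Y i
    go _       zero    _         = trans (p 0) (sym (q 0))
    go (suc n) (suc i) (s≤s i≤n) = begin
      X (suc i)                        ≡⟨ p (suc i) ⟩
      A (suc i) + (z ⊗ (Q ⊗ X)) (suc i) ≡⟨ cong (A (suc i) +_) (z⊗-suc (Q ⊗ X) i) ⟩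
      A (suc i) + (Q ⊗ X) i            ≡⟨ cong (A (suc i) +_)
                                            (⊗-cong≤ i {Q} (λ _ _ → refl) (λ j j≤i → go n j (≤-trans j≤i i≤n))) ⟩
      A (suc i) + (Q ⊗ Y) i            ≡⟨ cong (A (suc i) +_) (z⊗-suc (Q ⊗ Y) i) ⟨
      A (suc i) + (z ⊗ (Q ⊗ Y)) (suc i) ≡⟨ q (suc i) ⟨
      Y (suc i)                        ∎
      where open ≡-Reasoning

  -- The Catalan series and B = 1 / (1 - 2zC).

  module Catalan (C : Series) (C-eq : C ≈ 𝟙 ⊕ z ⊗ (C ⊗ C)) where
    open CommutativeSemiring series using ()
      renaming (setoid to ≈-setoid; refl to ≈-refl; sym to ≈-sym; trans to ≈-trans; +-cong to ⊕-cong)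
    open import Algebra.Solver.Ring.NaturalCoefficients.Default series
      using (solve; _:=_; _:+_; _:*_; con)
    open import Relation.Binary.Reasoning.Setoid ≈-setoid

    B G : Series
    B n = suc n * C n
    G   = z ⊗ C

    G-eq : G ≈ z ⊕ G ⊗ G
    G-eq = begin
      z ⊗ C                  ≈⟨ ⊗-cong {z} (λ _ → refl) C-eq ⟩
      z ⊗ (𝟙 ⊕ z ⊗ (C ⊗ C))  ≈⟨ solve 2 (λ z C → z :* (con 1 :+ z :* (C :* C)) := z :+ (z :* C) :* (z :* C)) ≈-refl z C ⟩
      z ⊕ G ⊗ G              ∎

    θG≈zB : θ G ≈ z ⊗ B
    θG≈zB zero    = refl
    θG≈zB (suc n) = trans (cong (suc n *_) (z⊗-suc C n)) (sym (z⊗-suc B n))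

    θz≈z : θ z ≈ z
    θz≈z zero          = refl
    θz≈z (suc zero)    = refl
    θz≈z (suc (suc n)) = *-zeroʳ n

    -- Apply θ to G = z + G², which gives θG = z + 2G θG. Then put θG = zB and cancel z by reading
    -- coefficient n + 1.
    B-eq : B ≈ 𝟙 ⊕ (G ⊗ B ⊕ G ⊗ B)
    B-eq n = trans (sym (z⊗-suc B n)) (trans (zB (suc n)) (z⊗-suc (𝟙 ⊕ (G ⊗ B ⊕ G ⊗ B)) n))
      where
      zB : z ⊗ B ≈ z ⊗ (𝟙 ⊕ (G ⊗ B ⊕ G ⊗ B))
      zB = begin
        z ⊗ B                                  ≈⟨ θG≈zB ⟨
        θ G                                    ≈⟨ (λ n → cong (n *_) (G-eq n)) ⟩
        θ (z ⊕ G ⊗ G)                          ≈⟨ (λ n → *-distribˡ-+ n (z n) _) ⟩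
        θ z ⊕ θ (G ⊗ G)                        ≈⟨ ⊕-cong θz≈z (θ-⊗ G G) ⟩
        z ⊕ (θ G ⊗ G ⊕ G ⊗ θ G)                ≈⟨ ⊕-cong {z} ≈-refl (⊕-cong (⊗-cong θG≈zB (≈-refl {G})) (⊗-cong {G} ≈-refl θG≈zB)) ⟩
        z ⊕ ((z ⊗ B) ⊗ G ⊕ G ⊗ (z ⊗ B))        ≈⟨ solve 3 (λ z B G → z :+ ((z :* B) :* G :+ G :* (z :* B))
                                                   := z :* (con 1 :+ (G :* B :+ G :* B))) ≈-refl z B G ⟩
        z ⊗ (𝟙 ⊕ (G ⊗ B ⊕ G ⊗ B))              ∎

    -- By `B-eq` the series A B solves the same equation, and solutions are unique. Statistics
    -- summed over both children lead to such equations: the sibling ranges freely and brings the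
    -- factor C.
    linear-solution : ∀ {A X} → X ≈ A ⊕ z ⊗ ((C ⊕ C) ⊗ X) → X ≈ A ⊗ B
    linear-solution {A} {X} X-eq = linear-unique {A} {C ⊕ C} {X} X-eq (begin
      A ⊗ B                           ≈⟨ ⊗-cong {A} ≈-refl B-eq ⟩
      A ⊗ (𝟙 ⊕ (G ⊗ B ⊕ G ⊗ B))       ≈⟨ solve 4 (λ z C A B → A :* (con 1 :+ ((z :* C) :* B :+ (z :* C) :* B))
                                            := A :+ z :* ((C :+ C) :* (A :* B))) ≈-refl z C A B ⟩
      A ⊕ z ⊗ ((C ⊕ C) ⊗ (A ⊗ B))     ∎)

    -- This is B² = 1 / (1 - 4z), as (1 - 2G)² = 1 - 4(G - G²) = 1 - 4z. To avoid subtraction, u²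
    -- with u = 2GB is added to both sides: B = 1 + u gives B² + u² = 1 + 2uB = 1 + 4GB², and G = z
    -- + G² turns this into 1 + 4zB² + u².
    B²-eq : B ⊗ B ≈ 𝟙 ⊕ (z ⊗ (B ⊗ B) ⊕ z ⊗ (B ⊗ B) ⊕ z ⊗ (B ⊗ B) ⊕ z ⊗ (B ⊗ B))
    B²-eq n = +-cancelʳ-≡ (U² n) _ _ (sum n)
      where
      u U² : Series
      u  = G ⊗ B ⊕ G ⊗ B
      U² = u ⊗ u
      W = B ⊗ B
      sum : B ⊗ B ⊕ U² ≈ 𝟙 ⊕ (z ⊗ W ⊕ z ⊗ W ⊕ z ⊗ W ⊕ z ⊗ W) ⊕ U²
      sum = begin
        B ⊗ B ⊕ u ⊗ u                    ≈⟨ ⊕-cong (⊗-cong B-eq B-eq) (≈-refl {u ⊗ u}) ⟩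
        (𝟙 ⊕ u) ⊗ (𝟙 ⊕ u) ⊕ u ⊗ u        ≈⟨ solve 1 (λ u → (con 1 :+ u) :* (con 1 :+ u) :+ u :* u
                                               := con 1 :+ (u :* (con 1 :+ u) :+ u :* (con 1 :+ u))) ≈-refl u ⟩
        𝟙 ⊕ (u ⊗ (𝟙 ⊕ u) ⊕ u ⊗ (𝟙 ⊕ u))  ≈⟨ ⊕-cong {𝟙} ≈-refl (⊕-cong (⊗-cong {u} ≈-refl B-eq) (⊗-cong {u} ≈-refl B-eq)) ⟨
        𝟙 ⊕ (u ⊗ B ⊕ u ⊗ B)              ≈⟨ solve 2 (λ G B → let u = G :* B :+ G :* B; w = G :* (B :* B) in
                                               con 1 :+ (u :* B :+ u :* B) := con 1 :+ (w :+ w :+ w :+ w)) ≈-refl G B ⟩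
        𝟙 ⊕ (G ⊗ W ⊕ G ⊗ W ⊕ G ⊗ W ⊕ G ⊗ W)
          ≈⟨ ⊕-cong {𝟙} ≈-refl (⊕-cong (⊕-cong (⊕-cong GW GW) GW) GW) ⟩
        𝟙 ⊕ ((z ⊕ G ⊗ G) ⊗ W ⊕ (z ⊕ G ⊗ G) ⊗ W ⊕ (z ⊕ G ⊗ G) ⊗ W ⊕ (z ⊕ G ⊗ G) ⊗ W)
          ≈⟨ solve 3 (λ z G B → let u = G :* B :+ G :* B; W = B :* B; v = (z :+ G :* G) :* W in
               con 1 :+ (v :+ v :+ v :+ v) := con 1 :+ (z :* W :+ z :* W :+ z :* W :+ z :* W) :+ u :* u) ≈-refl z G B ⟩
        𝟙 ⊕ (z ⊗ W ⊕ z ⊗ W ⊕ z ⊗ W ⊕ z ⊗ W) ⊕ U²  ∎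
        where
        GW : G ⊗ W ≈ (z ⊕ G ⊗ G) ⊗ W
        GW = ⊗-cong G-eq (≈-refl {W})

    -- Apply θ to B = 1 + 2GB. As θG = zB, this gives θB = 2zB² + 2zC θB, a linear equation with the
    -- solution 2zB² · B.
    θB-eq : θ B ≈ z ⊗ (B ⊗ B ⊗ B ⊕ B ⊗ B ⊗ B)
    θB-eq = ≈-trans (linear-solution {z ⊗ (B ⊗ B) ⊕ z ⊗ (B ⊗ B)} {θ B} (begin
      θ B                          ≈⟨ (λ n → cong (n *_) (B-eq n)) ⟩
      θ (𝟙 ⊕ (G ⊗ B ⊕ G ⊗ B))      ≈⟨ θ-split ⟩
      θ (G ⊗ B) ⊕ θ (G ⊗ B)        ≈⟨ ⊕-cong (θ-⊗ G B) (θ-⊗ G B) ⟩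
      (θ G ⊗ B ⊕ G ⊗ θ B) ⊕ (θ G ⊗ B ⊕ G ⊗ θ B)
        ≈⟨ ⊕-cong (⊕-cong zBB (≈-refl {G ⊗ θ B})) (⊕-cong zBB (≈-refl {G ⊗ θ B})) ⟩
      ((z ⊗ B) ⊗ B ⊕ G ⊗ θ B) ⊕ ((z ⊗ B) ⊗ B ⊕ G ⊗ θ B)
        ≈⟨ solve 4 (λ z C B Y → let w = (z :* B) :* B :+ (z :* C) :* Y in
             w :+ w := z :* (B :* B) :+ z :* (B :* B) :+ z :* ((C :+ C) :* Y)) ≈-refl z C B (θ B) ⟩
      z ⊗ (B ⊗ B) ⊕ z ⊗ (B ⊗ B) ⊕ z ⊗ ((C ⊕ C) ⊗ θ B) ∎))
      (solve 2 (λ z B → (z :* (B :* B) :+ z :* (B :* B)) :* B := z :* (B :* B :* B :+ B :* B :* B)) ≈-refl z B)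
      where
      zBB : θ G ⊗ B ≈ (z ⊗ B) ⊗ B
      zBB = ⊗-cong θG≈zB (≈-refl {B})
      θ-split : θ (𝟙 ⊕ (G ⊗ B ⊕ G ⊗ B)) ≈ θ (G ⊗ B) ⊕ θ (G ⊗ B)
      θ-split zero    = refl
      θ-split (suc n) = *-distribˡ-+ (suc n) ((G ⊗ B) (suc n)) _

    -- B³ = (1 + 4zB²) B = B + 2θB turns θB = 2zB³ into θB = 2z(B + 2θB), whose coefficients give
    -- the recurrence. It is that of the central binomial coefficients.
    B-step : ∀ n → suc n * B (suc n) ≡ (4 * n + 2) * B n
    B-step n = trans (θB-eq′ (suc n)) (trans (z⊗-suc _ n) (eq n (B n)))
      where
      eq : ∀ n b → (b + (n * b + n * b)) + (b + (n * b + n * b)) ≡ (4 * n + 2) * b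
      eq = solve-∀
      B³ = B ⊗ B ⊗ B
      B³-eq : B³ ≈ B ⊕ (θ B ⊕ θ B)
      B³-eq = begin
        B ⊗ B ⊗ B  ≈⟨ ⊗-cong B²-eq (≈-refl {B}) ⟩
        (𝟙 ⊕ (z ⊗ (B ⊗ B) ⊕ z ⊗ (B ⊗ B) ⊕ z ⊗ (B ⊗ B) ⊕ z ⊗ (B ⊗ B))) ⊗ B
          ≈⟨ solve 2 (λ z B → let w = z :* (B :* B); v = z :* (B :* B :* B :+ B :* B :* B) in
               (con 1 :+ (w :+ w :+ w :+ w)) :* B := B :+ (v :+ v)) ≈-refl z B ⟩
        B ⊕ (z ⊗ (B³ ⊕ B³) ⊕ z ⊗ (B³ ⊕ B³))  ≈⟨ ⊕-cong {B} ≈-refl (⊕-cong θB-eq θB-eq) ⟨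
        B ⊕ (θ B ⊕ θ B) ∎
      θB-eq′ : θ B ≈ z ⊗ ((B ⊕ (θ B ⊕ θ B)) ⊕ (B ⊕ (θ B ⊕ θ B)))
      θB-eq′ = ≈-trans θB-eq (⊗-cong {z} ≈-refl (⊕-cong B³-eq B³-eq))

-- Binary trees, their enumeration by size, and generating series of tree statistics.

module Trees where

  open import Algebra.Bundles using (CommutativeSemiring)
  open import Data.List.Base using (List; []; _∷_; _++_; map; length; cartesianProductWith)
  open import Data.List.Properties using (map-++; map-∘; map-cong-local)
  open import Data.List.Membership.Propositional using (_∈_)
  open import Data.List.Membership.Propositional.Properties using (∈-++⁺ˡ; ∈-++⁺ʳ; ∈-++⁻; ∈-cartesianProductWith⁺; ∈-cartesianProductWith⁻)
  open import Data.List.Relation.Unary.All as All using ([]; _∷_)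
  open import Data.List.Relation.Unary.Any using (here; there)
  open import Data.List.Relation.Unary.AllPairs using ([]; _∷_)
  open import Data.List.Relation.Unary.Unique.Propositional using (Unique)
  open import Data.List.Relation.Unary.Unique.Propositional.Properties using (++⁺; cartesianProductWith⁺)
  open import Data.Nat.Base
  open import Data.Nat.ListAction using (sum)
  open import Data.Nat.ListAction.Properties using (sum-++)
  open import Data.Nat.Properties
  open import Data.Nat.Tactic.RingSolver using (solve-∀)
  open import Data.Product.Base using (_,_; _×_; ∃-syntax)
  open import Data.Sum.Base using (inj₁; inj₂)
  open import Function.Base using (_∘_)
  open import Relation.Binary.PropositionalEquality
  open import Relation.Nullary.Negation using (contradiction)

  open PowerSeries

  data Tree : Set where
    leaf : Tree
    node : Tree → Tree → Tree

  size : Tree → ℕ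
  size leaf       = 0
  size (node l r) = suc (size l + size r)

  infixl 7 _⊛_
  -- The clauses follow `_⊗_`, so a weight that is a product over the two children sums to a Cauchy
  -- product (`∑-⊛`).
  _⊛_ : (ℕ → List Tree) → (ℕ → List Tree) → ℕ → List Tree
  (F ⊛ G) zero    = cartesianProductWith node (F 0) (G 0)
  (F ⊛ G) (suc n) = cartesianProductWith node (F 0) (G (suc n)) ++ ((F ∘ suc) ⊛ G) n

  -- The first argument bounds the recursion; any bound ≥ the size will do.
  trees≤ : ℕ → ℕ → List Tree
  trees≤ _       zero    = leaf ∷ []
  trees≤ zero    (suc n) = []
  trees≤ (suc b) (suc n) = (trees≤ b ⊛ trees≤ b) n

  trees : ℕ → List Tree
  trees n = trees≤ n n

  ⊛-cong≤ : ∀ n {F F′ G G′} → (∀ i → i ≤ n → F i ≡ F′ i) → (∀ i → i ≤ n → G i ≡ G′ i) →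
            (F ⊛ G) n ≡ (F′ ⊛ G′) n
  ⊛-cong≤ zero    p q = cong₂ (cartesianProductWith node) (p 0 z≤n) (q 0 z≤n)
  ⊛-cong≤ (suc n) p q = cong₂ _++_ (cong₂ (cartesianProductWith node) (p 0 z≤n) (q (suc n) ≤-refl))
    (⊛-cong≤ n (λ i i≤n → p (suc i) (s≤s i≤n)) (λ i i≤n → q i (m≤n⇒m≤1+n i≤n)))

  trees≤-bound : ∀ b c n → n ≤ b → n ≤ c → trees≤ b n ≡ trees≤ c n
  trees≤-bound b       c       zero    _         _         = refl
  trees≤-bound (suc b) (suc c) (suc n) (s≤s n≤b) (s≤s n≤c) = ⊛-cong≤ n eq eq
    where
    eq : ∀ i → i ≤ n → trees≤ b i ≡ trees≤ c i
    eq i i≤n = trees≤-bound b c i (≤-trans i≤n n≤b) (≤-trans i≤n n≤c)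

  trees-suc : ∀ n → trees (suc n) ≡ (trees ⊛ trees) n
  trees-suc n = ⊛-cong≤ n eq eq
    where
    eq : ∀ i → i ≤ n → trees≤ n i ≡ trees i
    eq i i≤n = trees≤-bound n i i i≤n ≤-refl

  ∈-⊛⁻ : ∀ n {F G t} → t ∈ (F ⊛ G) n →
         ∃[ i ] ∃[ j ] ∃[ l ] ∃[ r ] (i + j ≡ n × l ∈ F i × r ∈ G j × t ≡ node l r)
  ∈-⊛⁻ zero {F} {G} t∈ with l , r , l∈ , r∈ , t≡ ← ∈-cartesianProductWith⁻ node (F 0) (G 0) t∈ =
    0 , 0 , l , r , refl , l∈ , r∈ , t≡
  ∈-⊛⁻ (suc n) {F} {G} t∈ with ∈-++⁻ (cartesianProductWith node (F 0) (G (suc n))) t∈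
  ... | inj₁ t∈′ with l , r , l∈ , r∈ , t≡ ← ∈-cartesianProductWith⁻ node (F 0) (G (suc n)) t∈′ =
    0 , suc n , l , r , refl , l∈ , r∈ , t≡
  ... | inj₂ t∈′ with i , j , l , r , i+j≡n , l∈ , r∈ , t≡ ← ∈-⊛⁻ n t∈′ =
    suc i , j , l , r , cong suc i+j≡n , l∈ , r∈ , t≡

  ∈-⊛⁺ : ∀ i j {F G l r} → l ∈ F i → r ∈ G j → node l r ∈ (F ⊛ G) (i + j)
  ∈-⊛⁺ zero    zero    l∈ r∈ = ∈-cartesianProductWith⁺ node l∈ r∈
  ∈-⊛⁺ zero    (suc j) l∈ r∈ = ∈-++⁺ˡ (∈-cartesianProductWith⁺ node l∈ r∈)
  ∈-⊛⁺ (suc i) j {F} {G} l∈ r∈ =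
    ∈-++⁺ʳ (cartesianProductWith node (F 0) (G (suc (i + j)))) (∈-⊛⁺ i j l∈ r∈)

  ∈-trees⁺ : ∀ t → t ∈ trees (size t)
  ∈-trees⁺ leaf       = here refl
  ∈-trees⁺ (node l r) = subst (node l r ∈_) (sym (trees-suc (size l + size r)))
    (∈-⊛⁺ (size l) (size r) {trees} {trees} (∈-trees⁺ l) (∈-trees⁺ r))

  ∈-trees≤⁻ : ∀ b n {t} → t ∈ trees≤ b n → size t ≡ n
  ∈-trees≤⁻ _       zero    (here refl) = refl
  ∈-trees≤⁻ (suc b) (suc n) t∈
    with i , j , l , r , refl , l∈ , r∈ , refl ← ∈-⊛⁻ n {trees≤ b} {trees≤ b} t∈ =
    cong suc (cong₂ _+_ (∈-trees≤⁻ b i l∈) (∈-trees≤⁻ b j r∈))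

  ∈-trees⁻ : ∀ n {t} → t ∈ trees n → size t ≡ n
  ∈-trees⁻ n = ∈-trees≤⁻ n n

  node-injective : ∀ {l l′ r r′} → node l r ≡ node l′ r′ → l ≡ l′ × r ≡ r′
  node-injective refl = refl , refl

  -- The blocks of the enumeration are told apart by the size of the left subtree. The offset `s`
  -- counts how often `F` has been replaced by `F ∘ suc`.
  ⊛-unique : ∀ n s {F G} → (∀ i → Unique (F i)) → (∀ j → Unique (G j)) →
             (∀ i {t} → t ∈ F i → size t ≡ s + i) → Unique ((F ⊛ G) n)
  ⊛-unique zero    s F! G! _ = cartesianProductWith⁺ node node-injective (F! 0) (G! 0)
  ⊛-unique (suc n) s {F} {G} F! G! size-F = ++⁺
    (cartesianProductWith⁺ node node-injective (F! 0) (G! (suc n)))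
    (⊛-unique n (suc s) (F! ∘ suc) G! (λ i t∈ → trans (size-F (suc i) t∈) (+-suc s i)))
    disjoint
    where
    disjoint : ∀ {t} → t ∈ cartesianProductWith node (F 0) (G (suc n)) × t ∈ ((F ∘ suc) ⊛ G) n → _
    disjoint (t∈ , t∈′)
      with l , r , l∈ , _ , refl ← ∈-cartesianProductWith⁻ node (F 0) (G (suc n)) t∈
      with i , j , _ , _ , _ , l∈′ , _ , refl ← ∈-⊛⁻ n t∈′ =
      0≢1+n (+-cancelˡ-≡ s 0 (suc i) (trans (sym (size-F 0 l∈)) (size-F (suc i) l∈′)))

  trees≤-unique : ∀ b n → Unique (trees≤ b n)
  trees≤-unique _       zero    = [] ∷ []
  trees≤-unique zero    (suc n) = []
  trees≤-unique (suc b) (suc n) = ⊛-unique n 0 (trees≤-unique b) (trees≤-unique b) (λ i → ∈-trees≤⁻ b i)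

  trees-unique : ∀ n → Unique (trees n)
  trees-unique n = trees≤-unique n n

  ∑ : ∀ {A : Set} → List A → (A → ℕ) → ℕ
  ∑ xs f = sum (map f xs)

  module _ {A : Set} where

    ∑-mono : ∀ (xs : List A) {f g} → (∀ {x} → x ∈ xs → f x ≤ g x) → ∑ xs f ≤ ∑ xs g
    ∑-mono []       _   = z≤n
    ∑-mono (x ∷ xs) f≤g = +-mono-≤ (f≤g (here refl)) (∑-mono xs (f≤g ∘ there))

    ∑-cong : ∀ (xs : List A) {f g} → (∀ {x} → x ∈ xs → f x ≡ g x) → ∑ xs f ≡ ∑ xs g
    ∑-cong xs f≡g = cong sum (map-cong-local (All.tabulate f≡g))

    ∑-+ : ∀ (xs : List A) f g → ∑ xs (λ x → f x + g x) ≡ ∑ xs f + ∑ xs g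
    ∑-+ []       f g = refl
    ∑-+ (x ∷ xs) f g = trans (cong (f x + g x +_) (∑-+ xs f g)) (eq (f x) (g x) _ _)
      where
      eq : ∀ a b c d → (a + b) + (c + d) ≡ (a + c) + (b + d)
      eq = solve-∀

    ∑-*ˡ : ∀ (xs : List A) c f → ∑ xs (λ x → c * f x) ≡ c * ∑ xs f
    ∑-*ˡ []       c f = sym (*-zeroʳ c)
    ∑-*ˡ (x ∷ xs) c f = trans (cong (c * f x +_) (∑-*ˡ xs c f)) (sym (*-distribˡ-+ c (f x) _))

    ∑-1 : ∀ (xs : List A) → ∑ xs (λ _ → 1) ≡ length xs
    ∑-1 []       = refl
    ∑-1 (x ∷ xs) = cong suc (∑-1 xs)

  onNode : (Tree → Tree → ℕ) → Tree → ℕ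
  onNode p leaf       = 0
  onNode p (node l r) = p l r

  ∑-cartesianProduct : ∀ a b xs ys →
    ∑ (cartesianProductWith node xs ys) (onNode λ l r → a l * b r) ≡ ∑ xs a * ∑ ys b
  ∑-cartesianProduct a b []       ys = refl
  ∑-cartesianProduct a b (x ∷ xs) ys = begin
    ∑ (map (node x) ys ++ cartesianProductWith node xs ys) f
      ≡⟨ cong sum (map-++ f (map (node x) ys) _) ⟩
    sum (map f (map (node x) ys) ++ map f (cartesianProductWith node xs ys))
      ≡⟨ sum-++ (map f (map (node x) ys)) _ ⟩
    sum (map f (map (node x) ys)) + ∑ (cartesianProductWith node xs ys) f
      ≡⟨ cong₂ _+_ (trans (cong sum (sym (map-∘ ys))) (∑-*ˡ ys (a x) b)) (∑-cartesianProduct a b xs ys) ⟩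
    a x * ∑ ys b + ∑ xs a * ∑ ys b
      ≡⟨ *-distribʳ-+ (∑ ys b) (a x) (∑ xs a) ⟨
    (a x + ∑ xs a) * ∑ ys b ∎
    where
    open ≡-Reasoning
    f = onNode λ l r → a l * b r

  ∑-⊛ : ∀ a b F G n →
    ∑ ((F ⊛ G) n) (onNode λ l r → a l * b r) ≡ ((λ i → ∑ (F i) a) ⊗ (λ j → ∑ (G j) b)) n
  ∑-⊛ a b F G zero    = ∑-cartesianProduct a b (F 0) (G 0)
  ∑-⊛ a b F G (suc n) = begin
    ∑ (cartesianProductWith node (F 0) (G (suc n)) ++ ((F ∘ suc) ⊛ G) n) f
      ≡⟨ cong sum (map-++ f (cartesianProductWith node (F 0) (G (suc n))) _) ⟩
    sum (map f (cartesianProductWith node (F 0) (G (suc n))) ++ map f (((F ∘ suc) ⊛ G) n))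
      ≡⟨ sum-++ (map f (cartesianProductWith node (F 0) (G (suc n)))) _ ⟩
    ∑ (cartesianProductWith node (F 0) (G (suc n))) f + ∑ (((F ∘ suc) ⊛ G) n) f
      ≡⟨ cong₂ _+_ (∑-cartesianProduct a b (F 0) (G (suc n))) (∑-⊛ a b (F ∘ suc) G n) ⟩
    _ ∎
    where
    open ≡-Reasoning
    f = onNode λ l r → a l * b r

  ⟦_⟧ : (Tree → ℕ) → Series
  ⟦ f ⟧ n = ∑ (trees n) f

  ⟦⟧-cong : ∀ {f g} → (∀ t → f t ≡ g t) → ⟦ f ⟧ ≈ ⟦ g ⟧
  ⟦⟧-cong f≡g n = ∑-cong (trees n) (λ {t} _ → f≡g t)

  ⟦⟧-+ : ∀ f g → ⟦ (λ t → f t + g t) ⟧ ≈ ⟦ f ⟧ ⊕ ⟦ g ⟧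
  ⟦⟧-+ f g n = ∑-+ (trees n) f g

  -- The root carries the factor z and the children vary independently; the value 0 of `onNode` at
  -- the leaf is the vanishing constant term.
  ⟦⟧-onNode : ∀ a b → ⟦ onNode (λ l r → a l * b r) ⟧ ≈ z ⊗ (⟦ a ⟧ ⊗ ⟦ b ⟧)
  ⟦⟧-onNode a b zero    = refl
  ⟦⟧-onNode a b (suc n) = begin
    ∑ (trees (suc n)) (onNode λ l r → a l * b r)      ≡⟨ cong (λ ts → ∑ ts (onNode λ l r → a l * b r)) (trees-suc n) ⟩
    ∑ ((trees ⊛ trees) n) (onNode λ l r → a l * b r)  ≡⟨ ∑-⊛ a b trees trees n ⟩
    (⟦ a ⟧ ⊗ ⟦ b ⟧) n                                 ≡⟨ z⊗-suc (⟦ a ⟧ ⊗ ⟦ b ⟧) n ⟨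
    (z ⊗ (⟦ a ⟧ ⊗ ⟦ b ⟧)) (suc n)                     ∎
    where open ≡-Reasoning

  C : Series
  C = ⟦ (λ _ → 1) ⟧

  C-eq : C ≈ 𝟙 ⊕ z ⊗ (C ⊗ C)
  C-eq zero    = refl
  C-eq (suc n) = trans (∑-cong (trees (suc n)) one) (⟦⟧-onNode (λ _ → 1) (λ _ → 1) (suc n))
    where
    one : ∀ {t} → t ∈ trees (suc n) → 1 ≡ onNode (λ l r → 1 * 1) t
    one {leaf}     t∈ = contradiction (∈-trees⁻ (suc n) t∈) λ ()
    one {node _ _} _  = refl

  open Catalan C C-eq public

  isLeaf : Tree → ℕ
  isLeaf leaf       = 1
  isLeaf (node _ _) = 0

  -- Indicator of the nonempty trees without a node that has two children.
  isPath : Tree → ℕ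
  isPath leaf       = 0
  isPath (node l r) = isLeaf l * isLeaf r + (isLeaf l * isPath r + isPath l * isLeaf r)

  ⟦isLeaf⟧ : ⟦ isLeaf ⟧ ≈ 𝟙
  ⟦isLeaf⟧ zero    = refl
  ⟦isLeaf⟧ (suc n) = trans (∑-cong (trees (suc n)) no-leaf) (∑-*ˡ (trees (suc n)) 0 (λ _ → 0))
    where
    no-leaf : ∀ {t} → t ∈ trees (suc n) → isLeaf t ≡ 0
    no-leaf {leaf}     t∈ = contradiction (∈-trees⁻ (suc n) t∈) λ ()
    no-leaf {node _ _} _  = refl

  module _ where
    open CommutativeSemiring series using ()
      renaming (setoid to ≈-setoid; refl to ≈-refl; +-cong to ⊕-cong)
    open import Algebra.Solver.Ring.NaturalCoefficients.Default series
      using (solve; _:=_; _:+_; _:*_; con)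
    open import Relation.Binary.Reasoning.Setoid ≈-setoid

    ⟦isPath⟧-eq : ⟦ isPath ⟧ ≈ z ⊗ (𝟙 ⊕ (⟦ isPath ⟧ ⊕ ⟦ isPath ⟧))
    ⟦isPath⟧-eq = begin
      H  ≈⟨ ⟦⟧-cong (λ { leaf → refl ; (node l r) → refl }) ⟩
      ⟦ (λ t → o e e t + (o e h t + o h e t)) ⟧
         ≈⟨ (λ n → trans (⟦⟧-+ (o e e) (λ t → o e h t + o h e t) n) (cong (⟦ o e e ⟧ n +_) (⟦⟧-+ (o e h) (o h e) n))) ⟩
      ⟦ o e e ⟧ ⊕ (⟦ o e h ⟧ ⊕ ⟦ o h e ⟧)
         ≈⟨ ⊕-cong (⟦⟧-onNode e e) (⊕-cong (⟦⟧-onNode e h) (⟦⟧-onNode h e)) ⟩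
      z ⊗ (⟦ e ⟧ ⊗ ⟦ e ⟧) ⊕ (z ⊗ (⟦ e ⟧ ⊗ H) ⊕ z ⊗ (H ⊗ ⟦ e ⟧))
         ≈⟨ solve 3 (λ z E H → z :* (E :* E) :+ (z :* (E :* H) :+ z :* (H :* E))
                           := z :* (E :* E :+ (E :* H :+ E :* H))) ≈-refl z ⟦ e ⟧ H ⟩
      z ⊗ (⟦ e ⟧ ⊗ ⟦ e ⟧ ⊕ (⟦ e ⟧ ⊗ H ⊕ ⟦ e ⟧ ⊗ H))
         ≈⟨ ⊗-cong {z} ≈-refl (⊕-cong (⊗-cong ⟦isLeaf⟧ ⟦isLeaf⟧) (⊕-cong (⊗-cong ⟦isLeaf⟧ (≈-refl {H})) (⊗-cong ⟦isLeaf⟧ (≈-refl {H})))) ⟩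
      z ⊗ (𝟙 ⊗ 𝟙 ⊕ (𝟙 ⊗ H ⊕ 𝟙 ⊗ H))
         ≈⟨ solve 2 (λ z H → z :* (con 1 :* con 1 :+ (con 1 :* H :+ con 1 :* H)) := z :* (con 1 :+ (H :+ H))) ≈-refl z H ⟩
      z ⊗ (𝟙 ⊕ (H ⊕ H)) ∎
      where
      e = isLeaf
      h = isPath
      H = ⟦ isPath ⟧
      o : (Tree → ℕ) → (Tree → ℕ) → Tree → ℕ
      o a b = onNode λ l r → a l * b r

  -- Every node except the bottom one chooses the side of its only child.
  ⟦isPath⟧ : ∀ n → ⟦ isPath ⟧ (suc n) ≡ 2 ^ n
  ⟦isPath⟧ zero    = refl
  ⟦isPath⟧ (suc n) = trans (⟦isPath⟧-eq (suc (suc n))) (trans (z⊗-suc _ (suc n))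
    (cong₂ _+_ (⟦isPath⟧ n) (trans (⟦isPath⟧ n) (sym (+-identityʳ (2 ^ n))))))

  -- Given by coefficients rather than as an iterated product: it doubles as the indicator of size
  -- k, and multiplying by it is a shift that holds by computation.
  z^ : ℕ → Series
  z^ zero            = 𝟙
  z^ (suc k) zero    = 0
  z^ (suc k) (suc n) = z^ k n

  z^⊗-≥ : ∀ k f m → (z^ k ⊗ f) (k + m) ≡ f m
  z^⊗-≥ zero    f m = ⊗-identityˡ f m
  z^⊗-≥ (suc k) f m = z^⊗-≥ k f m

  z^⊗-< : ∀ k f {n} → n < k → (z^ k ⊗ f) n ≡ 0
  z^⊗-< (suc k) f {zero}  _         = refl
  z^⊗-< (suc k) f {suc n} (s≤s n<k) = z^⊗-< k f n<k

  z^-diagonal : ∀ k → z^ k k ≡ 1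
  z^-diagonal zero    = refl
  z^-diagonal (suc k) = z^-diagonal k

  z^-off-diagonal : ∀ k n → n ≢ k → z^ k n ≡ 0
  z^-off-diagonal zero    zero    n≢k = contradiction refl n≢k
  z^-off-diagonal zero    (suc n) n≢k = refl
  z^-off-diagonal (suc k) zero    n≢k = refl
  z^-off-diagonal (suc k) (suc n) n≢k = z^-off-diagonal k n (n≢k ∘ cong suc)

  isPathOfSize : ℕ → Tree → ℕ
  isPathOfSize k t = z^ k (size t) * isPath t

  -- The number of fringe subtrees that are paths with k nodes, and the number of
  -- ordered pairs of two different such subtrees.
  paths pairs : ℕ → Tree → ℕ
  paths k leaf       = 0
  paths k (node l r) = isPathOfSize k (node l r) + (paths k l + paths k r)
  pairs k leaf       = 0
  pairs k (node l r) = (paths k l * paths k r + paths k l * paths k r) + (pairs k l + pairs k r)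

-- First and second factorial moments of the number of paths of a given size.

module PathCounts where

  open import Algebra.Bundles using (CommutativeSemiring)
  open import Data.Nat.Base
  open import Data.Nat.Properties
  open import Data.Nat.Tactic.RingSolver using (solve-∀)
  open import Data.Product.Base using (_,_)
  open import Relation.Binary.PropositionalEquality
  open import Relation.Nullary.Decidable using (yes; no)

  open PowerSeries
  open Trees

  ⟦isPathOfSize⟧ : ∀ k → ⟦ isPathOfSize (suc k) ⟧ ≈ scale (2 ^ k) (z^ (suc k))
  ⟦isPathOfSize⟧ k n = begin
    ∑ (trees n) (isPathOfSize (suc k))
      ≡⟨ ∑-cong (trees n) (λ {t} t∈ → cong (λ m → z^ (suc k) m * isPath t) (∈-trees⁻ n t∈)) ⟩
    ∑ (trees n) (λ t → z^ (suc k) n * isPath t)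
      ≡⟨ ∑-*ˡ (trees n) (z^ (suc k) n) isPath ⟩
    z^ (suc k) n * ⟦ isPath ⟧ n
      ≡⟨ coefficient n ⟩
    2 ^ k * z^ (suc k) n ∎
    where
    open ≡-Reasoning
    coefficient : ∀ n → z^ (suc k) n * ⟦ isPath ⟧ n ≡ 2 ^ k * z^ (suc k) n
    coefficient zero    = sym (*-zeroʳ (2 ^ k))
    coefficient (suc n) with n ≟ k
    ... | yes refl = trans (cong (z^ k k *_) (⟦isPath⟧ k)) (*-comm (z^ k k) (2 ^ k))
    ... | no n≢k   = trans (cong (_* ⟦ isPath ⟧ (suc n)) (z^-off-diagonal k n n≢k))
                       (sym (trans (cong (2 ^ k *_) (z^-off-diagonal k n n≢k)) (*-zeroʳ (2 ^ k))))

  module _ (k : ℕ) where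
    open CommutativeSemiring series using ()
      renaming (setoid to ≈-setoid; refl to ≈-refl; sym to ≈-sym; trans to ≈-trans; +-cong to ⊕-cong)
    open import Algebra.Solver.Ring.NaturalCoefficients.Default series
      using (solve; _:=_; _:+_; _:*_)
    open import Relation.Binary.Reasoning.Setoid ≈-setoid

    private
      one : Tree → ℕ
      one _ = 1
      o : (Tree → ℕ) → (Tree → ℕ) → Tree → ℕ
      o a b = onNode λ l r → a l * b r
      A N P : Series
      A = ⟦ isPathOfSize k ⟧
      N = ⟦ paths k ⟧
      P = ⟦ pairs k ⟧

      ⟦o+o⟧ : ∀ a b → ⟦ (λ t → o a one t + o one b t) ⟧ ≈ z ⊗ (⟦ a ⟧ ⊗ C) ⊕ z ⊗ (C ⊗ ⟦ b ⟧)
      ⟦o+o⟧ a b = ≈-trans (⟦⟧-+ (o a one) (o one b)) (⊕-cong (⟦⟧-onNode a one) (⟦⟧-onNode one b))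

    -- `paths` is additive, with one term for the whole tree and one for each child, hence N = A +
    -- 2zCN.
    ⟦paths⟧-eq : N ≈ A ⊗ B
    ⟦paths⟧-eq = linear-solution {A} (begin
      N  ≈⟨ ⟦⟧-cong split ⟩
      ⟦ (λ t → isPathOfSize k t + (o (paths k) one t + o one (paths k) t)) ⟧
         ≈⟨ ⟦⟧-+ (isPathOfSize k) _ ⟩
      A ⊕ ⟦ (λ t → o (paths k) one t + o one (paths k) t) ⟧
         ≈⟨ ⊕-cong {A} ≈-refl (⟦o+o⟧ (paths k) (paths k)) ⟩
      A ⊕ (z ⊗ (N ⊗ C) ⊕ z ⊗ (C ⊗ N))
         ≈⟨ solve 4 (λ z C A N → A :+ (z :* (N :* C) :+ z :* (C :* N)) := A :+ z :* ((C :+ C) :* N)) ≈-refl z C A N ⟩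
      A ⊕ z ⊗ ((C ⊕ C) ⊗ N) ∎)
      where
      split : ∀ t → paths k t ≡ isPathOfSize k t + (o (paths k) one t + o one (paths k) t)
      split leaf       = sym (trans (+-identityʳ _) (*-zeroʳ (z^ k 0)))
      split (node l r) = cong (isPathOfSize k (node l r) +_)
        (sym (cong₂ _+_ (*-identityʳ (paths k l)) (*-identityˡ (paths k r))))

    -- A pair is either separated by the root, in two orders, or lies inside one child, so P = 2zN²
    -- + 2zCP and P = 2zN²B. With N = AB this is A² · 2zB³, and 2zB³ = θB.
    ⟦pairs⟧-eq : P ≈ A ⊗ (A ⊗ θ B)
    ⟦pairs⟧-eq = ≈-trans (linear-solution {z ⊗ (N ⊗ N) ⊕ z ⊗ (N ⊗ N)} (begin
      P  ≈⟨ ⟦⟧-cong split ⟩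
      ⟦ (λ t → (o (paths k) (paths k) t + o (paths k) (paths k) t) + (o (pairs k) one t + o one (pairs k) t)) ⟧
         ≈⟨ ≈-trans (⟦⟧-+ (λ t → o (paths k) (paths k) t + o (paths k) (paths k) t) _)
              (⊕-cong (≈-trans (⟦⟧-+ (o (paths k) (paths k)) _) (⊕-cong (⟦⟧-onNode (paths k) (paths k)) (⟦⟧-onNode (paths k) (paths k))))
                      (⟦o+o⟧ (pairs k) (pairs k))) ⟩
      (z ⊗ (N ⊗ N) ⊕ z ⊗ (N ⊗ N)) ⊕ (z ⊗ (P ⊗ C) ⊕ z ⊗ (C ⊗ P))
         ≈⟨ solve 4 (λ z C N P → (z :* (N :* N) :+ z :* (N :* N)) :+ (z :* (P :* C) :+ z :* (C :* P))
                              := (z :* (N :* N) :+ z :* (N :* N)) :+ z :* ((C :+ C) :* P)) ≈-refl z C N P ⟩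
      (z ⊗ (N ⊗ N) ⊕ z ⊗ (N ⊗ N)) ⊕ z ⊗ ((C ⊕ C) ⊗ P) ∎)) (begin
      (z ⊗ (N ⊗ N) ⊕ z ⊗ (N ⊗ N)) ⊗ B
         ≈⟨ ⊗-cong (⊕-cong zNN zNN) (≈-refl {B}) ⟩
      (z ⊗ ((A ⊗ B) ⊗ (A ⊗ B)) ⊕ z ⊗ ((A ⊗ B) ⊗ (A ⊗ B))) ⊗ B
         ≈⟨ solve 3 (λ z A B → (z :* ((A :* B) :* (A :* B)) :+ z :* ((A :* B) :* (A :* B))) :* B
                            := A :* (A :* (z :* (B :* B :* B :+ B :* B :* B)))) ≈-refl z A B ⟩
      A ⊗ (A ⊗ (z ⊗ (B ⊗ B ⊗ B ⊕ B ⊗ B ⊗ B)))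
         ≈⟨ ⊗-cong {A} ≈-refl (⊗-cong {A} ≈-refl θB-eq) ⟨
      A ⊗ (A ⊗ θ B) ∎)
      where
      zNN : z ⊗ (N ⊗ N) ≈ z ⊗ ((A ⊗ B) ⊗ (A ⊗ B))
      zNN = ⊗-cong {z} ≈-refl (⊗-cong ⟦paths⟧-eq ⟦paths⟧-eq)
      split : ∀ t → pairs k t ≡ (o (paths k) (paths k) t + o (paths k) (paths k) t) + (o (pairs k) one t + o one (pairs k) t)
      split leaf       = refl
      split (node l r) = cong (paths k l * paths k r + paths k l * paths k r +_)
        (sym (cong₂ _+_ (*-identityʳ (pairs k l)) (*-identityˡ (pairs k r))))

  module _ (k : ℕ) where
    isPathOfSize⊗ : ∀ f n → (⟦ isPathOfSize (suc k) ⟧ ⊗ f) n ≡ 2 ^ k * (z^ (suc k) ⊗ f) n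
    isPathOfSize⊗ f n = trans (⊗-cong (⟦isPathOfSize⟧ k) (λ _ → refl) n) (⊗-scale (2 ^ k) (z^ (suc k)) f n)

    ⟦paths⟧-≥ : ∀ m → ⟦ paths (suc k) ⟧ (suc k + m) ≡ 2 ^ k * B m
    ⟦paths⟧-≥ m = trans (⟦paths⟧-eq (suc k) (suc k + m))
      (trans (isPathOfSize⊗ B (suc k + m)) (cong (2 ^ k *_) (z^⊗-≥ (suc k) B m)))

    ⟦paths⟧-< : ∀ {n} → n < suc k → ⟦ paths (suc k) ⟧ n ≡ 0
    ⟦paths⟧-< {n} n<k = trans (⟦paths⟧-eq (suc k) n)
      (trans (isPathOfSize⊗ B n) (trans (cong (2 ^ k *_) (z^⊗-< (suc k) B n<k)) (*-zeroʳ (2 ^ k))))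

    ⟦pairs⟧-≥ : ∀ i → ⟦ pairs (suc k) ⟧ (suc k + i) ≡ 2 ^ k * (2 ^ k * (z^ (suc k) ⊗ θ B) i)
    ⟦pairs⟧-≥ i = trans (⟦pairs⟧-eq (suc k) (suc k + i))
      (trans (isPathOfSize⊗ (⟦ isPathOfSize (suc k) ⟧ ⊗ θ B) (suc k + i))
        (cong (2 ^ k *_) (trans (z^⊗-≥ (suc k) (⟦ isPathOfSize (suc k) ⟧ ⊗ θ B) i) (isPathOfSize⊗ (θ B) i))))

  open ≤-Reasoning

  B-suc-≤ : ∀ n → B (suc n) ≤ 4 * B n
  B-suc-≤ n = *-cancelˡ-≤ (suc n) (begin
    suc n * B (suc n)    ≡⟨ B-step n ⟩
    (4 * n + 2) * B n    ≤⟨ *-monoˡ-≤ (B n) (+-monoʳ-≤ (4 * n) (s≤s (s≤s (z≤n {2})))) ⟩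
    (4 * n + 4) * B n    ≡⟨ eq n (B n) ⟩
    suc n * (4 * B n)    ∎)
    where
    eq : ∀ n b → (4 * n + 4) * b ≡ suc n * (4 * b)
    eq = solve-∀

  B-+-≤ : ∀ k m → B (k + m) ≤ 4 ^ k * B m
  B-+-≤ zero    m = ≤-reflexive (sym (*-identityˡ (B m)))
  B-+-≤ (suc k) m = begin
    B (suc (k + m))     ≤⟨ B-suc-≤ (k + m) ⟩
    4 * B (k + m)       ≤⟨ *-monoʳ-≤ 4 (B-+-≤ k m) ⟩
    4 * (4 ^ k * B m)   ≡⟨ *-assoc 4 (4 ^ k) (B m) ⟨
    4 ^ suc k * B m     ∎

  -- Dropping the 2 from 4n + 2 in the recurrence shows that n b_n grows at least by the factor 4 at
  -- each step.
  B-+-≥ : ∀ k m → 4 ^ k * (m * B m) ≤ (k + m) * B (k + m)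
  B-+-≥ zero    m = ≤-reflexive (*-identityˡ (m * B m))
  B-+-≥ (suc k) m = begin
    4 ^ suc k * (m * B m)                ≡⟨ *-assoc 4 (4 ^ k) (m * B m) ⟩
    4 * (4 ^ k * (m * B m))              ≤⟨ *-monoʳ-≤ 4 (B-+-≥ k m) ⟩
    4 * ((k + m) * B (k + m))            ≡⟨ *-assoc 4 (k + m) (B (k + m)) ⟨
    4 * (k + m) * B (k + m)              ≤⟨ *-monoˡ-≤ (B (k + m)) (m≤m+n (4 * (k + m)) 2) ⟩
    (4 * (k + m) + 2) * B (k + m)        ≡⟨ B-step (k + m) ⟨
    suc (k + m) * B (suc (k + m))        ∎

  -- `B-+-≥` is void at m = 0; the factor k + 1 buys a bound that is uniform in m. With n = k + m
  -- the step amounts to (k + 2)(4n + 2) - 4(n + 1)(k + 1) = 4m + 2k ≥ 0.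
  B-+-≥′ : ∀ k m → 4 ^ k * B m ≤ suc k * B (k + m)
  B-+-≥′ zero    m = ≤-refl
  B-+-≥′ (suc k) m = *-cancelˡ-≤ (suc (k + m)) (begin
    suc (k + m) * (4 ^ suc k * B m)               ≡⟨ eq₁ (suc (k + m)) (4 ^ k) (B m) ⟩
    suc (k + m) * 4 * (4 ^ k * B m)               ≤⟨ *-monoʳ-≤ (suc (k + m) * 4) (B-+-≥′ k m) ⟩
    suc (k + m) * 4 * (suc k * B (k + m))         ≤⟨ m≤m+n _ ((4 * m + 2 * k) * B (k + m)) ⟩
    suc (k + m) * 4 * (suc k * B (k + m)) + (4 * m + 2 * k) * B (k + m)
                                                  ≡⟨ eq₂ k m (B (k + m)) ⟩
    suc (suc k) * ((4 * (k + m) + 2) * B (k + m)) ≡⟨ cong (suc (suc k) *_) (B-step (k + m)) ⟨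
    suc (suc k) * (suc (k + m) * B (suc (k + m))) ≡⟨ eq₃ (suc (suc k)) (suc (k + m)) (B (suc (k + m))) ⟩
    suc (k + m) * (suc (suc k) * B (suc (k + m))) ∎)
    where
    eq₁ : ∀ a b c → a * (4 * b * c) ≡ a * 4 * (b * c)
    eq₁ = solve-∀
    eq₂ : ∀ k m b → suc (k + m) * 4 * (suc k * b) + (4 * m + 2 * k) * b
                  ≡ suc (suc k) * ((4 * (k + m) + 2) * b)
    eq₂ = solve-∀
    eq₃ : ∀ a b c → a * (b * c) ≡ b * (a * c)
    eq₃ = solve-∀

  4^≡2^*2^ : ∀ k → 4 ^ k ≡ 2 ^ k * 2 ^ k
  4^≡2^*2^ zero    = refl
  4^≡2^*2^ (suc k) = trans (cong (4 *_) (4^≡2^*2^ k)) (eq (2 ^ k))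
    where
    eq : ∀ x → 4 * (x * x) ≡ (2 * x) * (2 * x)
    eq = solve-∀

  -- As B n = (n + 1) C n, this reads E(N) ≤ (n + 1)(k + 2) / 2^(k + 2) for the number N of paths
  -- with k + 1 nodes. It covers every k, and the surplus factor k + 2 is harmless in the geometric
  -- sum over k.
  ⟦paths⟧-upper : ∀ k n → 2 ^ suc (suc k) * ⟦ paths (suc k) ⟧ n ≤ suc (suc k) * B n
  ⟦paths⟧-upper k n with suc k ≤? n
  ... | no k≰n  = begin
    2 ^ suc (suc k) * ⟦ paths (suc k) ⟧ n  ≡⟨ cong (2 ^ suc (suc k) *_) (⟦paths⟧-< k (≰⇒> k≰n)) ⟩
    2 ^ suc (suc k) * 0                    ≡⟨ *-zeroʳ (2 ^ suc (suc k)) ⟩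
    0                                      ≤⟨ z≤n ⟩
    suc (suc k) * B n                      ∎
  ... | yes k≤n with m , refl ← m≤n⇒∃[o]m+o≡n k≤n = begin
    2 ^ suc (suc k) * ⟦ paths (suc k) ⟧ (suc k + m)  ≡⟨ cong (2 ^ suc (suc k) *_) (⟦paths⟧-≥ k m) ⟩
    2 ^ suc (suc k) * (2 ^ k * B m)                  ≡⟨ eq (2 ^ k) (B m) ⟩
    (2 ^ suc k * 2 ^ suc k) * B m                    ≡⟨ cong (_* B m) (4^≡2^*2^ (suc k)) ⟨
    4 ^ suc k * B m                                  ≤⟨ B-+-≥′ (suc k) m ⟩
    suc (suc k) * B (suc k + m)                      ∎
    where
    eq : ∀ x b → 2 * (2 * x) * (x * b) ≡ (2 * x) * (2 * x) * b
    eq = solve-∀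

  ⟦paths⟧-lower : ∀ k m M → M * 2 ^ suc (suc k) ≤ suc (suc k + m) →
                  M * C (suc k + m) ≤ ⟦ paths (suc k) ⟧ (suc k + m)
  ⟦paths⟧-lower k m M h = *-cancelˡ-≤ (suc n) (*-cancelˡ-≤ 2 (begin
    2 * (suc n * (M * C n))               ≡⟨ eq₁ (suc n) M (C n) ⟩
    2 * M * B n                           ≤⟨ *-monoʳ-≤ (2 * M) (B-+-≤ (suc k) m) ⟩
    2 * M * (4 ^ suc k * B m)             ≡⟨ cong (λ x → 2 * M * (x * B m)) (4^≡2^*2^ (suc k)) ⟩
    2 * M * (2 ^ suc k * 2 ^ suc k * B m) ≡⟨ eq₂ M (2 ^ k) (B m) ⟩
    2 * (M * 2 ^ suc (suc k) * (2 ^ k * B m)) ≤⟨ *-monoʳ-≤ 2 (*-monoˡ-≤ (2 ^ k * B m) h) ⟩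
    2 * (suc n * (2 ^ k * B m))           ≡⟨ cong (λ x → 2 * (suc n * x)) (⟦paths⟧-≥ k m) ⟨
    2 * (suc n * ⟦ paths (suc k) ⟧ n)     ∎))
    where
    n = suc k + m
    eq₁ : ∀ a b c → 2 * (a * (b * c)) ≡ 2 * b * (a * c)
    eq₁ = solve-∀
    eq₂ : ∀ M x b → 2 * M * ((2 * x) * (2 * x) * b) ≡ 2 * (M * (2 * (2 * x)) * (x * b))
    eq₂ = solve-∀

  -- The second factorial moment is at most the square of the first. Put i = n - k - 1 and m = i - k
  -- - 1: `B-+-≤` replaces b_n by 4^(k + 1) b_i, `B-+-≥` absorbs that power and turns m b_m into i
  -- b_i, and i ≤ n + 1 finishes. If n or i is below k + 1, there are no pairs.
  ⟦pairs⟧-upper : ∀ k n → C n * ⟦ pairs (suc k) ⟧ n ≤ ⟦ paths (suc k) ⟧ n * ⟦ paths (suc k) ⟧ n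
  ⟦pairs⟧-upper k n with suc k ≤? n
  ... | no k≰n = begin
    C n * ⟦ pairs (suc k) ⟧ n  ≡⟨ cong (C n *_) pairs≡0 ⟩
    C n * 0                    ≡⟨ *-zeroʳ (C n) ⟩
    0                          ≤⟨ z≤n ⟩
    _                          ∎
    where
    pairs≡0 : ⟦ pairs (suc k) ⟧ n ≡ 0
    pairs≡0 = trans (⟦pairs⟧-eq (suc k) n) (trans (isPathOfSize⊗ k (⟦ isPathOfSize (suc k) ⟧ ⊗ θ B) n)
      (trans (cong (2 ^ k *_) (z^⊗-< (suc k) (⟦ isPathOfSize (suc k) ⟧ ⊗ θ B) (≰⇒> k≰n))) (*-zeroʳ (2 ^ k))))
  ... | yes k≤n with i , refl ← m≤n⇒∃[o]m+o≡n k≤n with suc k ≤? i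
  ...   | no k≰i = begin
    C n * ⟦ pairs (suc k) ⟧ (suc k + i)  ≡⟨ cong (C n *_) (⟦pairs⟧-≥ k i) ⟩
    C n * (2 ^ k * (2 ^ k * (z^ (suc k) ⊗ θ B) i)) ≡⟨ cong (λ x → C n * (2 ^ k * (2 ^ k * x))) (z^⊗-< (suc k) (θ B) (≰⇒> k≰i)) ⟩
    C n * (2 ^ k * (2 ^ k * 0))          ≡⟨ eq (C n) (2 ^ k) ⟩
    0                                    ≤⟨ z≤n ⟩
    _                                    ∎
    where
    eq : ∀ a b → a * (b * (b * 0)) ≡ 0
    eq = solve-∀
  ...   | yes k≤i with m , refl ← m≤n⇒∃[o]m+o≡n k≤i = *-cancelˡ-≤ (suc n) (begin
    suc n * (C n * ⟦ pairs (suc k) ⟧ (suc k + i))             ≡⟨ cong (λ x → suc n * (C n * x)) (⟦pairs⟧-≥ k i) ⟩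
    suc n * (C n * (2 ^ k * (2 ^ k * (z^ (suc k) ⊗ θ B) i)))  ≡⟨ cong (λ x → suc n * (C n * (2 ^ k * (2 ^ k * x)))) (z^⊗-≥ (suc k) (θ B) m) ⟩
    suc n * (C n * (2 ^ k * (2 ^ k * (m * B m))))             ≡⟨ eq₁ (suc n) (C n) (2 ^ k) (m * B m) ⟩
    2 ^ k * 2 ^ k * (B n * (m * B m))                         ≤⟨ *-monoʳ-≤ (2 ^ k * 2 ^ k) (*-monoˡ-≤ (m * B m) (B-+-≤ (suc k) i)) ⟩
    2 ^ k * 2 ^ k * (4 ^ suc k * B i * (m * B m))             ≡⟨ eq₂ (2 ^ k * 2 ^ k) (4 ^ suc k) (B i) (m * B m) ⟩
    2 ^ k * 2 ^ k * B i * (4 ^ suc k * (m * B m))             ≤⟨ *-monoʳ-≤ (2 ^ k * 2 ^ k * B i) (B-+-≥ (suc k) m) ⟩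
    2 ^ k * 2 ^ k * B i * (i * B i)                           ≡⟨ eq₃ (2 ^ k) (B i) i ⟩
    i * ((2 ^ k * B i) * (2 ^ k * B i))                       ≤⟨ *-monoˡ-≤ _ (m≤n⇒m≤1+n (m≤n+m i (suc k))) ⟩
    suc n * ((2 ^ k * B i) * (2 ^ k * B i))                   ≡⟨ cong (λ x → suc n * (x * x)) (⟦paths⟧-≥ k i) ⟨
    suc n * (⟦ paths (suc k) ⟧ (suc k + i) * ⟦ paths (suc k) ⟧ (suc k + i)) ∎)
    where
    eq₁ : ∀ n c x y → n * (c * (x * (x * y))) ≡ x * x * (n * c * y)
    eq₁ = solve-∀
    eq₂ : ∀ a b c d → a * (b * c * d) ≡ a * c * (b * d)
    eq₂ = solve-∀
    eq₃ : ∀ x b i → x * x * b * (i * b) ≡ i * ((x * b) * (x * b))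
    eq₃ = solve-∀

-- First and second moment bounds for the size of the largest path.

module Moments where

  open import Data.Nat.Base
  open import Data.Nat.Properties
  open import Data.Nat.Tactic.RingSolver using (solve-∀)
  open import Data.Product.Base using (_,_)
  open import Data.Sum.Base using (inj₁; inj₂)
  open import Relation.Binary.PropositionalEquality
  open import Relation.Nullary.Decidable using (yes; no)

  open PowerSeries
  open Trees
  open PathCounts

  isPathOfSize-≢ : ∀ k t → size t ≢ k → isPathOfSize k t ≡ 0
  isPathOfSize-≢ k t ≢k = cong (_* isPath t) (z^-off-diagonal k (size t) ≢k)

  paths-< : ∀ k t → size t < k → paths k t ≡ 0
  paths-< k leaf       _   = refl
  paths-< k (node l r) t<k = cong₂ _+_ (isPathOfSize-≢ k (node l r) (<⇒≢ t<k))
    (cong₂ _+_ (paths-< k l (≤-<-trans (m≤n⇒m≤1+n (m≤m+n (size l) (size r))) t<k))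
               (paths-< k r (≤-<-trans (m≤n⇒m≤1+n (m≤n+m (size r) (size l))) t<k)))

  pairs-< : ∀ k t → size t < k → pairs k t ≡ 0
  pairs-< k leaf       _   = refl
  pairs-< k (node l r) t<k
    rewrite paths-< k l (≤-<-trans (m≤n⇒m≤1+n (m≤m+n (size l) (size r))) t<k) =
    cong₂ _+_ (pairs-< k l (≤-<-trans (m≤n⇒m≤1+n (m≤m+n (size l) (size r))) t<k))
              (pairs-< k r (≤-<-trans (m≤n⇒m≤1+n (m≤n+m (size r) (size l))) t<k))

  isPath-idem : ∀ t → isPath t * isPath t ≡ isPath t
  isPath-idem leaf                          = refl
  isPath-idem (node leaf leaf)              = refl
  isPath-idem (node leaf r@(node _ _))
    = subst (λ x → x * x ≡ x) (sym (trans (+-identityʳ _) (+-identityʳ _))) (isPath-idem r)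
  isPath-idem (node l@(node _ _) leaf)
    = subst (λ x → x * x ≡ x) (sym (*-identityʳ (isPath l))) (isPath-idem l)
  isPath-idem (node l@(node _ _) (node _ _))
    = subst (λ x → x * x ≡ x) (sym (*-zeroʳ (isPath l))) refl

  -- This is N² = N + N(N - 1). In a tree of size k all proper subtrees are too small to count, so N
  -- = `isPath` is 0 or 1 and there are no pairs; this is why `pairs` has no term for a path at the
  -- root. At other sizes the root adds no path, and the cross term 2xy supplies the pairs that it
  -- separates.
  paths² : ∀ k t → paths k t * paths k t ≡ paths k t + pairs k t
  paths² k leaf = refl
  paths² k (node l r) with size (node l r) ≟ k
  ... | no ≢k rewrite isPathOfSize-≢ k (node l r) ≢k = begin
    (x + y) * (x + y)                          ≡⟨ eq₁ x y ⟩
    x * x + y * y + (x * y + x * y)            ≡⟨ cong₂ (λ u v → u + v + (x * y + x * y)) (paths² k l) (paths² k r) ⟩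
    (x + p) + (y + q) + (x * y + x * y)        ≡⟨ eq₂ x y p q (x * y + x * y) ⟩
    (x + y) + ((x * y + x * y) + (p + q))      ∎
    where
    open ≡-Reasoning
    x = paths k l
    y = paths k r
    p = pairs k l
    q = pairs k r
    eq₁ : ∀ x y → (x + y) * (x + y) ≡ x * x + y * y + (x * y + x * y)
    eq₁ = solve-∀
    eq₂ : ∀ x y p q w → (x + p) + (y + q) + w ≡ (x + y) + (w + (p + q))
    eq₂ = solve-∀
  ... | yes refl
    rewrite paths-< k l (s≤s (m≤m+n (size l) (size r)))
          | paths-< k r (s≤s (m≤n+m (size r) (size l)))
          | z^-diagonal (size l + size r)
          | pairs-< k l (s≤s (m≤m+n (size l) (size r)))
          | pairs-< k r (s≤s (m≤n+m (size r) (size l))) = begin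
    (h + 0 + 0) * (h + 0 + 0)  ≡⟨ eq h ⟩
    h * h                      ≡⟨ isPath-idem (node l r) ⟩
    h                          ≡⟨ eq′ h ⟩
    h + 0 + 0 + 0              ∎
    where
    open ≡-Reasoning
    h = isPath (node l r)
    eq : ∀ h → (h + 0 + 0) * (h + 0 + 0) ≡ h * h
    eq = solve-∀
    eq′ : ∀ h → h ≡ h + 0 + 0 + 0
    eq′ = solve-∀

  open ≤-Reasoning

  -- ∑ from K j f = f K + f (K + 1) + … + f (K + j − 1)
  ∑from : ℕ → ℕ → (ℕ → ℕ) → ℕ
  ∑from K zero    f = 0
  ∑from K (suc j) f = f K + ∑from (suc K) j f

  ∑-∑from : ∀ n K j (f : ℕ → Tree → ℕ) →
            ⟦ (λ t → ∑from K j (λ i → f i t)) ⟧ n ≡ ∑from K j (λ i → ⟦ f i ⟧ n)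
  ∑-∑from n K zero    f = ∑-*ˡ (trees n) 0 (λ _ → 0)
  ∑-∑from n K (suc j) f = trans (⟦⟧-+ (f K) _ n) (cong (⟦ f K ⟧ n +_) (∑-∑from n (suc K) j f))

  -- ∑_{k > K} (k + 1) / 2^{k + 1} = (K + 3) / 2^{K + 1}
  ∑from-geometric : ∀ X f → (∀ k → 2 ^ suc (suc k) * f k ≤ suc (suc k) * X) →
                    ∀ K j → 2 ^ suc K * ∑from K j f ≤ (3 + K) * X
  ∑from-geometric X f f≤ K zero    = ≤-trans (≤-reflexive (*-zeroʳ (2 ^ suc K))) z≤n
  ∑from-geometric X f f≤ K (suc j) = *-cancelˡ-≤ 2 (begin
    2 * (2 ^ suc K * (f K + ∑from (suc K) j f))
      ≡⟨ eq₁ (2 ^ suc K) (f K) _ ⟩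
    2 ^ suc (suc K) * f K + 2 ^ suc (suc K) * ∑from (suc K) j f
      ≤⟨ +-mono-≤ (f≤ K) (∑from-geometric X f f≤ (suc K) j) ⟩
    suc (suc K) * X + (3 + suc K) * X
      ≡⟨ eq₂ K X ⟩
    2 * ((3 + K) * X) ∎)
    where
    eq₁ : ∀ a b c → 2 * (a * (b + c)) ≡ 2 * a * b + 2 * a * c
    eq₁ = solve-∀
    eq₂ : ∀ K X → suc (suc K) * X + (3 + suc K) * X ≡ 2 * ((3 + K) * X)
    eq₂ = solve-∀

  2xy≤x²+y² : ∀ x y → 2 * (x * y) ≤ x * x + y * y
  2xy≤x²+y² x y with ≤-total x y
  ... | inj₁ x≤y with d , refl ← m≤n⇒∃[o]m+o≡n x≤y =
    ≤-trans (m≤m+n _ (d * d)) (≤-reflexive (eq x d))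
    where
    eq : ∀ x d → 2 * (x * (x + d)) + d * d ≡ x * x + (x + d) * (x + d)
    eq = solve-∀
  ... | inj₂ y≤x with d , refl ← m≤n⇒∃[o]m+o≡n y≤x =
    ≤-trans (m≤m+n _ (d * d)) (≤-reflexive (eq y d))
    where
    eq : ∀ y d → 2 * ((y + d) * y) + d * d ≡ (y + d) * (y + d) + y * y
    eq = solve-∀

  -- For N > 0 this is (aN - b)² ≥ 0; at N = 0 the b² is switched off by `1 ⊓ N`. Summed over all
  -- trees it replaces Cauchy-Schwarz. With T the number of trees and S = ∑ N, the ratio a : b = T :
  -- (T + S) maximises the bound that follows from T ∑ N(N - 1) ≤ S².
  quadratic-≤ : ∀ a b N → 2 * (a * b) * N ≤ a * a * (N * N) + b * b * (1 ⊓ N)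
  quadratic-≤ a b zero    = ≤-trans (≤-reflexive (*-zeroʳ (2 * (a * b)))) z≤n
  quadratic-≤ a b N@(suc _) = begin
    2 * (a * b) * N                  ≡⟨ eq₁ a b N ⟩
    2 * ((a * N) * b)                ≤⟨ 2xy≤x²+y² (a * N) b ⟩
    (a * N) * (a * N) + b * b        ≡⟨ eq₂ a b N ⟩
    a * a * (N * N) + b * b * 1      ∎
    where
    eq₁ : ∀ a b N → 2 * (a * b) * N ≡ 2 * ((a * N) * b)
    eq₁ = solve-∀
    eq₂ : ∀ a b N → (a * N) * (a * N) + b * b ≡ a * a * (N * N) + b * b * 1
    eq₂ = solve-∀

  C-nonZero : ∀ n → 0 < C n
  C-nonZero zero    = s≤s z≤n
  C-nonZero (suc n) = ≤-trans (C-nonZero n) (begin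
    C n          ≡⟨ *-identityˡ (C n) ⟨
    1 * C n      ≤⟨ head≤ n ⟩
    (C ⊗ C) n    ≡⟨ trans (C-eq (suc n)) (z⊗-suc (C ⊗ C) n) ⟨
    C (suc n)    ∎)
    where
    head≤ : ∀ n → 1 * C n ≤ (C ⊗ C) n
    head≤ zero    = ≤-refl
    head≤ (suc n) = m≤m+n (1 * C (suc n)) _

  -- The second moment method: the quadratic inequality with a = C n and
  -- b = C n + ∑ N bounds the number of t with N t > 0 from below.
  second-moment : ∀ k n → let S = ⟦ paths (suc k) ⟧ n in
                  C n * S ≤ (C n + S) * ⟦ (λ t → 1 ⊓ paths (suc k) t) ⟧ n
  second-moment k n = *-cancelˡ-≤ b {{>-nonZero (≤-trans (C-nonZero n) (m≤m+n T S))}} (+-cancelˡ-≤ (b * (T * S)) _ _ (begin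
    b * (T * S) + b * (T * S)
      ≡⟨ eq₁ T b S ⟩
    2 * (T * b) * S
      ≡⟨ ∑-*ˡ (trees n) (2 * (T * b)) N ⟨
    ⟦ (λ t → 2 * (T * b) * N t) ⟧ n
      ≤⟨ ∑-mono (trees n) (λ {t} _ → quadratic-≤ T b (N t)) ⟩
    ⟦ (λ t → T * T * (N t * N t) + b * b * (1 ⊓ N t)) ⟧ n
      ≡⟨ trans (⟦⟧-+ (λ t → T * T * (N t * N t)) _ n)
           (cong₂ _+_ (∑-*ˡ (trees n) (T * T) (λ t → N t * N t)) (∑-*ˡ (trees n) (b * b) (λ t → 1 ⊓ N t))) ⟩
    T * T * ⟦ (λ t → N t * N t) ⟧ n + b * b * Z
      ≡⟨ cong (λ x → T * T * x + b * b * Z) (trans (⟦⟧-cong (paths² (suc k)) n) (⟦⟧-+ N (pairs (suc k)) n)) ⟩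
    T * T * (S + P) + b * b * Z
      ≡⟨ eq₂ T S P (b * b * Z) ⟩
    T * (T * S + T * P) + b * b * Z
      ≤⟨ +-monoˡ-≤ (b * b * Z) (*-monoʳ-≤ T (+-monoʳ-≤ (T * S) (⟦pairs⟧-upper k n))) ⟩
    T * (T * S + S * S) + b * b * Z
      ≡⟨ eq₃ T S Z ⟩
    b * (T * S) + b * (b * Z) ∎))
    where
    N = paths (suc k)
    T = C n
    S = ⟦ N ⟧ n
    P = ⟦ pairs (suc k) ⟧ n
    Z = ⟦ (λ t → 1 ⊓ N t) ⟧ n
    b = T + S
    eq₁ : ∀ T b S → b * (T * S) + b * (T * S) ≡ 2 * (T * b) * S
    eq₁ = solve-∀
    eq₂ : ∀ T S P w → T * T * (S + P) + w ≡ T * (T * S + T * P) + w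
    eq₂ = solve-∀
    eq₃ : ∀ T S Z → T * (T * S + S * S) + (T + S) * (T + S) * Z
                  ≡ (T + S) * (T * S) + (T + S) * ((T + S) * Z)
    eq₃ = solve-∀

  -- The monotonicity of S / (T + S) in S, without division. Write S = MT + r: if (M + 1) Z < T M,
  -- then (T + S) Z < T S, where Z ≤ T takes care of the part with r.
  ratio-bound : ∀ {T S Z} M → 0 < T → Z ≤ T → M * T ≤ S → T * S ≤ (T + S) * Z → T * M ≤ suc M * Z
  ratio-bound {T} {S} {Z} M 0<T Z≤T MT≤S h with r , refl ← m≤n⇒∃[o]m+o≡n MT≤S = ≮⇒≥ λ lt → <⇒≱ (begin-strict
    (T + (M * T + r)) * Z        ≡⟨ eq₁ T M r Z ⟩
    T * (suc M * Z) + r * Z      <⟨ +-mono-<-≤ (*-monoʳ-< T {{>-nonZero 0<T}} lt) (*-monoʳ-≤ r Z≤T) ⟩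
    T * (T * M) + r * T          ≡⟨ eq₂ T M r ⟩
    T * (M * T + r)              ∎) h
    where
    eq₁ : ∀ T M r Z → (T + (M * T + r)) * Z ≡ T * (suc M * Z) + r * Z
    eq₁ = solve-∀
    eq₂ : ∀ T M r → T * (T * M) + r * T ≡ T * (M * T + r)
    eq₂ = solve-∀

  -- The hypotheses pin `L` down as the size of the largest path, and they are all that the
  -- estimates use about γ. The second one asks for every size up to `L t`; it holds because a path
  -- contains paths of all smaller positive sizes.
  module Largest (L : Tree → ℕ)
    (paths⇒≤L : ∀ k t → 0 < paths k t → k ≤ L t)
    (≤L⇒paths : ∀ k t → 0 < k → k ≤ L t → 0 < paths k t) where

    L≤size : ∀ t → L t ≤ size t
    L≤size t = ≮⇒≥ λ lt → <-irrefl (sym (paths-< (L t) t lt)) (≤L⇒paths (L t) t (≤-<-trans z≤n lt) ≤-refl)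

    -- Each size k with K < k ≤ L t occurs and adds at least 1, so the sum makes up for L t - K.
    L≤∑paths : ∀ n K t → L t ≤ K + n → L t ≤ K + ∑from K n (λ k → paths (suc k) t)
    L≤∑paths zero    K t L≤ = L≤
    L≤∑paths (suc n) K t L≤ with L t ≤? K
    ... | yes L≤K = ≤-trans L≤K (m≤m+n K _)
    ... | no L≰K  = begin
      L t                                                ≤⟨ L≤∑paths n (suc K) t (≤-trans L≤ (≤-reflexive (+-suc K n))) ⟩
      suc K + rest                                       ≡⟨ +-suc K rest ⟨
      K + (1 + rest)                                     ≤⟨ +-monoʳ-≤ K (+-monoˡ-≤ rest (≤L⇒paths (suc K) t (s≤s z≤n) (≰⇒> L≰K))) ⟩
      K + (paths (suc K) t + rest)                       ∎
      where rest = ∑from (suc K) n (λ k → paths (suc k) t)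

    ∑L-upper : ∀ c ℓ n → n < 2 ^ suc ℓ →
               2 ^ c * ⟦ L ⟧ n ≤ C n * (2 ^ c * (ℓ + c) + (3 + (ℓ + c)))
    ∑L-upper c ℓ n n<2^ℓ = begin
      2 ^ c * ⟦ L ⟧ n
        ≤⟨ *-monoʳ-≤ (2 ^ c) (∑-mono (trees n) (λ {t} t∈ → L≤∑paths n K t
             (≤-trans (≤-trans (L≤size t) (≤-reflexive (∈-trees⁻ n t∈))) (m≤n+m n K)))) ⟩
      2 ^ c * ⟦ (λ t → K + ∑from K n (λ k → paths (suc k) t)) ⟧ n
        ≡⟨ cong (2 ^ c *_) (trans (⟦⟧-+ (λ _ → K) _ n) (cong₂ _+_ const (∑-∑from n K n (λ k → paths (suc k))))) ⟩
      2 ^ c * (C n * K + tail′)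
        ≡⟨ eq₁ (2 ^ c) (C n) K tail′ ⟩
      C n * (2 ^ c * K) + 2 ^ c * tail′
        ≤⟨ +-monoʳ-≤ (C n * (2 ^ c * K)) tail-bound ⟩
      C n * (2 ^ c * K) + C n * (3 + K)
        ≡⟨ *-distribˡ-+ (C n) (2 ^ c * K) (3 + K) ⟨
      C n * (2 ^ c * K + (3 + K)) ∎
      where
      K = ℓ + c
      tail′ = ∑from K n (λ k → ⟦ paths (suc k) ⟧ n)
      const : ⟦ (λ _ → K) ⟧ n ≡ C n * K
      const = trans (∑-cong (trees n) (λ _ → sym (*-identityʳ K))) (trans (∑-*ˡ (trees n) K (λ _ → 1)) (*-comm K (C n)))
      eq₁ : ∀ D T K s → D * (T * K + s) ≡ T * (D * K) + D * s
      eq₁ = solve-∀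
      eq₂ : ∀ a k c → k * (a * c) ≡ a * (c * k)
      eq₂ = solve-∀
      -- The 2^(K + 1) of the geometric bound is 2^(ℓ + 1) · 2^c, and its first factor swallows the
      -- n + 1 in B n = (n + 1) C n.
      tail-bound : 2 ^ c * tail′ ≤ C n * (3 + K)
      tail-bound = *-cancelˡ-≤ (2 ^ suc ℓ) {{m^n≢0 2 (suc ℓ)}} (begin
        2 ^ suc ℓ * (2 ^ c * tail′)   ≡⟨ *-assoc (2 ^ suc ℓ) (2 ^ c) tail′ ⟨
        2 ^ suc ℓ * 2 ^ c * tail′     ≡⟨ cong (_* tail′) (^-distribˡ-+-* 2 (suc ℓ) c) ⟨
        2 ^ suc K * tail′             ≤⟨ ∑from-geometric (B n) _ (λ k → ⟦paths⟧-upper k n) K n ⟩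
        (3 + K) * (suc n * C n)       ≤⟨ *-monoʳ-≤ (3 + K) (*-monoˡ-≤ (C n) n<2^ℓ) ⟩
        (3 + K) * (2 ^ suc ℓ * C n)   ≡⟨ eq₂ (2 ^ suc ℓ) (3 + K) (C n) ⟩
        2 ^ suc ℓ * (C n * (3 + K))   ∎)

    -- With N the number of paths with k + 1 nodes, E(L) ≥ (k + 1) P(N > 0), and P(N > 0) ≥ M / (M +
    -- 1) as soon as E(N) ≥ M.
    ∑L-lower : ∀ M k n → suc k ≤ n → M * 2 ^ suc (suc k) ≤ suc n →
               C n * M * suc k ≤ suc M * ⟦ L ⟧ n
    ∑L-lower M k n k≤n h with m , refl ← m≤n⇒∃[o]m+o≡n k≤n = begin
      C n * M * suc k        ≤⟨ *-monoˡ-≤ (suc k) (ratio-bound M (C-nonZero n)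
                                  (∑-mono (trees n) (λ {t} _ → m⊓n≤m 1 (N t))) (⟦paths⟧-lower k m M h) (second-moment k n)) ⟩
      suc M * Z * suc k      ≡⟨ trans (*-assoc (suc M) Z (suc k)) (cong (suc M *_) (*-comm Z (suc k))) ⟩
      suc M * (suc k * Z)    ≡⟨ cong (suc M *_) (∑-*ˡ (trees n) (suc k) (λ t → 1 ⊓ N t)) ⟨
      suc M * ⟦ (λ t → suc k * (1 ⊓ N t)) ⟧ n ≤⟨ *-monoʳ-≤ (suc M) (∑-mono (trees n) (λ {t} _ → pointwise t)) ⟩
      suc M * ⟦ L ⟧ n        ∎
      where
      N = paths (suc k)
      Z = ⟦ (λ t → 1 ⊓ N t) ⟧ n
      pointwise : ∀ t → suc k * (1 ⊓ N t) ≤ L t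
      pointwise t with N t in eq
      ... | zero  = ≤-trans (≤-reflexive (*-zeroʳ (suc k))) z≤n
      ... | suc _ = ≤-trans (≤-reflexive (*-identityʳ (suc k))) (paths⇒≤L (suc k) t (≤-trans (s≤s z≤n) (≤-reflexive (sym eq))))

-- The permutation of a tree, and its patterns 312 and 213.

module TreePermutations where

  open import Data.Empty using (⊥; ⊥-elim)
  open import Data.Fin.Base using (zero; suc)
  open import Data.List.Base using (List; []; _∷_; _++_; length)
  open import Data.List.Properties using (length-++; ∷-injectiveˡ; ∷-injectiveʳ)
  open import Data.List.Membership.Propositional using (_∈_; _∉_)
  open import Data.List.Membership.Propositional.Properties
  open import Data.List.Relation.Binary.Sublist.Propositional as Sublist using (_⊆_; []; _∷_; _∷ʳ_; from∈)
  open import Data.List.Relation.Binary.Sublist.Propositional.Properties as Sublist using ()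
  open import Data.List.Relation.Unary.All as All using ([]; _∷_)
  open import Data.List.Relation.Unary.AllPairs using ([]; _∷_)
  open import Data.List.Relation.Unary.Any using (here; there)
  open import Data.List.Relation.Unary.Unique.Propositional using (Unique)
  open import Data.List.Relation.Unary.Unique.Propositional.Properties as Unique using ()
  open import Data.Nat.Base
  open import Data.Nat.Properties
  open import Data.Product.Base using (_,_; _×_; proj₁; proj₂; ∃-syntax)
  open import Data.Sum.Base using (_⊎_; inj₁; inj₂)
  open import Function.Base using (_∘_)
  open import Function.Bundles using (mk⇔; Equivalence)
  open import Relation.Binary.PropositionalEquality
  open import Relation.Nullary.Negation using (contradiction)

  open Trees

  -- In an Av(312) permutation all entries to the left of the least one are
  -- smaller than those to its right.
  perm : ℕ → Tree → List ℕ
  perm a leaf       = []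
  perm a (node l r) = perm (suc a) l ++ a ∷ perm (suc a + size l) r

  -- The number stored with a subtree is the value of its root, the least entry of its block and
  -- hence the entry that generates it.
  subtrees : ℕ → Tree → List (ℕ × Tree)
  subtrees a leaf       = []
  subtrees a (node l r) = subtrees (suc a) l ++ (a , node l r) ∷ subtrees (suc a + size l) r

  length-perm : ∀ a t → length (perm a t) ≡ size t
  length-perm a leaf       = refl
  length-perm a (node l r) = begin
    length (perm (suc a) l ++ a ∷ perm (suc a + size l) r)          ≡⟨ length-++ (perm (suc a) l) ⟩
    length (perm (suc a) l) + suc (length (perm (suc a + size l) r)) ≡⟨ cong₂ (λ x y → x + suc y) (length-perm (suc a) l) (length-perm _ r) ⟩
    size l + suc (size r)                                           ≡⟨ +-suc (size l) (size r) ⟩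
    suc (size l + size r)                                           ∎
    where open ≡-Reasoning

  perm-bounds : ∀ a t {x} → x ∈ perm a t → a ≤ x × x < a + size t
  perm-bounds a (node l r) {x} x∈ with ∈-++⁻ (perm (suc a) l) x∈
  ... | inj₁ x∈l with a<x , x<b ← perm-bounds (suc a) l x∈l =
    <⇒≤ a<x , <-≤-trans x<b (≤-trans (s≤s (+-monoʳ-≤ a (m≤m+n (size l) (size r)))) (≤-reflexive (sym (+-suc a _))))
  ... | inj₂ (here refl) = ≤-refl , m<m+n a (s≤s z≤n)
  ... | inj₂ (there x∈r) with b≤x , x<c ← perm-bounds (suc a + size l) r x∈r =
    ≤-trans (n≤1+n a) (≤-trans (m≤m+n (suc a) (size l)) b≤x) ,
    <-≤-trans x<c (≤-reflexive (trans (cong suc (+-assoc a (size l) (size r))) (sym (+-suc a _))))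

  module _ {a : ℕ} {l r : Tree} where
    left< : ∀ {x} → x ∈ perm (suc a) l → a < x × x < suc a + size l
    left< = perm-bounds (suc a) l

    right> : ∀ {y} → y ∈ perm (suc a + size l) r → suc a + size l ≤ y
    right> = proj₁ ∘ perm-bounds (suc a + size l) r

    right>a : ∀ {y} → y ∈ perm (suc a + size l) r → a < y
    right>a = ≤-trans (m≤m+n (suc a) (size l)) ∘ right>

  perm-unique : ∀ a t → Unique (perm a t)
  perm-unique a leaf       = []
  perm-unique a (node l r) = Unique.++⁺ (perm-unique (suc a) l)
    (All.tabulate (λ y∈ a≡y → <-irrefl a≡y (right>a {a} {l} {r} y∈)) ∷ perm-unique (suc a + size l) r)
    λ { (x∈l , here refl) → <-irrefl refl (proj₁ (left< {a} {l} {r} x∈l))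
      ; (x∈l , there x∈r) → <⇒≱ (proj₂ (left< {a} {l} {r} x∈l)) (right> {a} {l} {r} x∈r) }

  ++-∷-injective : ∀ {A : Set} {a : A} us us′ {vs vs′} → a ∉ us → a ∉ us′ →
                   us ++ a ∷ vs ≡ us′ ++ a ∷ vs′ → us ≡ us′ × vs ≡ vs′
  ++-∷-injective []       []         _  _  eq = refl , ∷-injectiveʳ eq
  ++-∷-injective []       (_ ∷ us′)  _  a∉ eq = contradiction (here (∷-injectiveˡ eq)) a∉
  ++-∷-injective (_ ∷ us) []         a∉ _  eq = contradiction (here (sym (∷-injectiveˡ eq))) a∉
  ++-∷-injective (u ∷ us) (u′ ∷ us′) a∉ a∉′ eq
    with refl ← ∷-injectiveˡ eq
    with refl , vs≡ ← ++-∷-injective us us′ (a∉ ∘ there) (a∉′ ∘ there) (∷-injectiveʳ eq) = refl , vs≡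

  root∉left : ∀ a l → a ∉ perm (suc a) l
  root∉left a l a∈ = <-irrefl refl (proj₁ (perm-bounds (suc a) l a∈))

  []≢++∷ : ∀ {A : Set} {a : A} us {vs} → [] ≢ us ++ a ∷ vs
  []≢++∷ []      ()
  []≢++∷ (_ ∷ _) ()

  -- The value `a` occurs exactly once in a nonempty word, so both words split at the same place.
  perm-injective : ∀ a t t′ → perm a t ≡ perm a t′ → t ≡ t′
  perm-injective a leaf       leaf         eq = refl
  perm-injective a leaf       (node l′ r′) eq = contradiction eq ([]≢++∷ (perm (suc a) l′))
  perm-injective a (node l r) leaf         eq = contradiction (sym eq) ([]≢++∷ (perm (suc a) l))
  perm-injective a (node l r) (node l′ r′) eq
    with l≡ , r≡ ← ++-∷-injective (perm (suc a) l) (perm (suc a) l′) (root∉left a l) (root∉left a l′) eq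
    with refl ← perm-injective (suc a) l l′ l≡
    with refl ← perm-injective (suc a + size l) r r′ r≡ = refl

  ⊆-++⁻ : ∀ {A : Set} {xs : List A} ys {zs} → xs ⊆ ys ++ zs →
          ∃[ us ] ∃[ vs ] (xs ≡ us ++ vs × us ⊆ ys × vs ⊆ zs)
  ⊆-++⁻ []       p          = [] , _ , refl , [] , p
  ⊆-++⁻ (y ∷ ys) (.y ∷ʳ p)  with us , vs , eq , q , r ← ⊆-++⁻ ys p = us , vs , eq , y ∷ʳ q , r
  ⊆-++⁻ (y ∷ ys) (refl ∷ p) with us , vs , eq , q , r ← ⊆-++⁻ ys p = y ∷ us , vs , cong (y ∷_) eq , refl ∷ q , r

  SameOrder : ℕ → ℕ → ℕ → ℕ → Set
  SameOrder x y x′ y′ = (x < y × x′ < y′) ⊎ (y < x × y′ < x′)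

  ≅-triple : ∀ {x y w x′ y′ w′} → SameOrder x y x′ y′ → SameOrder x w x′ w′ → SameOrder y w y′ w′ →
             (x ∷ y ∷ w ∷ []) ≅ (x′ ∷ y′ ∷ w′ ∷ [])
  ≅-triple p q r = refl , λ
    { zero zero → mk⇔ (⊥-elim ∘ <-irrefl refl) (⊥-elim ∘ <-irrefl refl)
    ; zero (suc zero) → forward p
    ; zero (suc (suc zero)) → forward q
    ; (suc zero) zero → backward p
    ; (suc zero) (suc zero) → mk⇔ (⊥-elim ∘ <-irrefl refl) (⊥-elim ∘ <-irrefl refl)
    ; (suc zero) (suc (suc zero)) → forward r
    ; (suc (suc zero)) zero → backward q
    ; (suc (suc zero)) (suc zero) → backward r
    ; (suc (suc zero)) (suc (suc zero)) → mk⇔ (⊥-elim ∘ <-irrefl refl) (⊥-elim ∘ <-irrefl refl)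
    }
    where
    forward : ∀ {x y x′ y′} → SameOrder x y x′ y′ → _
    forward (inj₁ (x<y , x′<y′)) = mk⇔ (λ _ → x′<y′) (λ _ → x<y)
    forward (inj₂ (y<x , y′<x′)) = mk⇔ (⊥-elim ∘ <-asym y<x) (⊥-elim ∘ <-asym y′<x′)
    backward : ∀ {x y x′ y′} → SameOrder x y x′ y′ → _
    backward (inj₁ (x<y , x′<y′)) = mk⇔ (⊥-elim ∘ <-asym x<y) (⊥-elim ∘ <-asym x′<y′)
    backward (inj₂ (y<x , y′<x′)) = mk⇔ (λ _ → y′<x′) (λ _ → y<x)

  contains-312⁺ : ∀ {π c a b} → c ∷ a ∷ b ∷ [] ⊆ π → a < b → b < c → Contains p312 π
  contains-312⁺ τ⊆π a<b b<c = _ , τ⊆π , ≅-triple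
    (inj₂ (<-trans a<b b<c , s≤s (s≤s z≤n))) (inj₂ (b<c , ≤-refl)) (inj₁ (a<b , ≤-refl))

  contains-312⁻ : ∀ {π} → Contains p312 π → ∃[ c ] ∃[ a ] ∃[ b ] (c ∷ a ∷ b ∷ [] ⊆ π × a < b × b < c)
  contains-312⁻ (c ∷ a ∷ b ∷ [] , τ⊆π , refl , iso) = c , a , b , τ⊆π ,
    Equivalence.from (iso (suc zero) (suc (suc zero))) ≤-refl ,
    Equivalence.from (iso (suc (suc zero)) zero) ≤-refl

  contains-213⁺ : ∀ {π b a c} → b ∷ a ∷ c ∷ [] ⊆ π → a < b → b < c → Contains p213 π
  contains-213⁺ τ⊆π a<b b<c = _ , τ⊆π , ≅-triple
    (inj₂ (a<b , ≤-refl)) (inj₁ (b<c , ≤-refl)) (inj₁ (<-trans a<b b<c , s≤s (s≤s z≤n)))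

  contains-213⁻ : ∀ {π} → Contains p213 π → ∃[ b ] ∃[ a ] ∃[ c ] (b ∷ a ∷ c ∷ [] ⊆ π × a < b × b < c)
  contains-213⁻ (b ∷ a ∷ c ∷ [] , τ⊆π , refl , iso) = b , a , c , τ⊆π ,
    Equivalence.from (iso (suc zero) zero) ≤-refl ,
    Equivalence.from (iso zero (suc (suc zero))) ≤-refl

  last∈ : ∀ {A : Set} {x y a : A} {ys} → x ∷ y ∷ [] ⊆ a ∷ ys → y ∈ ys
  last∈ (_ ∷ʳ p) = Sublist.lookup p (there (here refl))
  last∈ (_ ∷ p)  = Sublist.lookup p (here refl)

  -- Let c x y be an occurrence, x < y < c. The root is the least entry, hence neither c nor y.
  -- Entries left of the root are smaller than those right of it, so c and y are on the same side,
  -- and the occurrence lies in one child.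
  perm-avoids-312 : ∀ a t → Avoids p312 (perm a t)
  perm-avoids-312 a t cont with _ , _ , _ , τ⊆ , x<y , y<c ← contains-312⁻ cont = go a t τ⊆ x<y y<c
    where
    go : ∀ a t {c x y} → c ∷ x ∷ y ∷ [] ⊆ perm a t → x < y → y < c → ⊥
    go a (node l r) τ⊆ x<y y<c with ⊆-++⁻ (perm (suc a) l) τ⊆
    ... | [] , _ , refl , _ , _ ∷ʳ q = go (suc a + size l) r q x<y y<c
    ... | [] , _ , refl , _ , refl ∷ q =
      <-asym (<-trans x<y y<c) (right>a {a} {l} {r} (Sublist.lookup q (here refl)))
    ... | _ ∷ [] , _ , refl , p , q =
      <-asym y<c (<-≤-trans (proj₂ (left< {a} {l} {r} (Sublist.lookup p (here refl)))) (right> {a} {l} {r} (last∈ q)))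
    ... | _ ∷ _ ∷ [] , _ , refl , p , refl ∷ _ =
      <-asym x<y (proj₁ (left< {a} {l} {r} (Sublist.lookup p (there (here refl)))))
    ... | _ ∷ _ ∷ [] , _ , refl , p , _ ∷ʳ q =
      <-asym y<c (<-≤-trans (proj₂ (left< {a} {l} {r} (Sublist.lookup p (here refl))))
                            (right> {a} {l} {r} (Sublist.lookup q (here refl))))
    ... | _ ∷ _ ∷ _ ∷ [] , _ , refl , p , _ = go (suc a) l p x<y y<c

  -- Unlike `isPath` this includes the leaf, so that inductions can run through the only child down
  -- to the empty tree.
  data Linear : Tree → Set where
    leaf  : Linear leaf
    left  : ∀ {l} → Linear l → Linear (node l leaf)
    right : ∀ {r} → Linear r → Linear (node leaf r)

  linear⇒isPath : ∀ {t} → Linear t → 0 < size t → isPath t ≡ 1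
  linear⇒isPath (left leaf)                    _ = refl
  linear⇒isPath (left {node _ _} lin)          _ = trans (*-identityʳ _) (linear⇒isPath lin (s≤s z≤n))
  linear⇒isPath (right leaf)                   _ = refl
  linear⇒isPath (right {node _ _} lin)         _ =
    trans (+-identityʳ _) (trans (+-identityʳ _) (linear⇒isPath lin (s≤s z≤n)))

  isPath⇒linear : ∀ t → 0 < isPath t → Linear t
  isPath⇒linear (node leaf leaf)                   _ = left leaf
  isPath⇒linear (node leaf r@(node _ _))           p =
    right (isPath⇒linear r (subst (0 <_) (trans (+-identityʳ _) (+-identityʳ _)) p))
  isPath⇒linear (node l@(node _ _) leaf)           p =
    left (isPath⇒linear l (subst (0 <_) (*-identityʳ _) p))
  isPath⇒linear (node l@(node _ _) (node _ _))     p =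
    contradiction (subst (0 <_) (*-zeroʳ (isPath l)) p) λ ()

  -- The root is the least entry and comes first or last in the word. In first place it could only
  -- be the 2 of an occurrence, in last place only the 3, so the occurrence lies in the child.
  linear⇒avoids-213 : ∀ a {t} → Linear t → Avoids p213 (perm a t)
  linear⇒avoids-213 a lin cont with _ , _ , _ , τ⊆ , x<y , y<w ← contains-213⁻ cont = go a lin τ⊆ x<y y<w
    where
    go : ∀ a {t} → Linear t → ∀ {y x w} → y ∷ x ∷ w ∷ [] ⊆ perm a t → x < y → y < w → ⊥
    go a (right {r} lin) (_ ∷ʳ q)   x<y y<w = go (suc a + 0) lin q x<y y<w
    go a (right {r} lin) (refl ∷ q) x<y y<w =
      <-asym x<y (right>a {a} {leaf} {r} (Sublist.lookup q (here refl)))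
    go a (left {l} lin) τ⊆ x<y y<w with ⊆-++⁻ (perm (suc a) l) τ⊆
    ... | [] , _ , refl , _ , _ ∷ʳ ()
    ... | [] , _ , refl , _ , refl ∷ ()
    ... | _ ∷ [] , _ , refl , _ , _ ∷ʳ ()
    ... | _ ∷ [] , _ , refl , _ , refl ∷ ()
    ... | _ ∷ _ ∷ [] , _ , refl , p , refl ∷ _ =
      <-asym y<w (proj₁ (left< {a} {l} {leaf} (Sublist.lookup p (here refl))))
    ... | _ ∷ _ ∷ _ ∷ [] , _ , refl , p , _ = go (suc a) lin p x<y y<w

  root∈ : ∀ a l r → a ∈ perm a (node l r)
  root∈ a l r = ∈-++⁺ʳ (perm (suc a) l) (here refl)

  -- At a node with two children, the root of the left child, the node and the root of the right
  -- child form a 213.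
  avoids-213⇒linear : ∀ a t → Avoids p213 (perm a t) → Linear t
  avoids-213⇒linear a leaf _ = leaf
  avoids-213⇒linear a (node leaf r) avoids = right (avoids-213⇒linear (suc a + 0) r
    λ (τ , τ⊆ , iso) → avoids (τ , _ ∷ʳ τ⊆ , iso))
  avoids-213⇒linear a (node l leaf) avoids = left (avoids-213⇒linear (suc a) l
    λ (τ , τ⊆ , iso) → avoids (τ , Sublist.++⁺ʳ _ τ⊆ , iso))
  avoids-213⇒linear a (node l@(node l₁ l₂) r@(node r₁ r₂)) avoids = contradiction
    (contains-213⁺ (Sublist.++⁺ (from∈ (root∈ (suc a) l₁ l₂)) (refl ∷ from∈ (root∈ (suc a + size l) r₁ r₂)))
      ≤-refl (m<m+n (suc a) (s≤s z≤n)))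
    avoids

-- Sub-permutations are the permutations of the fringe subtrees.

module Subpermutations where

  open import Data.List.Base using (List; []; _∷_; _++_; map; length; filter; inits; tails)
  open import Data.List.Properties using (length-++; length-++-≤ˡ; length-++-≤ʳ; ++-assoc; filter-++; filter-accept; filter-reject; map-++; map-cong-local; ∷-injectiveˡ; ∷-injectiveʳ; ++-identityʳ)
  open import Data.List.Extrema.Nat using (argmax-sel; f[xs]≤f[argmax]; xs≤max)
  open import Data.List.Membership.Propositional using (_∈_; _∉_; find; lose)
  open import Data.List.Membership.Propositional.Properties
  open import Data.List.Relation.Unary.All as All using (All; []; _∷_)
  open import Data.List.Relation.Unary.Any using (here; there)
  open import Data.Nat.Base
  open import Data.Nat.Properties
  open import Data.Product.Base using (_,_; _×_; proj₁; proj₂; ∃-syntax)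
  open import Data.Sum.Base using (_⊎_; inj₁; inj₂)
  open import Function.Base using (_∘_)
  open import Relation.Binary.PropositionalEquality
  open import Relation.Nullary.Decidable using (yes; no; _×-dec_)
  open import Relation.Nullary.Negation using (contradiction)
  open import Data.List.Membership.DecPropositional _≟_ using (_∈?_)

  open Trees
  open Moments
  open TreePermutations

  module _ {A : Set} where

    Infix : List A → List A → Set
    Infix u xs = ∃[ p ] ∃[ q ] p ++ u ++ q ≡ xs

    infix-refl : ∀ {xs} → Infix xs xs
    infix-refl {xs} = [] , [] , ++-identityʳ xs

    infix-∷ : ∀ {u xs x} → Infix u xs → Infix u (x ∷ xs)
    infix-∷ (p , q , eq) = _ ∷ p , q , cong (_ ∷_) eq

    infix-++ʳ : ∀ {u xs} ys → Infix u xs → Infix u (xs ++ ys)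
    infix-++ʳ {u} ys (p , q , refl) = p , q ++ ys ,
      sym (trans (++-assoc p (u ++ q) ys) (cong (p ++_) (++-assoc u q ys)))

    infix-++ˡ : ∀ {u xs} ys → Infix u xs → Infix u (ys ++ xs)
    infix-++ˡ []       i = i
    infix-++ˡ (y ∷ ys) i = infix-∷ (infix-++ˡ ys i)

    infix-∈ : ∀ {u xs x} → Infix u xs → x ∈ u → x ∈ xs
    infix-∈ (p , q , refl) x∈u = ∈-++⁺ʳ p (∈-++⁺ˡ x∈u)

    infix-long : ∀ {u xs} → Infix u xs → length xs ≤ length u → u ≡ xs
    infix-long {u} ([] , [] , refl) _ = sym (++-identityʳ u)
    infix-long {u} ([] , x ∷ q , refl) len =
      contradiction (≤-trans (≤-reflexive (sym (length-++ u))) len) (<⇒≱ (m<m+n (length u) (s≤s z≤n)))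
    infix-long {u} (x ∷ p , q , refl) len =
      contradiction len (<⇒≱ (s≤s (≤-trans (length-++-≤ˡ u) (length-++-≤ʳ (u ++ q) {p}))))

    prefix-before : ∀ {a : A} (u : List A) {q : List A} (us : List A) {vs : List A} → a ∉ u → u ++ q ≡ us ++ a ∷ vs → ∃[ q′ ] u ++ q′ ≡ us
    prefix-before []      us       _  _  = us , refl
    prefix-before (x ∷ u) []       a∉ eq = contradiction (here (sym (∷-injectiveˡ eq))) a∉
    prefix-before (x ∷ u) (y ∷ us) a∉ eq
      with refl ← ∷-injectiveˡ eq
      with q′ , refl ← prefix-before u us (a∉ ∘ there) (∷-injectiveʳ eq) = q′ , refl

    infix-around : ∀ {a : A} (u us : List A) {vs : List A} → a ∉ u → Infix u (us ++ a ∷ vs) → Infix u us ⊎ Infix u vs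
    infix-around u us a∉ ([] , q , eq) with q′ , eq′ ← prefix-before u us a∉ eq = inj₁ ([] , q′ , eq′)
    infix-around u []       a∉ (_ ∷ p , q , eq) = inj₂ (p , q , ∷-injectiveʳ eq)
    infix-around u (y ∷ us) a∉ (_ ∷ p , q , eq) with infix-around u us a∉ (p , q , ∷-injectiveʳ eq)
    ... | inj₁ i = inj₁ (infix-∷ i)
    ... | inj₂ i = inj₂ i

  ∈-tails⁺ : ∀ p {xs : List ℕ} → xs ∈ tails (p ++ xs)
  ∈-tails⁺ []      = here refl
  ∈-tails⁺ (x ∷ p) = there (∈-tails⁺ p)

  ∈-tails⁻ : ∀ {u} (xs : List ℕ) → u ∈ tails xs → ∃[ p ] p ++ u ≡ xs
  ∈-tails⁻ []       (here refl) = [] , refl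
  ∈-tails⁻ (x ∷ xs) (here refl) = [] , refl
  ∈-tails⁻ (x ∷ xs) (there u∈) with p , refl ← ∈-tails⁻ xs u∈ = x ∷ p , refl

  ∈-inits⁺ : ∀ u {q : List ℕ} → u ∈ inits (u ++ q)
  ∈-inits⁺ []      = here refl
  ∈-inits⁺ (x ∷ u) = there (∈-map⁺ (x ∷_) (∈-inits⁺ u))

  ∈-inits⁻ : ∀ {u} (xs : List ℕ) → u ∈ inits xs → ∃[ q ] u ++ q ≡ xs
  ∈-inits⁻ xs       (here refl) = xs , refl
  ∈-inits⁻ (x ∷ xs) (there u∈)
    with _ , u∈′ , refl ← ∈-map⁻ (x ∷_) u∈
    with q , refl ← ∈-inits⁻ xs u∈′ = q , refl

  ∈-substrings⁺ : ∀ {u xs} → Infix u xs → u ∈ substrings xs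
  ∈-substrings⁺ {u} (p , q , refl) = ∈-concatMap⁺ inits (lose (∈-tails⁺ p) (∈-inits⁺ u))

  ∈-substrings⁻ : ∀ {u} xs → u ∈ substrings xs → Infix u xs
  ∈-substrings⁻ xs u∈
    with ys , ys∈ , u∈′ ← find (∈-concatMap⁻ inits {xs = tails xs} u∈)
    with p , refl ← ∈-tails⁻ xs ys∈
    with q , refl ← ∈-inits⁻ ys u∈′ = p , q , refl

  ∈-subtrees-perm : ∀ a t {x t′} → (x , t′) ∈ subtrees a t → x ∈ perm a t
  ∈-subtrees-perm a (node l r) st with ∈-++⁻ (subtrees (suc a) l) st
  ... | inj₁ st′         = ∈-++⁺ˡ (∈-subtrees-perm (suc a) l st′)
  ... | inj₂ (here refl) = root∈ a l r
  ... | inj₂ (there st′) = ∈-++⁺ʳ (perm (suc a) l) (there (∈-subtrees-perm (suc a + size l) r st′))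

  ∈-perm-subtrees : ∀ a t {x} → x ∈ perm a t → ∃[ t′ ] (x , t′) ∈ subtrees a t
  ∈-perm-subtrees a (node l r) x∈ with ∈-++⁻ (perm (suc a) l) x∈
  ... | inj₁ x∈l with t′ , st ← ∈-perm-subtrees (suc a) l x∈l = t′ , ∈-++⁺ˡ st
  ... | inj₂ (here refl) = node l r , ∈-++⁺ʳ (subtrees (suc a) l) (here refl)
  ... | inj₂ (there x∈r) with t′ , st ← ∈-perm-subtrees (suc a + size l) r x∈r =
    t′ , ∈-++⁺ʳ (subtrees (suc a) l) (there st)

  subtree-root : ∀ a t {x t′} → (x , t′) ∈ subtrees a t → x ∈ perm x t′
  subtree-root a (node l r) st with ∈-++⁻ (subtrees (suc a) l) st
  ... | inj₁ st′         = subtree-root (suc a) l st′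
  ... | inj₂ (here refl) = root∈ a l r
  ... | inj₂ (there st′) = subtree-root (suc a + size l) r st′

  subtree-infix : ∀ a t {x t′} → (x , t′) ∈ subtrees a t → Infix (perm x t′) (perm a t)
  subtree-infix a (node l r) st with ∈-++⁻ (subtrees (suc a) l) st
  ... | inj₁ st′         = infix-++ʳ _ (subtree-infix (suc a) l st′)
  ... | inj₂ (here refl) = infix-refl
  ... | inj₂ (there st′) = infix-++ˡ (perm (suc a) l) (infix-∷ (subtree-infix (suc a + size l) r st′))

  -- At each proper ancestor of x the value a is below x, so a block with entries ≥ x misses a and
  -- stays on one side of it. As it contains x, that is the side of x, and the descent continues
  -- there.
  subtree-largest : ∀ a t {x t′ u} → (x , t′) ∈ subtrees a t →
                    Infix u (perm a t) → x ∈ u → All (x ≤_) u → Infix u (perm x t′)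
  subtree-largest a (node l r) {x} {u = u} st i x∈u x≤u with ∈-++⁻ (subtrees (suc a) l) st
  ... | inj₂ (here refl) = i
  ... | inj₁ st′ with infix-around u (perm (suc a) l) (<⇒≱ a<x ∘ All.lookup x≤u) i
    where
    a<x : a < x
    a<x = proj₁ (left< {a} {l} {r} (∈-subtrees-perm (suc a) l st′))
  ...   | inj₁ i′ = subtree-largest (suc a) l st′ i′ x∈u x≤u
  ...   | inj₂ i′ = contradiction (right> {a} {l} {r} (infix-∈ i′ x∈u))
                      (<⇒≱ (proj₂ (left< {a} {l} {r} (∈-subtrees-perm (suc a) l st′))))
  subtree-largest a (node l r) {x} {u = u} st i x∈u x≤u
      | inj₂ (there st′) with infix-around u (perm (suc a) l) (<⇒≱ a<x ∘ All.lookup x≤u) i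
    where
    a<x : a < x
    a<x = right>a {a} {l} {r} (∈-subtrees-perm (suc a + size l) r st′)
  ...   | inj₁ i′ = contradiction (right> {a} {l} {r} (∈-subtrees-perm (suc a + size l) r st′))
                      (<⇒≱ (proj₂ (left< {a} {l} {r} (infix-∈ i′ x∈u))))
  ...   | inj₂ i′ = subtree-largest (suc a + size l) r st′ i′ x∈u x≤u

  -- The block of the subtree is a candidate, so `argmax` returns something at least as long. Every
  -- candidate is an infix of that block, and an infix that is not shorter is the whole; ties
  -- therefore cannot spoil the result.
  s-perm : ∀ a t {x t′} → (x , t′) ∈ subtrees a t → s (perm a t) x ≡ perm x t′
  s-perm a t {x} {t′} st = case-sel (argmax-sel length [] candidates)
    where
    candidate? = λ u → (x ∈? u) ×-dec All.all? (x ≤?_) u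
    candidates = filter candidate? (substrings (perm a t))
    canonical∈ : perm x t′ ∈ candidates
    canonical∈ = ∈-filter⁺ candidate? (∈-substrings⁺ (subtree-infix a t st))
      (subtree-root a t st , All.tabulate (proj₁ ∘ perm-bounds x t′))
    longest : length (perm x t′) ≤ length (s (perm a t) x)
    longest = All.lookup (f[xs]≤f[argmax] {f = length} [] candidates) canonical∈
    case-sel : s (perm a t) x ≡ [] ⊎ s (perm a t) x ∈ candidates → s (perm a t) x ≡ perm x t′
    case-sel (inj₁ ≡[]) = contradiction (≤-trans (∈-length (subtree-root a t st)) (subst (λ u → length (perm x t′) ≤ length u) ≡[] longest)) λ ()
    case-sel (inj₂ u∈) with u∈substrings , x∈u , x≤u ← ∈-filter⁻ candidate? {xs = substrings (perm a t)} u∈ =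
      infix-long (subtree-largest a t st (∈-substrings⁻ (perm a t) u∈substrings) x∈u x≤u) longest

  ⊓-∸-+ : ∀ e l r → e ⊓ l + (e ∸ l) ⊓ r ≡ e ⊓ (l + r)
  ⊓-∸-+ e       zero    r = cong (_+ e ⊓ r) (⊓-zeroʳ e)
  ⊓-∸-+ zero    (suc l) r = refl
  ⊓-∸-+ (suc e) (suc l) r = cong suc (⊓-∸-+ e l r)

  -- The entries fill the interval from a to a + size t - 1. Truncated subtraction covers y below
  -- it, the minimum covers y above it.
  count-≤ : ∀ y a t → length (filter (_≤? y) (perm a t)) ≡ (suc y ∸ a) ⊓ size t
  count-≤ y a leaf       = sym (⊓-zeroʳ (suc y ∸ a))
  count-≤ y a (node l r) = begin
    length (filter (_≤? y) (L ++ a ∷ R))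
      ≡⟨ cong length (filter-++ (_≤? y) L (a ∷ R)) ⟩
    length (filter (_≤? y) L ++ filter (_≤? y) (a ∷ R))
      ≡⟨ length-++ (filter (_≤? y) L) ⟩
    length (filter (_≤? y) L) + length (filter (_≤? y) (a ∷ R))
      ≡⟨ cong (_+ length (filter (_≤? y) (a ∷ R))) (count-≤ y (suc a) l) ⟩
    (y ∸ a) ⊓ size l + length (filter (_≤? y) (a ∷ R))
      ≡⟨ root ⟩
    (suc y ∸ a) ⊓ suc (size l + size r) ∎
    where
    open ≡-Reasoning
    L = perm (suc a) l
    R = perm (suc a + size l) r
    root : (y ∸ a) ⊓ size l + length (filter (_≤? y) (a ∷ R)) ≡ (suc y ∸ a) ⊓ suc (size l + size r)
    root with a ≤? y
    ... | yes a≤y = begin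
      (y ∸ a) ⊓ size l + length (filter (_≤? y) (a ∷ R))
        ≡⟨ cong (λ xs → (y ∸ a) ⊓ size l + length xs) (filter-accept (_≤? y) {xs = R} a≤y) ⟩
      (y ∸ a) ⊓ size l + suc (length (filter (_≤? y) R))
        ≡⟨ +-suc _ _ ⟩
      suc ((y ∸ a) ⊓ size l + length (filter (_≤? y) R))
        ≡⟨ cong (λ c → suc ((y ∸ a) ⊓ size l + c)) (trans (count-≤ y (suc a + size l) r) (cong (_⊓ size r) (sym (∸-+-assoc y a (size l))))) ⟩
      suc ((y ∸ a) ⊓ size l + (y ∸ a ∸ size l) ⊓ size r)
        ≡⟨ cong suc (⊓-∸-+ (y ∸ a) (size l) (size r)) ⟩
      suc (y ∸ a) ⊓ suc (size l + size r)
        ≡⟨ cong (_⊓ suc (size l + size r)) (+-∸-assoc 1 a≤y) ⟨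
      (suc y ∸ a) ⊓ suc (size l + size r) ∎
    ... | no a≰y rewrite m≤n⇒m∸n≡0 (≰⇒> a≰y) | m≤n⇒m∸n≡0 (<⇒≤ (≰⇒> a≰y)) = begin
      length (filter (_≤? y) (a ∷ R))            ≡⟨ cong length (filter-reject (_≤? y) {xs = R} a≰y) ⟩
      length (filter (_≤? y) R)                  ≡⟨ count-≤ y (suc a + size l) r ⟩
      (y ∸ (a + size l)) ⊓ size r                ≡⟨ cong (_⊓ size r) (m≤n⇒m∸n≡0 (≤-trans (<⇒≤ (≰⇒> a≰y)) (m≤m+n a (size l)))) ⟩
      0                                          ∎

  -- The offset `d` grows along the recursion while the subtracted `a` stays fixed; rescaling is the
  -- case d = 0.
  map-shift-perm : ∀ a d t → map (λ y → suc y ∸ a) (perm (a + d) t) ≡ perm (suc d) t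
  map-shift-perm a d leaf       = refl
  map-shift-perm a d (node l r) = begin
    map f (perm (suc (a + d)) l ++ (a + d) ∷ perm (suc (a + d) + size l) r)
      ≡⟨ map-++ f (perm (suc (a + d)) l) _ ⟩
    map f (perm (suc (a + d)) l) ++ f (a + d) ∷ map f (perm (suc (a + d) + size l) r)
      ≡⟨ cong₂ _++_ (shifted (suc d) l (+-suc a d)) (cong₂ _∷_ (trans (cong (_∸ a) (sym (+-suc a d))) (m+n∸m≡n a (suc d)))
           (shifted (suc d + size l) r (trans (sym (+-assoc a (suc d) (size l))) (cong (_+ size l) (+-suc a d))))) ⟩
    perm (suc (suc d)) l ++ suc d ∷ perm (suc (suc d) + size l) r ∎
    where
    open ≡-Reasoning
    f = λ y → suc y ∸ a
    shifted : ∀ {b} d t → a + d ≡ b → map f (perm b t) ≡ perm (suc d) t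
    shifted d t refl = map-shift-perm a d t

  rescale-perm : ∀ a t → rescale (perm a t) ≡ perm 1 t
  rescale-perm a t = begin
    map (λ y → length (filter (_≤? y) (perm a t))) (perm a t)
      ≡⟨ map-cong-local (All.tabulate (λ {y} y∈ → trans (count-≤ y a t) (m≤n⇒m⊓n≡m
           (m≤n+o⇒m∸n≤o (suc y) a (proj₂ (perm-bounds a t y∈)))))) ⟩
    map (λ y → suc y ∸ a) (perm a t)
      ≡⟨ cong (λ b → map (λ y → suc y ∸ a) (perm b t)) (+-identityʳ a) ⟨
    map (λ y → suc y ∸ a) (perm (a + 0) t)
      ≡⟨ map-shift-perm a 0 t ⟩
    perm 1 t ∎
    where open ≡-Reasoning

  g-perm : ∀ a t {x t′} → (x , t′) ∈ subtrees a t → g (perm a t) x ≡ perm 1 t′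
  g-perm a t {x} {t′} st = trans (cong rescale (s-perm a t st)) (rescale-perm x t′)

  isPathOfSize⇒ : ∀ k t → 0 < isPathOfSize k t → size t ≡ k × Linear t
  isPathOfSize⇒ k t p with size t ≟ k
  ... | no ≢k    = contradiction (subst (0 <_) (isPathOfSize-≢ k t ≢k) p) λ ()
  ... | yes refl = refl , isPath⇒linear t (subst (0 <_) (trans (cong (_* isPath t) (z^-diagonal k)) (*-identityˡ (isPath t))) p)

  positive-summand : ∀ {m n} → 0 < m + n → 0 < m ⊎ 0 < n
  positive-summand {zero}  p = inj₂ p
  positive-summand {suc m} _ = inj₁ (s≤s z≤n)

  paths⇒subtree : ∀ k a t → 0 < paths k t → ∃[ x ] ∃[ t′ ] ((x , t′) ∈ subtrees a t × size t′ ≡ k × Linear t′)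
  paths⇒subtree k a (node l r) p with positive-summand {isPathOfSize k (node l r)} p
  ... | inj₁ q = a , node l r , ∈-++⁺ʳ (subtrees (suc a) l) (here refl) , isPathOfSize⇒ k (node l r) q
  ... | inj₂ q with positive-summand {paths k l} q
  ...   | inj₁ q′ with x , t′ , st , p′ ← paths⇒subtree k (suc a) l q′ = x , t′ , ∈-++⁺ˡ st , p′
  ...   | inj₂ q′ with x , t′ , st , p′ ← paths⇒subtree k (suc a + size l) r q′ =
    x , t′ , ∈-++⁺ʳ (subtrees (suc a) l) (there st) , p′

  paths-subtree : ∀ k a t {x t′} → (x , t′) ∈ subtrees a t → paths k t′ ≤ paths k t
  paths-subtree k a (node l r) st with ∈-++⁻ (subtrees (suc a) l) st
  ... | inj₂ (here refl) = ≤-refl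
  ... | inj₁ st′         = ≤-trans (paths-subtree k (suc a) l st′)
    (≤-trans (m≤m+n (paths k l) (paths k r)) (m≤n+m _ (isPathOfSize k (node l r))))
  ... | inj₂ (there st′) = ≤-trans (paths-subtree k (suc a + size l) r st′)
    (≤-trans (m≤n+m (paths k r) (paths k l)) (m≤n+m _ (isPathOfSize k (node l r))))

  -- Going down a path loses one node at a time, so every size from 1 to `size t` is met.
  linear⇒paths : ∀ k {t} → Linear t → 0 < k → k ≤ size t → 0 < paths k t
  linear⇒paths k {t} lin 0<k k≤ with k ≟ size t
  -- With k = 0 the goal is the absurd hypothesis itself.
  linear⇒paths k {leaf} lin 0<k k≤ | yes refl = 0<k
  linear⇒paths k {t@(node _ _)} lin 0<k k≤ | yes refl =
    ≤-trans (≤-reflexive (sym (cong₂ _*_ (z^-diagonal k) (linear⇒isPath lin 0<k)))) (m≤m+n _ _)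
  linear⇒paths k leaf 0<k k≤ | no k≢ = contradiction (n≤0⇒n≡0 k≤) k≢
  linear⇒paths k (left {l} lin) 0<k k≤ | no k≢ =
    ≤-trans (linear⇒paths k lin 0<k (≤-trans (≤-pred (≤∧≢⇒< k≤ k≢)) (≤-reflexive (+-identityʳ (size l)))))
      (≤-trans (m≤m+n (paths k l) 0) (m≤n+m _ (isPathOfSize k (node l leaf))))
  linear⇒paths k (right {r} lin) 0<k k≤ | no k≢ =
    ≤-trans (linear⇒paths k lin 0<k (≤-pred (≤∧≢⇒< k≤ k≢)))
      (m≤n+m _ (isPathOfSize k (node leaf r)))

  paths⇒≤γ : ∀ k t → 0 < paths k t → k ≤ γ (perm 1 t)
  paths⇒≤γ k t p with x , t′ , st , refl , lin ← paths⇒subtree k 1 t p =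
    All.lookup (xs≤max 0 (map length (filter (avoids? p213) (subpermutations (perm 1 t)))))
      (subst (_∈ _) (length-perm 1 t′) (∈-map⁺ length (∈-filter⁺ (avoids? p213)
        (subst (_∈ _) (g-perm 1 t st) (∈-map⁺ (g (perm 1 t)) (∈-subtrees-perm 1 t st)))
        (linear⇒avoids-213 1 lin))))

  -- The maximum in γ is attained at some entry, as 0 < k rules out the default 0. The subtree of
  -- that entry is linear of size at least k and so contains a path of size k.
  ≤γ⇒paths : ∀ k t → 0 < k → k ≤ γ (perm 1 t) → 0 < paths k t
  ≤γ⇒paths k t 0<k k≤γ with argmax-sel (λ m → m) 0 (map length (filter (avoids? p213) (subpermutations (perm 1 t))))
  ... | inj₁ γ≡0 = contradiction (≤-trans k≤γ (≤-reflexive γ≡0)) (<⇒≱ 0<k)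
  ... | inj₂ γ∈
    with u , u∈ , γ≡ ← ∈-map⁻ length γ∈
    with u∈g , avoids ← ∈-filter⁻ (avoids? p213) {xs = subpermutations (perm 1 t)} u∈
    with x , x∈ , refl ← ∈-map⁻ (g (perm 1 t)) u∈g
    with t′ , st ← ∈-perm-subtrees 1 t x∈
    rewrite g-perm 1 t st | length-perm 1 t′ =
    ≤-trans (linear⇒paths k (avoids-213⇒linear 1 t′ avoids) 0<k (≤-trans k≤γ (≤-reflexive γ≡)))
      (paths-subtree k 1 t st)

-- The bijection between trees of size n and Av_n(312).

module Enumeration where

  open import Data.List.Base using (List; []; _∷_; _++_; map; length; applyUpTo)
  open import Data.List.Properties using (length-++; length-map; length-applyUpTo; length-++-sucʳ; map-∘; ∷-injective)
  open import Data.List.Membership.Propositional using (_∈_)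
  open import Data.List.Membership.Propositional.Properties
  open import Data.List.Membership.Propositional.Properties.WithK using (unique∧set⇒bag)
  open import Data.List.Relation.Binary.BagAndSetEquality using (∼bag⇒↭)
  open import Data.List.Relation.Binary.Permutation.Propositional using (_↭_)
  open import Data.List.Relation.Binary.Permutation.Propositional.Properties using (map⁺; ↭-length)
  open import Data.List.Relation.Binary.Sublist.Propositional as Sublist using (_⊆_; []; _∷_; _∷ʳ_; from∈)
  open import Data.List.Relation.Binary.Sublist.Propositional.Properties as Sublist using ()
  open import Data.List.Relation.Unary.All as All using (All; []; _∷_)
  open import Data.List.Relation.Unary.All.Properties as All using ()
  open import Data.List.Relation.Unary.AllPairs using ([]; _∷_)
  open import Data.List.Relation.Unary.Any using (here; there)
  open import Data.List.Relation.Unary.Unique.Propositional using (Unique)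
  open import Data.List.Relation.Unary.Unique.Propositional.Properties as Unique using ()
  open import Data.Nat.Base
  open import Data.Nat.ListAction using (sum)
  open import Data.Nat.ListAction.Properties using (sum-↭)
  open import Data.Nat.Properties
  open import Data.Product.Base using (_,_; _×_; proj₁; proj₂; ∃-syntax)
  open import Data.Sum.Base using (inj₁; inj₂)
  open import Function.Base using (_∘_)
  open import Function.Bundles using (mk⇔)
  open import Relation.Binary.Definitions using (tri<; tri≈; tri>)
  open import Relation.Binary.PropositionalEquality
  open import Relation.Nullary.Decidable using (yes; no)
  open import Relation.Nullary.Negation using (contradiction)
  open import Data.List.Membership.DecPropositional _≟_ using (_∈?_)
  open import Data.List.Relation.Unary.Unique.DecPropositional _≟_ using (unique?)

  open Trees
  open TreePermutations

  module _ {A : Set} where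

    unique-length-≤ : ∀ {xs ys : List A} → Unique xs → (∀ {x} → x ∈ xs → x ∈ ys) → length xs ≤ length ys
    unique-length-≤ []                 _   = z≤n
    unique-length-≤ {x ∷ xs} (x∉ ∷ xs!) xs⊆ with us , vs , refl ← ∈-∃++ (xs⊆ (here refl)) =
      ≤-trans (s≤s (unique-length-≤ xs! rest)) (≤-reflexive (sym (length-++-sucʳ us x vs)))
      where
      rest : ∀ {y} → y ∈ xs → y ∈ us ++ vs
      rest y∈ with ∈-++⁻ us (xs⊆ (there y∈))
      ... | inj₁ y∈us         = ∈-++⁺ˡ y∈us
      ... | inj₂ (here refl)  = contradiction refl (All.lookup x∉ y∈)
      ... | inj₂ (there y∈vs) = ∈-++⁺ʳ us y∈vs

    unique-++⁻ : ∀ (xs : List A) {ys} → Unique (xs ++ ys) →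
                 Unique xs × Unique ys × (∀ {x y} → x ∈ xs → y ∈ ys → x ≢ y)
    unique-++⁻ []       u        = [] , u , λ ()
    unique-++⁻ (x ∷ xs) (x∉ ∷ u) with xs! , ys! , # ← unique-++⁻ xs u =
      All.++⁻ˡ xs x∉ ∷ xs! , ys! , λ
        { (here refl) y∈ → All.lookup (All.++⁻ʳ xs x∉) y∈
        ; (there x∈)  y∈ → # x∈ y∈ }

  interval-length : ∀ a k {xs} → Unique xs → (∀ {x} → x ∈ xs → a ≤ x × x < a + k) → length xs ≤ k
  interval-length a k u bounds = ≤-trans (unique-length-≤ u inside) (≤-reflexive (length-applyUpTo (a +_) k))
    where
    inside : ∀ {x} → x ∈ _ → x ∈ applyUpTo (a +_) k
    inside x∈ with a≤x , x<b ← bounds x∈ with d , refl ← m≤n⇒∃[o]m+o≡n a≤x =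
      ∈-applyUpTo⁺ (a +_) (+-cancelˡ-< a _ _ x<b)

  -- The least value `a` must occur. Avoiding 312 puts everything left of it below everything right
  -- of it, and counting then forces both sides to fill consecutive intervals. The two sides are not
  -- structurally smaller, so `m` bounds the recursion.
  perm-surjective : ∀ m a xs → length xs ≤ m → Unique xs → (∀ {x} → x ∈ xs → a ≤ x × x < a + length xs) →
                    Avoids p312 xs → ∃[ t ] perm a t ≡ xs
  perm-surjective _       a []         _     _ _      _      = leaf , refl
  perm-surjective (suc m) a xs@(_ ∷ xs′) len≤m u bounds avoids with a ∈? xs
  -- Without `a`, the distinct entries would fit into an interval with one element fewer.
  ... | no a∉ = contradiction (interval-length (suc a) (length xs′) u bounds′) (<⇒≱ (n<1+n _))
    where
    bounds′ : ∀ {x} → x ∈ xs → suc a ≤ x × x < suc a + length xs′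
    bounds′ x∈ with a≤x , x<b ← bounds x∈ =
      ≤∧≢⇒< a≤x (λ { refl → a∉ x∈ }) , ≤-trans x<b (≤-reflexive (+-suc a _))
  ... | yes a∈ with L , R , xs≡ ← ∈-∃++ a∈ = node l r , trans
      (cong₂ (λ us vs → us ++ a ∷ vs) perm-l (trans (cong (λ k → perm (suc a + k) r) size-l) perm-r)) (sym xs≡)
    where
    split : Unique L × Unique (a ∷ R) × (∀ {x y} → x ∈ L → y ∈ a ∷ R → x ≢ y)
    split = unique-++⁻ L (subst Unique xs≡ u)
    L! = proj₁ split
    # = proj₂ (proj₂ split)
    R! : Unique R
    R! with _ ∷ R! ← proj₁ (proj₂ split) = R!
    len : length xs ≡ suc (length L + length R)
    len = trans (cong length xs≡) (trans (length-++ L) (+-suc (length L) (length R)))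
    L⊆ : ∀ {x} → x ∈ L → x ∈ xs
    L⊆ x∈ = subst (_ ∈_) (sym xs≡) (∈-++⁺ˡ x∈)
    R⊆ : ∀ {x} → x ∈ R → x ∈ xs
    R⊆ x∈ = subst (_ ∈_) (sym xs≡) (∈-++⁺ʳ L (there x∈))
    sublist : ∀ {us} → us ⊆ L ++ a ∷ R → us ⊆ xs
    sublist = subst (_ ⊆_) (sym xs≡)
    a<L : ∀ {x} → x ∈ L → a < x
    a<L x∈ = ≤∧≢⇒< (proj₁ (bounds (L⊆ x∈))) (# x∈ (here refl) ∘ sym)
    a<R : ∀ {y} → y ∈ R → a < y
    a<R y∈ with a∉R ∷ _ ← proj₁ (proj₂ split) = ≤∧≢⇒< (proj₁ (bounds (R⊆ y∈))) (All.lookup a∉R y∈)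
    L<R : ∀ {x y} → x ∈ L → y ∈ R → x < y
    L<R {x} {y} x∈ y∈ with <-cmp x y
    ... | tri< x<y _ _ = x<y
    ... | tri≈ _ x≡y _ = contradiction x≡y (# x∈ (there y∈))
    ... | tri> _ _ y<x = contradiction
      (contains-312⁺ (sublist (Sublist.++⁺ (from∈ x∈) (refl ∷ from∈ y∈))) (a<R y∈) y<x) avoids
    top : ∀ {x} → x ∈ xs → x < suc a + (length L + length R)
    top x∈ = ≤-trans (proj₂ (bounds x∈)) (≤-reflexive (trans (cong (a +_) len) (+-suc a _)))
    -- All of R lies above x and below T, so R has at most T - (x + 1) entries; this bounds x from
    -- above.
    L-bounds : ∀ {x} → x ∈ L → suc a ≤ x × x < suc a + length L
    L-bounds {x} x∈ = a<L x∈ , +-cancelʳ-≤ (length R) (suc x) (suc a + length L) (begin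
      suc x + length R               ≤⟨ +-monoʳ-≤ (suc x) (interval-length (suc x) (T ∸ suc x) R!
                                          (λ y∈ → L<R x∈ y∈ , <-≤-trans (top (R⊆ y∈)) (≤-reflexive (sym T≡)))) ⟩
      suc x + (T ∸ suc x)            ≡⟨ T≡ ⟩
      T                              ≡⟨ +-assoc (suc a) (length L) (length R) ⟨
      suc a + length L + length R    ∎)
      where
      open ≤-Reasoning
      T = suc a + (length L + length R)
      T≡ : suc x + (T ∸ suc x) ≡ T
      T≡ = m+[n∸m]≡n (top (L⊆ x∈))
    -- Dually, all of L lies strictly between a and y, which bounds y from below.
    R-bounds : ∀ {y} → y ∈ R → suc a + length L ≤ y × y < suc a + length L + length R
    R-bounds {y} y∈ = lower , ≤-trans (top (R⊆ y∈)) (≤-reflexive (sym (+-assoc (suc a) (length L) (length R))))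
      where
      d = y ∸ suc a
      y≡ : suc a + d ≡ y
      y≡ = m+[n∸m]≡n (a<R y∈)
      lower : suc a + length L ≤ y
      lower = ≤-trans (+-monoʳ-≤ (suc a) (interval-length (suc a) d L!
        (λ x∈ → a<L x∈ , <-≤-trans (L<R x∈ y∈) (≤-reflexive (sym y≡))))) (≤-reflexive y≡)
    len≤ : length L + length R ≤ m
    len≤ = ≤-pred (≤-trans (≤-reflexive (sym len)) len≤m)
    left-tree : ∃[ t ] perm (suc a) t ≡ L
    left-tree = perm-surjective m (suc a) L (≤-trans (m≤m+n (length L) (length R)) len≤) L! L-bounds
      λ (τ , τ⊆ , iso) → avoids (τ , sublist (Sublist.++⁺ʳ _ τ⊆) , iso)
    right-tree : ∃[ t ] perm (suc a + length L) t ≡ R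
    right-tree = perm-surjective m (suc a + length L) R (≤-trans (m≤n+m (length R) (length L)) len≤) R! R-bounds
      λ (τ , τ⊆ , iso) → avoids (τ , sublist (Sublist.++⁺ˡ L (_ ∷ʳ τ⊆)) , iso)
    l = proj₁ left-tree
    r = proj₁ right-tree
    perm-l = proj₂ left-tree
    perm-r = proj₂ right-tree
    size-l : size l ≡ length L
    size-l = trans (sym (length-perm (suc a) l)) (cong length perm-l)

  ∈-words⁺ : ∀ {as} w → All (_∈ as) w → w ∈ words (length w) as
  ∈-words⁺ []      []        = here refl
  ∈-words⁺ (x ∷ w) (x∈ ∷ w∈) = ∈-cartesianProductWith⁺ _∷_ x∈ (∈-words⁺ w w∈)

  ∈-words⁻ : ∀ k as {w} → w ∈ words k as → length w ≡ k × All (_∈ as) w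
  ∈-words⁻ zero    as (here refl) = refl , []
  ∈-words⁻ (suc k) as w∈
    with x , w , x∈ , w∈′ , refl ← ∈-cartesianProductWith⁻ _∷_ as (words k as) w∈
    with len , all ← ∈-words⁻ k as w∈′ = cong suc len , x∈ ∷ all

  words-unique : ∀ k {as} → Unique as → Unique (words k as)
  words-unique zero    as! = [] ∷ []
  words-unique (suc k) as! = Unique.cartesianProductWith⁺ _∷_ ∷-injective as! (words-unique k as!)

  Av-unique : ∀ n → Unique (Av n p312)
  Av-unique n = Unique.filter⁺ (avoids? p312) (Unique.filter⁺ unique?
    (words-unique n (Unique.applyUpTo⁺₁ suc n (λ i<j _ → <⇒≢ (s≤s i<j)))))

  ∈-Av⁺ : ∀ t → perm 1 t ∈ Av (size t) p312
  ∈-Av⁺ t = ∈-filter⁺ (avoids? p312) (∈-filter⁺ unique? word (perm-unique 1 t)) (perm-avoids-312 1 t)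
    where
    letter : ∀ {x} → x ∈ perm 1 t → x ∈ [1⋯ size t ]
    letter x∈ with s≤s _ , s≤s x<n ← perm-bounds 1 t x∈ = ∈-applyUpTo⁺ suc x<n
    word : perm 1 t ∈ words (size t) [1⋯ size t ]
    word = subst (λ k → perm 1 t ∈ words k [1⋯ size t ]) (length-perm 1 t)
      (∈-words⁺ (perm 1 t) (All.tabulate letter))

  letter-bounds : ∀ {π} → All (_∈ [1⋯ length π ]) π → ∀ {x} → x ∈ π → 1 ≤ x × x < 1 + length π
  letter-bounds letters x∈ with i , i<n , refl ← ∈-applyUpTo⁻ suc (All.lookup letters x∈) = s≤s z≤n , s≤s i<n

  ∈-Av⁻ : ∀ n {π} → π ∈ Av n p312 → π ∈ map (perm 1) (trees n)
  ∈-Av⁻ n {π} π∈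
    with π∈permutations , avoids ← ∈-filter⁻ (avoids? p312) {xs = permutations n} π∈
    with π∈words , u ← ∈-filter⁻ unique? {xs = words n [1⋯ n ]} π∈permutations
    with refl , letters ← ∈-words⁻ n [1⋯ n ] π∈words
    with t , refl ← perm-surjective n 1 π ≤-refl u (letter-bounds letters) avoids =
    ∈-map⁺ (perm 1) (subst (λ k → t ∈ trees k) (sym (length-perm 1 t)) (∈-trees⁺ t))

  -- Both lists are free of repetitions and have the same elements, so they agree up to reordering,
  -- to which sums and lengths are blind.
  Av↭trees : ∀ n → Av n p312 ↭ map (perm 1) (trees n)
  Av↭trees n = ∼bag⇒↭ (unique∧set⇒bag (Av-unique n)
    (Unique.map⁺ (perm-injective 1 _ _) (trees-unique n))
    (mk⇔ (∈-Av⁻ n) from))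
    where
    from : ∀ {π} → π ∈ map (perm 1) (trees n) → π ∈ Av n p312
    from π∈ with t , t∈ , refl ← ∈-map⁻ (perm 1) π∈ = subst (λ k → perm 1 t ∈ Av k p312) (∈-trees⁻ n t∈) (∈-Av⁺ t)

  ∑γ-Av : ∀ n → sum (map γ (Av n p312)) ≡ ⟦ (λ t → γ (perm 1 t)) ⟧ n
  ∑γ-Av n = trans (sum-↭ (map⁺ γ (Av↭trees n))) (cong sum (sym (map-∘ (trees n))))

  length-Av : ∀ n → length (Av n p312) ≡ C n
  length-Av n = trans (↭-length (Av↭trees n)) (trans (length-map (perm 1) (trees n)) (sym (∑-1 (trees n))))

-- From the moment bounds to the limit of the quotient.

import Data.Integer.Base as ℤ
open import Data.Integer.Base using (+_; -[1+_])
import Data.Integer.Properties as ℤ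
open import Data.List.Base using (length; map)
open import Data.Nat.Base
open import Data.Nat.ListAction using (sum)
open import Data.Nat.Properties
open import Data.Nat.Tactic.RingSolver using (solve-∀)
open import Data.Product.Base using (_,_; _×_; ∃-syntax)
open import Data.Rational.Unnormalised.Base as ℚ using (ℚᵘ; mkℚᵘ; 0ℚᵘ; 1ℚᵘ; *<*; *≡*)
import Data.Rational.Unnormalised.Properties as ℚ
open import Relation.Binary.PropositionalEquality
open import Relation.Nullary.Decidable using (yes; no)
open import Relation.Nullary.Negation using (contradiction)

open Trees
open Moments
open TreePermutations
open Subpermutations
open Enumeration

open ≤-Reasoning

n<2^n : ∀ n → n < 2 ^ n
n<2^n zero    = s≤s z≤n
n<2^n (suc n) = begin-strict
  suc n        ≤⟨ n<2^n n ⟩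
  2 ^ n        <⟨ ^-monoʳ-< 2 ≤-refl (n<1+n n) ⟩
  2 ^ suc n    ∎

-- A downward search that cannot pass `b`, which is how b ≤ ℓ comes out.
log₂-floor : ∀ b j n → 2 ^ b ≤ n → n < 2 ^ (b + j) → ∃[ ℓ ] (b ≤ ℓ × 2 ^ ℓ ≤ n × n < 2 ^ suc ℓ)
log₂-floor b zero    n lo hi = contradiction (≤-trans hi (≤-reflexive (cong (2 ^_) (+-identityʳ b)))) (≤⇒≯ lo)
log₂-floor b (suc j) n lo hi with n <? 2 ^ (b + j)
... | yes hi′ = log₂-floor b j n lo hi′
... | no ¬hi  = b + j , m≤m+n b j , ≮⇒≥ ¬hi , subst (λ i → n < 2 ^ i) (+-suc b j) hi

-- Here T = |Av_n(312)|, S = ∑ γ and D = 2^q; in the first lemma log₂ n < q + 2 + k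
-- and S / T is compared with (1 − 1/q) log₂ n, in the second one y < log₂ n and
-- S / T is compared with (1 + 1/q) log₂ n.
lower-arithmetic : ∀ {S T D q k} e → 0 < T → q ≡ suc e → q < D → suc D * e * (q + 2) < k →
                   T * D * k ≤ suc D * S → e * (q + 2 + k) * T < S * q
lower-arithmetic {S} {T} {D} {q} {k} e 0<T refl q<D big h = *-cancelˡ-< (suc D) _ _ (begin-strict
  suc D * (e * (q + 2 + k) * T)      ≡⟨ eq₁ (suc D) e (q + 2 + k) T ⟩
  T * (suc D * e * (q + 2 + k))      <⟨ *-monoʳ-< T {{>-nonZero 0<T}} growth ⟩
  T * (q * (D * k))                  ≡⟨ eq₂ T q D k ⟩
  q * (T * D * k)                    ≤⟨ *-monoʳ-≤ q h ⟩
  q * (suc D * S)                    ≡⟨ eq₃ q (suc D) S ⟩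
  suc D * (S * q)                    ∎)
  where
  eq₁ : ∀ D e x T → D * (e * x * T) ≡ T * (D * e * x)
  eq₁ = solve-∀
  eq₂ : ∀ T q D k → T * (q * (D * k)) ≡ q * (T * D * k)
  eq₂ = solve-∀
  eq₃ : ∀ q D S → q * (D * S) ≡ D * (S * q)
  eq₃ = solve-∀
  eq₄ : ∀ D e k r → suc D * e * (r + k) ≡ e * (D * k) + (suc D * e * r + e * k)
  eq₄ = solve-∀
  growth : suc D * e * (q + 2 + k) < q * (D * k)
  growth = begin-strict
    suc D * e * (q + 2 + k)                          ≡⟨ eq₄ D e k (q + 2) ⟩
    e * (D * k) + (suc D * e * (q + 2) + e * k)      <⟨ +-monoʳ-< (e * (D * k)) (+-monoˡ-< (e * k) big) ⟩
    e * (D * k) + suc e * k                          ≤⟨ +-monoʳ-≤ (e * (D * k)) (*-monoˡ-≤ k (<⇒≤ q<D)) ⟩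
    e * (D * k) + D * k                              ≡⟨ +-comm (e * (D * k)) (D * k) ⟩
    q * (D * k)                                      ∎

upper-arithmetic : ∀ {S T D q y} → 0 < T → q < D → q * (D * (1 + q) + (4 + q)) < y →
                   D * S ≤ T * (D * (suc y + q) + (3 + (suc y + q))) → S * q < suc q * y * T
upper-arithmetic {S} {T} {D} {q} {y} 0<T q<D big h = *-cancelˡ-< D _ _ (begin-strict
  D * (S * q)                                          ≡⟨ eq₁ D S q ⟩
  q * (D * S)                                          ≤⟨ *-monoʳ-≤ q h ⟩
  q * (T * (D * (suc y + q) + (3 + (suc y + q))))      ≡⟨ eq₂ q T (D * (suc y + q) + (3 + (suc y + q))) ⟩
  T * (q * (D * (suc y + q) + (3 + (suc y + q))))      <⟨ *-monoʳ-< T {{>-nonZero 0<T}} growth ⟩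
  T * (suc q * (D * y))                                ≡⟨ eq₃ T (suc q) D y ⟩
  D * (suc q * y * T)                                  ∎)
  where
  eq₁ : ∀ D S q → D * (S * q) ≡ q * (D * S)
  eq₁ = solve-∀
  eq₂ : ∀ q T x → q * (T * x) ≡ T * (q * x)
  eq₂ = solve-∀
  eq₃ : ∀ T q D y → T * (q * (D * y)) ≡ D * (q * y * T)
  eq₃ = solve-∀
  eq₄ : ∀ q D y → q * (D * (suc y + q) + (3 + (suc y + q))) ≡ q * (D * y) + (q * (D * (1 + q) + (4 + q)) + q * y)
  eq₄ = solve-∀
  growth : q * (D * (suc y + q) + (3 + (suc y + q))) < suc q * (D * y)
  growth = begin-strict
    q * (D * (suc y + q) + (3 + (suc y + q)))           ≡⟨ eq₄ q D y ⟩
    q * (D * y) + (q * (D * (1 + q) + (4 + q)) + q * y) <⟨ +-monoʳ-< (q * (D * y)) (+-monoˡ-< (q * y) big) ⟩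
    q * (D * y) + suc q * y                             ≤⟨ +-monoʳ-≤ (q * (D * y)) (*-monoˡ-≤ y q<D) ⟩
    q * (D * y) + D * y                                 ≡⟨ +-comm (q * (D * y)) (D * y) ⟩
    suc q * (D * y)                                     ∎

*<-/ : ∀ a d y S T .{{_ : NonZero T}} → a * y * T < S * suc d →
       mkℚᵘ (+ a) d ℚ.* mkℚᵘ (+ y) 0 ℚ.< (+ S) ℚ./ T
*<-/ a d y S (suc T) lt = *<* (subst₂ ℤ._<_
  (trans (ℤ.pos-* (a * y) (suc T)) (cong (ℤ._* + suc T) (ℤ.pos-* a y)))
  (trans (ℤ.pos-* S (suc d)) (cong (λ m → + S ℤ.* + m) (sym (*-identityʳ (suc d)))))
  (ℤ.+<+ lt))

/-<* : ∀ a d y S T .{{_ : NonZero T}} → S * suc d < a * y * T →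
       (+ S) ℚ./ T ℚ.< mkℚᵘ (+ a) d ℚ.* mkℚᵘ (+ y) 0
/-<* a d y S (suc T) lt = *<* (subst₂ ℤ._<_
  (trans (ℤ.pos-* S (suc d)) (cong (λ m → + S ℤ.* + m) (sym (*-identityʳ (suc d)))))
  (trans (ℤ.pos-* (a * y) (suc T)) (cong (ℤ._* + suc T) (ℤ.pos-* a y)))
  (ℤ.+<+ lt))

module _ (p d : ℕ) where
  private
    ε δ : ℚᵘ
    ε = mkℚᵘ (+ suc p) d
    -- `mkℚᵘ` takes the denominator minus one: ε = (p + 1) / (d + 1), and δ = 1 / (d + 2) is
    -- strictly smaller even for p = 0.
    δ = mkℚᵘ (+ 1) (suc d)

    δ<ε : δ ℚ.< ε
    δ<ε = *<* (ℤ.+<+ (begin-strict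
      1 * suc d              ≡⟨ *-identityˡ (suc d) ⟩
      suc d                  <⟨ n<1+n (suc d) ⟩
      suc (suc d)            ≤⟨ m≤m+n (suc (suc d)) (p * suc (suc d)) ⟩
      suc p * suc (suc d)    ∎))

  1-ε< : 1ℚᵘ ℚ.- ε ℚ.< mkℚᵘ (+ suc d) (suc d)
  1-ε< = ℚ.<-respʳ-≃ 1-δ≃ (ℚ.+-monoʳ-< 1ℚᵘ (ℚ.neg-mono-< δ<ε))
    where
    1-δ≃ : 1ℚᵘ ℚ.- δ ℚ.≃ mkℚᵘ (+ suc d) (suc d)
    1-δ≃ = *≡* (cong₂ (λ x y → + suc x ℤ.* + suc (suc y)) (+-identityʳ d) (sym (+-identityʳ d)))

  <1+ε : mkℚᵘ (+ (3 + d)) (suc d) ℚ.< 1ℚᵘ ℚ.+ ε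
  <1+ε = ℚ.<-respˡ-≃ 1+δ≃ (ℚ.+-monoʳ-< 1ℚᵘ δ<ε)
    where
    1+δ≃ : 1ℚᵘ ℚ.+ δ ℚ.≃ mkℚᵘ (+ (3 + d)) (suc d)
    1+δ≃ = *≡* (cong₂ (λ x y → + x ℤ.* + suc (suc y)) (trans (cong (λ x → suc (suc x)) (+-comm (d + 0) 1)) (cong (λ x → suc (suc (suc x))) (+-identityʳ d))) (sym (+-identityʳ d)))

open Largest (λ t → γ (perm 1 t)) paths⇒≤γ ≤γ⇒paths

module _ (d : ℕ) where
  private
    q D big : ℕ
    q = suc (suc d)
    D = 2 ^ q
    -- The sum of the constant errors in the two arithmetic lemmas, so that k ≥ `big` suffices for
    -- both. The relative error of order 1 / D must stay below the allowance 1 / q, which q < D =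
    -- 2^q ensures.
    big = suc D * suc d * (q + 2) + q * (D * (1 + q) + (4 + q))

  -- Here ⌊log₂ n⌋ = q + k + 2, so with c = q the path size ⌊log₂ n⌋ - c - 1 of the lower bound is k
  -- + 1.
  module _ (n k : ℕ) .{{_ : NonZero n}} (big≤k : big ≤ k)
           (lo : 2 ^ suc (q + suc k) ≤ n) (hi : n < 2 ^ suc (suc (q + suc k))) where
    private
      y z S T : ℕ
      y = q + suc k
      z = suc (suc y)
      S = sum (map γ (Av n p312))
      T = length (Av n p312)

      0<T : 0 < T
      0<T = subst (0 <_) (sym (length-Av n)) (C-nonZero n)

      q<D : q < D
      q<D = n<2^n q

      -- The power `n ^ 1` is what the cut of `log₂ n` at the fraction y / 1 unfolds to.
      2^y<n : 2 ^ y < n ^ 1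
      2^y<n = subst (2 ^ y <_) (sym (*-identityʳ n)) (<-≤-trans (^-monoʳ-< 2 ≤-refl (n<1+n y)) lo)

      n<2^z : n ^ 1 < 2 ^ z
      n<2^z = subst (_< 2 ^ z) (sym (*-identityʳ n)) hi

      D*2^ : D * 2 ^ suc (suc k) ≤ suc n
      D*2^ = begin
        D * 2 ^ suc (suc k)      ≡⟨ ^-distribˡ-+-* 2 q (suc (suc k)) ⟨
        2 ^ (q + suc (suc k))    ≡⟨ cong (2 ^_) (+-suc q (suc k)) ⟩
        2 ^ suc y                ≤⟨ lo ⟩
        n                        ≤⟨ n≤1+n n ⟩
        suc n                    ∎

      k<n : suc k ≤ n
      k<n = <⇒≤ (begin-strict
        suc k            ≤⟨ m≤n+m (suc k) q ⟩
        y                <⟨ n<2^n y ⟩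
        2 ^ y            ≤⟨ ^-monoʳ-≤ 2 (n≤1+n y) ⟩
        2 ^ suc y        ≤⟨ lo ⟩
        n                ∎)

      lower : suc d * z * T < S * q
      lower = subst (λ x → suc d * x * T < S * q) (eq q k) (lower-arithmetic (suc d) 0<T refl q<D
        (s≤s (≤-trans (m≤m+n _ _) big≤k))
        (subst₂ (λ t s → t * D * suc k ≤ suc D * s) (sym (length-Av n)) (sym (∑γ-Av n)) (∑L-lower D k n k<n D*2^)))
        where
        eq : ∀ q k → q + 2 + suc k ≡ suc (suc (q + suc k))
        eq = solve-∀

      upper : S * q < suc q * y * T
      upper = upper-arithmetic 0<T q<D
        (≤-trans (s≤s (≤-trans (m≤n+m _ (suc D * suc d * (q + 2))) big≤k)) (m≤n+m (suc k) q))
        (subst₂ (λ t s → D * s ≤ t * (D * (suc y + q) + (3 + (suc y + q)))) (sym (length-Av n)) (sym (∑γ-Av n))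
          (∑L-upper q (suc y) n hi))

      y≤z : y ≤ z
      y≤z = ≤-trans (n≤1+n y) (n≤1+n (suc y))

      T≢0 : NonZero T
      T≢0 = >-nonZero 0<T

    quotient-bounds : Quotient-Lower (E n) (log₂ n) (mkℚᵘ (+ suc d) (suc d)) ×
                      Quotient-Upper (E n) (log₂ n) (mkℚᵘ (+ (3 + d)) (suc d))
    -- The lower comparison is proved at `z` and the upper one at `y`, the harder ends; `y≤z` yields
    -- the other two.
    quotient-bounds =
      mk {y = mkℚᵘ (+ y) 0} {z = mkℚᵘ (+ z) 0} 0<y 2^y<n n<2^z
        (*<-/ (suc d) (suc d) y S T {{T≢0}} (≤-<-trans (*-monoˡ-≤ T (*-monoʳ-≤ (suc d) y≤z)) lower))
        (*<-/ (suc d) (suc d) z S T {{T≢0}} lower) ,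
      mk {y = mkℚᵘ (+ y) 0} {z = mkℚᵘ (+ z) 0} 0<y 2^y<n n<2^z
        (/-<* (3 + d) (suc d) y S T {{T≢0}} upper)
        (/-<* (3 + d) (suc d) z S T {{T≢0}} (<-≤-trans upper (*-monoˡ-≤ T (*-monoʳ-≤ (suc q) y≤z))))
      where
      0<y : 0ℚᵘ ℚ.< mkℚᵘ (+ y) 0
      0<y = *<* (ℤ.+<+ (s≤s z≤n))

  threshold : ℕ
  threshold = 2 ^ suc (q + suc big)

  quotient-sandwich : ∀ n .{{_ : NonZero n}} → threshold ≤ n →
                      Quotient-Lower (E n) (log₂ n) (mkℚᵘ (+ suc d) (suc d)) ×
                      Quotient-Upper (E n) (log₂ n) (mkℚᵘ (+ (3 + d)) (suc d))
  quotient-sandwich n n≥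
    with ℓ , b≤ℓ , lo , hi ← log₂-floor (suc (q + suc big)) n n n≥
           (<-≤-trans (n<2^n n) (^-monoʳ-≤ 2 (m≤n+m n (suc (q + suc big)))))
    -- Writing ℓ = b + o, where 2^b is the threshold, gives k = `big` + o.
    with o , refl ← m≤n⇒∃[o]m+o≡n b≤ℓ
    = quotient-bounds n (big + o) (m≤m+n big o)
        (subst (λ i → 2 ^ suc i ≤ n) (+-assoc q (suc big) o) lo)
        (subst (λ i → n < 2 ^ suc (suc i)) (+-assoc q (suc big) o) hi)

1<threshold : ∀ d → 1 < threshold d
1<threshold d = ≤-trans (≤-trans (s≤s (s≤s z≤n)) (<⇒≤ (n<2^n (suc (suc d))))) (^-monoʳ-≤ 2 (≤-trans (m≤m+n (suc (suc d)) _) (n≤1+n _)))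

proposition2 : E ∼ (λ n → log₂ n)
proposition2 (mkℚᵘ (+ zero) d)    (*<* (ℤ.+<+ ()))
proposition2 (mkℚᵘ -[1+ _ ] d)    (*<* ())
proposition2 (mkℚᵘ (+ suc p) d) _ = threshold d , λ n n≥ →
  let 0<log : 0ℚᵘ <ʳ log₂ n
      -- 0 < log₂ n unfolds to 2^0 < n^1, so the threshold has to exceed 1.
      0<log = subst (1 <_) (sym (*-identityʳ n)) (≤-trans (1<threshold d) n≥)
      lower , upper = quotient-sandwich d n n≥
      q = quotient (E n) (log₂ n) 0<log
  in 0<log , ℝ.lower-closed q (1-ε< p d) lower , ℝ.upper-closed q (<1+ε p d) upper
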